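{- There is no calculus $G$ consisting just of focused axioms and $\mathrm{PPF}$ rules that is sound and feasibly complete for $\mathbf{CPC}$. More precisely, if $G$ is a calculus for $\mathbf{CPC}$ consisting only of focused axioms and $\mathrm{PPF}$ rules, then there exists a sequence of $\mathbf{CPC}$-valid sequents $\phi_n\Rightarrow\psi_n$ with polynomially short (in $n$) tree-like proofs in the classical Hilbert-style system (equivalently in $\mathbf{LK}+\mathrm{Cut}$) such that the length of the shortest tree-like $G$-proof of $\phi_n\Rightarrow\psi_n$ is exponential in $n$.
   Context: Language: classical propositional logic ($\wedge,\vee,\to,\neg,\top,\bot$), with fusion, addition, $1$, $0$ read as $\wedge,\vee,\top,\bot$. Sequents $\Gamma\Rightarrow\Delta$ ($\Gamma,\Delta$ finite multisets, multi-conclusion). $G$ is a calculus for $\mathbf{CPC}$ if $G\vdash\Gamma\Rightarrow\Delta$ iff $\bigwedge\Gamma\to\bigvee\Delta$ is a classical tautology. Rules are schemes over meta-formulas (formulas with formula variables; $V(\cdot)$ = formula variables and atoms occurring) and meta-multiset variables; an instance substitutes formulas and finite multisets of formulas. Lengths are lengths of binary encodings. Focused rules: left: premises $\Gamma_i,\bar\phi_{ir}\Rightarrow\Delta_i$ (all $i\le n$, $r$), conclusion $\Gamma_1,\dots,\Gamma_n,\phi\Rightarrow\Delta_1,\dots,\Delta_n$; right: premises $\Gamma_i\Rightarrow\bar\phi_{ir},\Delta_i$, conclusion $\Gamma_1,\dots,\Gamma_n\Rightarrow\Delta_1,\dots,\Delta_n,\phi$; here $\Gamma_i,\Delta_i$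 are meta-multiset variables and all variables of the $\bar\phi_{ir}$ lie in $V(\phi)$. For a set $\mathcal P$ of formula variables or atoms, a (meta-)formula is $\mathcal P$-monotone if every occurrence of each element of $\mathcal P$ in it is positive (not in the scope of a negation nor in the antecedent of an implication); a multiset is $\mathcal P$-monotone if all its elements are. A focused rule is polarity preserving ($\mathrm{PPF}$) if for every $\mathcal P$, whenever the antecedent of the conclusion is $\mathcal P$-monotone, the antecedents of all premises are $\mathcal P$-monotone. Focused axioms: $\phi\Rightarrow\phi$; $\Rightarrow\bar\alpha$; $\bar\beta\Rightarrow$; $\Gamma,\bar\phi\Rightarrow\Delta$; $\Gamma\Rightarrow\bar\phi,\Delta$, where any two elements of $\bar\alpha$ (resp. $\bar\beta,\bar\phi$) have the same variables and $\Gamma,\Delta$ are meta-multiset variables. -}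

module Defs where

open import Data.Nat using (ℕ; zero; suc; _+_; _*_; _^_; _≤_)
open import Data.Nat.Logarithm using (⌊log₂_⌋)
open import Data.Bool using (Bool; true; false; _∧_; _∨_; not)
open import Data.Fin using (Fin)
open import Data.List using (List; []; _∷_; _++_; map; length; foldr)
open import Data.Nat.ListAction using (sum)
open import Data.List.Relation.Unary.All using (All)
open import Data.List.Membership.Propositional using (_∈_)
open import Data.List.Relation.Binary.Permutation.Propositional using (_↭_)
open import Data.Product using (Σ; _×_; _,_)
open import Data.Empty using (⊥)
open import Data.Unit using (⊤)
open import Relation.Binary.PropositionalEquality using (_≡_)

data Fm : Set where
  atom : ℕ → Fm
  ⊤ᶠ ⊥ᶠ : Fm
  _∧ᶠ_ _∨ᶠ_ _⇒ᶠ_ : Fm → Fm → Fm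
  ¬ᶠ_ : Fm → Fm

-- Meta-formulas: formulas that may also contain formula variables
data MFm : Set where
  fvar : ℕ → MFm
  atom : ℕ → MFm
  ⊤ᵐ ⊥ᵐ : MFm
  _∧ᵐ_ _∨ᵐ_ _⇒ᵐ_ : MFm → MFm → MFm
  ¬ᵐ_ : MFm → MFm

data Var : Set where
  fv : ℕ → Var
  at : ℕ → Var

data Occ : Var → MFm → Set where
  o-fv  : ∀ {k} → Occ (fv k) (fvar k)
  o-at  : ∀ {k} → Occ (at k) (atom k)
  o-∧l  : ∀ {x A B} → Occ x A → Occ x (A ∧ᵐ B)
  o-∧r  : ∀ {x A B} → Occ x B → Occ x (A ∧ᵐ B)
  o-∨l  : ∀ {x A B} → Occ x A → Occ x (A ∨ᵐ B)
  o-∨r  : ∀ {x A B} → Occ x B → Occ x (A ∨ᵐ B)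
  o-⇒l  : ∀ {x A B} → Occ x A → Occ x (A ⇒ᵐ B)
  o-⇒r  : ∀ {x A B} → Occ x B → Occ x (A ⇒ᵐ B)
  o-¬   : ∀ {x A} → Occ x A → Occ x (¬ᵐ A)

_⊆V_ : MFm → MFm → Set
ψ ⊆V φ = ∀ x → Occ x ψ → Occ x φ

SameVars : List MFm → Set
SameVars φs = ∀ {a b} → a ∈ φs → b ∈ φs → (a ⊆V b) × (b ⊆V a)

NoOcc : (Var → Set) → MFm → Set
NoOcc 𝒫 A = ∀ x → Occ x A → 𝒫 x → ⊥

Mono : (Var → Set) → MFm → Set
Mono 𝒫 (fvar k) = ⊤
Mono 𝒫 (atom k) = ⊤
Mono 𝒫 ⊤ᵐ = ⊤
Mono 𝒫 ⊥ᵐ = ⊤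
Mono 𝒫 (A ∧ᵐ B) = Mono 𝒫 A × Mono 𝒫 B
Mono 𝒫 (A ∨ᵐ B) = Mono 𝒫 A × Mono 𝒫 B
Mono 𝒫 (A ⇒ᵐ B) = NoOcc 𝒫 A × Mono 𝒫 B
Mono 𝒫 (¬ᵐ A) = NoOcc 𝒫 A

inst : (ℕ → Fm) → MFm → Fm
inst σ (fvar k) = σ k
inst σ (atom k) = atom k
inst σ ⊤ᵐ = ⊤ᶠ
inst σ ⊥ᵐ = ⊥ᶠ
inst σ (A ∧ᵐ B) = inst σ A ∧ᶠ inst σ B
inst σ (A ∨ᵐ B) = inst σ A ∨ᶠ inst σ B
inst σ (A ⇒ᵐ B) = inst σ A ⇒ᶠ inst σ B
inst σ (¬ᵐ A) = ¬ᶠ inst σ A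

instL : (ℕ → Fm) → List MFm → List Fm
instL σ = map (inst σ)

-- Sequents (multisets represented by lists, taken up to permutation)

record Seq : Set where
  constructor _⇛_
  field
    ante : List Fm
    succ : List Fm
open Seq public

_≈ˢ_ : Seq → Seq → Set
S ≈ˢ T = (ante S ↭ ante T) × (succ S ↭ succ T)

eval : (ℕ → Bool) → Fm → Bool
eval v (atom k) = v k
eval v ⊤ᶠ = true
eval v ⊥ᶠ = false
eval v (A ∧ᶠ B) = eval v A ∧ eval v B
eval v (A ∨ᶠ B) = eval v A ∨ eval v B
eval v (A ⇒ᶠ B) = not (eval v A) ∨ eval v B
eval v (¬ᶠ A) = not (eval v A)

Tautology : Fm → Set
Tautology A = ∀ v → eval v A ≡ true

⋀ : List Fm → Fm
⋀ = foldr _∧ᶠ_ ⊤ᶠ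

⋁ : List Fm → Fm
⋁ = foldr _∨ᶠ_ ⊥ᶠ

Valid : Seq → Set
Valid S = Tautology (⋀ (ante S) ⇒ᶠ ⋁ (succ S))

bitlen : ℕ → ℕ
bitlen k = suc ⌊log₂ (suc k) ⌋

fsize : Fm → ℕ
fsize (atom k) = suc (bitlen k)
fsize ⊤ᶠ = 1
fsize ⊥ᶠ = 1
fsize (A ∧ᶠ B) = suc (fsize A + fsize B)
fsize (A ∨ᶠ B) = suc (fsize A + fsize B)
fsize (A ⇒ᶠ B) = suc (fsize A + fsize B)
fsize (¬ᶠ A) = suc (fsize A)

seqSize : Seq → ℕ
seqSize S = suc (sum (map fsize (ante S)) + sum (map fsize (succ S)))

sumFin : (n : ℕ) → (Fin n → ℕ) → ℕ
sumFin zero f = 0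
sumFin (suc n) f = f Fin.zero + sumFin n (λ i → f (Fin.suc i))

concatFin : (n : ℕ) → (Fin n → List Fm) → List Fm
concatFin zero f = []
concatFin (suc n) f = f Fin.zero ++ concatFin n (λ i → f (Fin.suc i))

data AxScheme : Set where
  idAx   : MFm → AxScheme               --  φ ⇒ φ
  rAx    : List MFm → AxScheme          --  ⇒ ᾱ
  lAx    : List MFm → AxScheme          --  β̄ ⇒
  lCtxAx : List MFm → AxScheme          --  Γ, φ̄ ⇒ Δ
  rCtxAx : List MFm → AxScheme          --  Γ ⇒ φ̄, Δ

FocusedAxiom : AxScheme → Set
FocusedAxiom (idAx φ) = ⊤
FocusedAxiom (rAx αs) = SameVars αs
FocusedAxiom (lAx βs) = SameVars βs
FocusedAxiom (lCtxAx φs) = SameVars φs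
FocusedAxiom (rCtxAx φs) = SameVars φs

-- instance: σ for formula variables, Γ Δ for the meta-multiset variables
axInst : AxScheme → (ℕ → Fm) → List Fm → List Fm → Seq
axInst (idAx φ) σ Γ Δ = (inst σ φ ∷ []) ⇛ (inst σ φ ∷ [])
axInst (rAx αs) σ Γ Δ = [] ⇛ instL σ αs
axInst (lAx βs) σ Γ Δ = instL σ βs ⇛ []
axInst (lCtxAx φs) σ Γ Δ = (Γ ++ instL σ φs) ⇛ Δ
axInst (rCtxAx φs) σ Γ Δ = Γ ⇛ (instL σ φs ++ Δ)

-- Focused rules (as schemes).  Γᵢ, Δᵢ (i < n) are pairwise distinct
-- meta-multiset variables; prem i lists the multisets φ̄ᵢᵣ (r ranging over
-- the positions of the list).

data Side : Set where
  left right : Side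

record FRule : Set where
  field
    side : Side
    n    : ℕ
    main : MFm
    prem : Fin n → List (List MFm)
open FRule public

FocusedRule : FRule → Set
FocusedRule R = ∀ i {φs} → φs ∈ prem R i → ∀ {ψ} → ψ ∈ φs → ψ ⊆V main R

-- meta-formulas occurring in the antecedent of the conclusion / of a premise
-- (meta-multiset variables contain no formula variables or atoms)
conclAnteM : FRule → List MFm
conclAnteM R with side R
... | left = main R ∷ []
... | right = []

premAnteM : FRule → List MFm → List MFm
premAnteM R φs with side R
... | left = φs
... | right = []

PPF : FRule → Set₁
PPF R = ∀ (𝒫 : Var → Set) → All (Mono 𝒫) (conclAnteM R) →
        ∀ i {φs} → φs ∈ prem R i → All (Mono 𝒫) (premAnteM R φs)

premInst : (R : FRule) → (ℕ → Fm) → (Γ Δ : Fin (n R) → List Fm) → (i : Fin (n R)) → List MFm → Seq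
premInst R σ Γ Δ i φs with side R
... | left = (Γ i ++ instL σ φs) ⇛ Δ i
... | right = Γ i ⇛ (instL σ φs ++ Δ i)

conclInst : (R : FRule) → (ℕ → Fm) → (Γ Δ : Fin (n R) → List Fm) → Seq
conclInst R σ Γ Δ with side R
... | left = (concatFin (n R) Γ ++ inst σ (main R) ∷ []) ⇛ concatFin (n R) Δ
... | right = concatFin (n R) Γ ⇛ (concatFin (n R) Δ ++ inst σ (main R) ∷ [])

record Calculus : Set where
  field
    axioms : List AxScheme
    rules  : List FRule
open Calculus public


lookupF : (xs : List (List MFm)) → Fin (length xs) → List MFm
lookupF (x ∷ xs) Fin.zero = x
lookupF (x ∷ xs) (Fin.suc k) = lookupF xs k

data GProof (G : Calculus) : Seq → Set where
  axN   : ∀ {S} (a : AxScheme) → a ∈ axioms G → (σ : ℕ → Fm) (Γ Δ : List Fm) →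
          S ≈ˢ axInst a σ Γ Δ → GProof G S
  ruleN : ∀ {S} (R : FRule) → R ∈ rules G → (σ : ℕ → Fm) (Γ Δ : Fin (n R) → List Fm) →
          S ≈ˢ conclInst R σ Γ Δ →
          ((i : Fin (n R)) (r : Fin (length (prem R i))) →
            GProof G (premInst R σ Γ Δ i (lookupF (prem R i) r))) →
          GProof G S

gsize : ∀ {G S} → GProof G S → ℕ
gsize {S = S} (axN _ _ _ _ _ _) = seqSize S
gsize {S = S} (ruleN R _ _ _ _ _ ps) =
  seqSize S + sumFin (n R) (λ i → sumFin (length (prem R i)) (λ r → gsize (ps i r)))

CalculusForCPC : Calculus → Set
CalculusForCPC G = ∀ S → (GProof G S → Valid S) × (Valid S → GProof G S)

-- LK + Cut (tree-like), multisets via an explicit exchange rule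

data LK : Seq → Set where
  ax   : ∀ {A} → LK ((A ∷ []) ⇛ (A ∷ []))
  ⊥L   : LK ((⊥ᶠ ∷ []) ⇛ [])
  ⊤R   : LK ([] ⇛ (⊤ᶠ ∷ []))
  exch : ∀ {Γ Γ' Δ Δ'} → Γ ↭ Γ' → Δ ↭ Δ' → LK (Γ ⇛ Δ) → LK (Γ' ⇛ Δ')
  wL   : ∀ {A Γ Δ} → LK (Γ ⇛ Δ) → LK ((A ∷ Γ) ⇛ Δ)
  wR   : ∀ {A Γ Δ} → LK (Γ ⇛ Δ) → LK (Γ ⇛ (A ∷ Δ))
  cL   : ∀ {A Γ Δ} → LK ((A ∷ A ∷ Γ) ⇛ Δ) → LK ((A ∷ Γ) ⇛ Δ)
  cR   : ∀ {A Γ Δ} → LK (Γ ⇛ (A ∷ A ∷ Δ)) → LK (Γ ⇛ (A ∷ Δ))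
  ∧L   : ∀ {A B Γ Δ} → LK ((A ∷ B ∷ Γ) ⇛ Δ) → LK (((A ∧ᶠ B) ∷ Γ) ⇛ Δ)
  ∧R   : ∀ {A B Γ Δ} → LK (Γ ⇛ (A ∷ Δ)) → LK (Γ ⇛ (B ∷ Δ)) → LK (Γ ⇛ ((A ∧ᶠ B) ∷ Δ))
  ∨L   : ∀ {A B Γ Δ} → LK ((A ∷ Γ) ⇛ Δ) → LK ((B ∷ Γ) ⇛ Δ) → LK (((A ∨ᶠ B) ∷ Γ) ⇛ Δ)
  ∨R   : ∀ {A B Γ Δ} → LK (Γ ⇛ (A ∷ B ∷ Δ)) → LK (Γ ⇛ ((A ∨ᶠ B) ∷ Δ))
  ⇒L   : ∀ {A B Γ Δ} → LK (Γ ⇛ (A ∷ Δ)) → LK ((B ∷ Γ) ⇛ Δ) → LK (((A ⇒ᶠ B) ∷ Γ) ⇛ Δ)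
  ⇒R   : ∀ {A B Γ Δ} → LK ((A ∷ Γ) ⇛ (B ∷ Δ)) → LK (Γ ⇛ ((A ⇒ᶠ B) ∷ Δ))
  ¬L   : ∀ {A Γ Δ} → LK (Γ ⇛ (A ∷ Δ)) → LK (((¬ᶠ A) ∷ Γ) ⇛ Δ)
  ¬R   : ∀ {A Γ Δ} → LK ((A ∷ Γ) ⇛ Δ) → LK (Γ ⇛ ((¬ᶠ A) ∷ Δ))
  cut  : ∀ {A Γ Δ} → LK (Γ ⇛ (A ∷ Δ)) → LK ((A ∷ Γ) ⇛ Δ) → LK (Γ ⇛ Δ)

lksize : ∀ {S} → LK S → ℕ
lksize {S} ax = seqSize S
lksize {S} ⊥L = seqSize S
lksize {S} ⊤R = seqSize S
lksize {S} (exch _ _ p) = seqSize S + lksize p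
lksize {S} (wL p) = seqSize S + lksize p
lksize {S} (wR p) = seqSize S + lksize p
lksize {S} (cL p) = seqSize S + lksize p
lksize {S} (cR p) = seqSize S + lksize p
lksize {S} (∧L p) = seqSize S + lksize p
lksize {S} (∧R p q) = seqSize S + lksize p + lksize q
lksize {S} (∨L p q) = seqSize S + lksize p + lksize q
lksize {S} (∨R p) = seqSize S + lksize p
lksize {S} (⇒L p q) = seqSize S + lksize p + lksize q
lksize {S} (⇒R p) = seqSize S + lksize p
lksize {S} (¬L p) = seqSize S + lksize p
lksize {S} (¬R p) = seqSize S + lksize p
lksize {S} (cut p q) = seqSize S + lksize p + lksize q

{-# OPTIONS --safe #-}
-- A proof of φ ⇒ ψ in which every left rule preserves P-monotonicity is a communication protocol: Alice holds an
-- assignment making φ true, Bob one making ψ false, and walking up the proof (Alice chooses at left rules, Bob at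
-- right rules, which is possible because the rules are sound) they reach an instance of A ⇒ A over the common atoms,
-- hence a common atom that is true for Alice and false for Bob.  So it is enough to find φ and ψ with short LK proofs
-- for which every such protocol has exponentially many leaves.
--
-- The formulas encode the principle that, if each of the nodes 0, ..., N either is dead or points to a smaller
-- node, and N is not dead, then some node points to a dead node; it is proved by showing successively that the
-- nodes 0, 1, ..., N are all dead.  The value at node i is Bob's entry y i (x i) at the row x i chosen by
-- Alice, and the common atoms name pairs of rows.  The lower bound is a Raz–McKenzie style simulation: as long as
-- Alice's set of inputs is large in every coordinate the protocol is followed by halving; once a coordinate has become
-- too predictable its value is fixed by an adversary that keeps a path of pointers ending at the largest free node
-- and declares every other queried node dead, and projecting the coordinate away makes Alice's set denser.
module Submission where

open import Defs
open import Data.Bool using (Bool; true; false; _∧_; _∨_; not; if_then_else_)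
open import Data.Bool.Properties using (∧-identityʳ; ∧-zeroʳ; ∨-zeroʳ; T-≡)
open import Data.Empty using (⊥; ⊥-elim)
open import Data.Fin using (Fin; punchIn; punchOut; toℕ; fromℕ<) renaming (zero to fzero; suc to fsuc)
import Data.Fin as Fin
open import Data.Fin.Properties using (any?; toℕ<n; toℕ≤pred[n]; toℕ-fromℕ<; toℕ-injective; punchIn-punchOut)
open import Data.List using (List; []; _∷_; _++_; map; length; concatMap; tabulate; allFin)
open import Data.List.Membership.Propositional using (_∈_)
open import Data.List.Membership.Propositional.Properties using (∈-++⁺ˡ; ∈-++⁺ʳ; ∈-map⁺; ∈-allFin; ∈-∃++)
open import Data.List.Properties using (length-++; length-map; length-tabulate)
open import Data.List.Relation.Binary.Permutation.Propositional using (_↭_; ↭-refl; ↭-sym; ↭-trans; prep)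
open import Data.List.Relation.Binary.Permutation.Propositional.Properties using (All-resp-↭; shift; ↭-length; ++-comm) renaming (map⁺ to ↭-map⁺)
open import Data.List.Relation.Binary.Subset.Propositional using (_⊆_)
open import Data.List.Relation.Unary.All using (All; []; _∷_)
import Data.List.Relation.Unary.All as All
open import Data.List.Relation.Unary.All.Properties using (++⁺; ++⁻ˡ; ++⁻ʳ; map⁺)
open import Data.List.Relation.Unary.Any using (here; there)
open import Data.Nat
open import Data.Nat.DivMod
open import Data.Nat.Divisibility using (divides-refl)
open import Data.Nat.ListAction using (sum)
open import Data.Nat.ListAction.Properties using (sum-↭)
open import Data.Nat.Logarithm using (⌊log₂⌋-mono-≤; ⌊log₂[2^n]⌋≡n)
open import Data.Nat.Properties
open import Data.Nat.Tactic.RingSolver using (solve-∀)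
open import Data.Product using (Σ; ∃; _×_; _,_; proj₁; proj₂)
open import Data.Sum using (_⊎_; inj₁; inj₂)
open import Data.Unit using (⊤; tt)
open import Data.Vec using (Vec; []; _∷_; insertAt; removeAt; lookup; replicate)
open import Data.Vec.Properties using (insertAt-lookup; insertAt-punchIn; insertAt-removeAt; removeAt-insertAt)
open import Function using (_∘_; id)
open import Function.Bundles using (Equivalence)
open import Relation.Binary.PropositionalEquality
open import Relation.Nullary using (¬_; yes; no; does)
open import Relation.Nullary.Decidable using (_×-dec_)

-- Finite sums and counting

sumL : {A : Set} → List A → (A → ℕ) → ℕ
sumL [] f = 0
sumL (x ∷ xs) f = f x + sumL xs f

module _ {A : Set} where

  sumL-mono : ∀ (xs : List A) {f g : A → ℕ} → (∀ a → f a ≤ g a) → sumL xs f ≤ sumL xs g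
  sumL-mono [] h = z≤n
  sumL-mono (x ∷ xs) h = +-mono-≤ (h x) (sumL-mono xs h)

  sumL-cong : ∀ (xs : List A) {f g : A → ℕ} → (∀ a → f a ≡ g a) → sumL xs f ≡ sumL xs g
  sumL-cong [] h = refl
  sumL-cong (x ∷ xs) h = cong₂ _+_ (h x) (sumL-cong xs h)

  sumL-+ : ∀ (xs : List A) (f g : A → ℕ) → sumL xs (λ a → f a + g a) ≡ sumL xs f + sumL xs g
  sumL-+ [] f g = refl
  sumL-+ (x ∷ xs) f g rewrite sumL-+ xs f g = lem (f x) (g x) (sumL xs f) (sumL xs g)
    where
    lem : ∀ a b c d → a + b + (c + d) ≡ a + c + (b + d)
    lem = solve-∀

  sumL-* : ∀ (xs : List A) c (f : A → ℕ) → sumL xs (λ a → c * f a) ≡ c * sumL xs f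
  sumL-* [] c f = sym (*-zeroʳ c)
  sumL-* (x ∷ xs) c f rewrite sumL-* xs c f = sym (*-distribˡ-+ c (f x) (sumL xs f))

  sumL-const : ∀ (xs : List A) c → sumL xs (λ _ → c) ≡ length xs * c
  sumL-const [] c = refl
  sumL-const (x ∷ xs) c = cong (c +_) (sumL-const xs c)

  sumL-++ : ∀ (xs ys : List A) (f : A → ℕ) → sumL (xs ++ ys) f ≡ sumL xs f + sumL ys f
  sumL-++ [] ys f = refl
  sumL-++ (x ∷ xs) ys f rewrite sumL-++ xs ys f = sym (+-assoc (f x) _ _)

  sumL-strict : ∀ {xs : List A} {f g : A → ℕ} {a} → a ∈ xs → (∀ a → f a ≤ g a) → f a < g a →
                sumL xs f < sumL xs g
  sumL-strict {x ∷ xs} (here refl) h lt = +-mono-<-≤ lt (sumL-mono xs h)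
  sumL-strict {x ∷ xs} (there m) h lt = +-mono-≤-< (h x) (sumL-strict m h lt)

sumL-map : {A B : Set} (h : A → B) (xs : List A) (f : B → ℕ) → sumL (map h xs) f ≡ sumL xs (f ∘ h)
sumL-map h [] f = refl
sumL-map h (x ∷ xs) f = cong (f (h x) +_) (sumL-map h xs f)

sumL-swap : {A B : Set} (xs : List A) (ys : List B) (f : A → B → ℕ) →
            sumL xs (λ a → sumL ys (f a)) ≡ sumL ys (λ b → sumL xs (λ a → f a b))
sumL-swap [] ys f = sym (trans (sumL-const ys 0) (*-zeroʳ (length ys)))
sumL-swap (x ∷ xs) ys f rewrite sumL-swap xs ys f = sym (sumL-+ ys (f x) _)

b2n : Bool → ℕ
b2n true = 1
b2n false = 0

b2n≤1 : ∀ b → b2n b ≤ 1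
b2n≤1 true = s≤s z≤n
b2n≤1 false = z≤n

b2n-mono : ∀ {a b} → (a ≡ true → b ≡ true) → b2n a ≤ b2n b
b2n-mono {false} h = z≤n
b2n-mono {true} h rewrite h refl = ≤-refl

cnt : {A : Set} → List A → (A → Bool) → ℕ
cnt xs P = sumL xs (λ a → b2n (P a))

module _ {A : Set} where

  cnt-mono : ∀ (xs : List A) {P Q : A → Bool} → (∀ a → P a ≡ true → Q a ≡ true) → cnt xs P ≤ cnt xs Q
  cnt-mono xs h = sumL-mono xs (λ a → b2n-mono (h a))

  cnt≤length : ∀ (xs : List A) (P : A → Bool) → cnt xs P ≤ length xs
  cnt≤length [] P = z≤n
  cnt≤length (x ∷ xs) P = +-mono-≤ (b2n≤1 (P x)) (cnt≤length xs P)

  cnt-∈ : ∀ {xs : List A} {a} (P : A → Bool) → a ∈ xs → P a ≡ true → 0 < cnt xs P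
  cnt-∈ P (here refl) e rewrite e = s≤s z≤n
  cnt-∈ {x ∷ xs} P (there m) e = ≤-trans (cnt-∈ P m e) (m≤n+m _ (b2n (P x)))

  cnt-split : ∀ (xs : List A) (P Q : A → Bool) →
              cnt xs P ≡ cnt xs (λ a → P a ∧ Q a) + cnt xs (λ a → P a ∧ not (Q a))
  cnt-split xs P Q = trans (sumL-cong xs (λ a → lem (P a) (Q a))) (sumL-+ xs _ _)
    where
    lem : ∀ p q → b2n p ≡ b2n (p ∧ q) + b2n (p ∧ not q)
    lem true true = refl
    lem true false = refl
    lem false q = refl

  search : List A → (A → Bool) → A → A
  search [] P d = d
  search (x ∷ xs) P d = if P x then x else search xs P d

  search-true : ∀ xs P d → 0 < cnt xs P → P (search xs P d) ≡ true
  search-true (x ∷ xs) P d lt with P x in eq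
  ... | true = eq
  ... | false = search-true xs P d lt

  cnt>0⇒∃ : ∀ xs (P : A → Bool) → 0 < cnt xs P → ∃ λ a → P a ≡ true
  cnt>0⇒∃ (x ∷ xs) P lt with P x in eq
  ... | true = x , eq
  ... | false = cnt>0⇒∃ xs P lt

prepend : {A : Set} → ∀ {k} → List (Vec A k) → A → List (Vec A (suc k))
prepend vs a = map (Vec._∷_ a) vs

0<ᵇ-true : ∀ {j} → 0 < j → (0 <ᵇ j) ≡ true
0<ᵇ-true (s≤s _) = refl

true-0<ᵇ : ∀ {j} → (0 <ᵇ j) ≡ true → 0 < j
true-0<ᵇ {suc j} e = s≤s z≤n

allVec : {A : Set} → List A → ∀ k → List (Vec A k)
allVec xs zero = [] ∷ []
allVec xs (suc k) = concatMap (prepend (allVec xs k)) xs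

module _ {A : Set} (xs : List A) where

  private
    sumL-concatMap : ∀ {k} (ys : List A) (vs : List (Vec A k)) (f : Vec A (suc k) → ℕ) →
      sumL (concatMap (prepend vs) ys) f ≡ sumL ys (λ a → sumL vs (λ v → f (a ∷ v)))
    sumL-concatMap [] vs f = refl
    sumL-concatMap (y ∷ ys) vs f
      rewrite sumL-++ (prepend vs y) (concatMap (prepend vs) ys) f
            | sumL-map (Vec._∷_ y) vs f | sumL-concatMap ys vs f = refl

    ∈-concatMap′ : ∀ {k} {a} (ys : List A) (vs : List (Vec A k)) {v} → a ∈ ys → v ∈ vs →
      (a ∷ v) ∈ concatMap (prepend vs) ys
    ∈-concatMap′ (y ∷ ys) vs (here refl) mv = ∈-++⁺ˡ (∈-map⁺ (Vec._∷_ y) mv)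
    ∈-concatMap′ (y ∷ ys) vs (there m) mv = ∈-++⁺ʳ (prepend vs y) (∈-concatMap′ ys vs m mv)

    length-concatMap : ∀ {k} (ys : List A) (vs : List (Vec A k)) →
      length (concatMap (prepend vs) ys) ≡ length ys * length vs
    length-concatMap [] vs = refl
    length-concatMap (y ∷ ys) vs
      rewrite length-++ (prepend vs y) {concatMap (prepend vs) ys}
            | length-map (Vec._∷_ y) vs | length-concatMap ys vs = refl

  sumL-allVec : ∀ k (f : Vec A (suc k) → ℕ) →
    sumL (allVec xs (suc k)) f ≡ sumL xs (λ a → sumL (allVec xs k) (λ v → f (a ∷ v)))
  sumL-allVec k f = sumL-concatMap xs (allVec xs k) f

  length-allVec : ∀ k → length (allVec xs k) ≡ length xs ^ k
  length-allVec zero = refl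
  length-allVec (suc k) = trans (length-concatMap xs (allVec xs k)) (cong (length xs *_) (length-allVec k))

  ∈-allVec : (∀ a → a ∈ xs) → ∀ {k} (v : Vec A k) → v ∈ allVec xs k
  ∈-allVec h [] = here refl
  ∈-allVec h (a ∷ v) = ∈-concatMap′ xs (allVec xs _) (h a) (∈-allVec h v)

  sumL-insertAt : ∀ k (i : Fin (suc k)) (f : Vec A (suc k) → ℕ) →
    sumL (allVec xs (suc k)) f ≡ sumL (allVec xs k) (λ w → sumL xs (λ a → f (insertAt w i a)))
  sumL-insertAt k fzero f =
    trans (sumL-allVec k f) (sumL-swap xs (allVec xs k) (λ a v → f (a ∷ v)))
  sumL-insertAt (suc k) (fsuc i) f = begin
    sumL (allVec xs (suc (suc k))) f
      ≡⟨ sumL-allVec (suc k) f ⟩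
    sumL xs (λ b → sumL (allVec xs (suc k)) (λ v → f (b ∷ v)))
      ≡⟨ sumL-cong xs (λ b → sumL-insertAt k i (λ v → f (b ∷ v))) ⟩
    sumL xs (λ b → sumL (allVec xs k) (λ w → sumL xs (λ a → f (b ∷ insertAt w i a))))
      ≡⟨ sumL-allVec k (λ w → sumL xs (λ a → f (insertAt w (fsuc i) a))) ⟨
    sumL (allVec xs (suc k)) (λ w → sumL xs (λ a → f (insertAt w (fsuc i) a))) ∎
    where open ≡-Reasoning

  deg : ∀ {k} → (Vec A (suc k) → Bool) → Fin (suc k) → Vec A k → ℕ
  deg X i w = cnt xs (λ a → X (insertAt w i a))

  proj : ∀ {k} → (Vec A (suc k) → Bool) → Fin (suc k) → Vec A k → Bool
  proj X i w = 0 <ᵇ deg X i w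

  card : ∀ {k} → (Vec A k → Bool) → ℕ
  card {k} X = cnt (allVec xs k) X

  card-deg : ∀ {k} (X : Vec A (suc k) → Bool) i → card X ≡ sumL (allVec xs k) (deg X i)
  card-deg {k} X i = sumL-insertAt k i (λ v → b2n (X v))

  card≤ : ∀ {k} (X : Vec A k → Bool) → card X ≤ length xs ^ k
  card≤ {k} X = ≤-trans (cnt≤length (allVec xs k) X) (≤-reflexive (length-allVec k))

  card≤proj : ∀ {k} (X : Vec A (suc k) → Bool) i → card X ≤ length xs * card (proj X i)
  card≤proj {k} X i = begin
    card X                                                    ≡⟨ card-deg X i ⟩
    sumL (allVec xs k) (deg X i)                              ≤⟨ sumL-mono (allVec xs k) pt ⟩
    sumL (allVec xs k) (λ w → length xs * b2n (proj X i w))   ≡⟨ sumL-* (allVec xs k) (length xs) _ ⟩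
    length xs * card (proj X i)                               ∎
    where
    open ≤-Reasoning
    pt : ∀ w → deg X i w ≤ length xs * b2n (proj X i w)
    pt w with deg X i w | cnt≤length xs (λ a → X (insertAt w i a))
    ... | zero | _ = z≤n
    ... | suc d | le rewrite *-identityʳ (length xs) = le

insertAt-comm : {A : Set} → ∀ {k} (i : Fin (suc (suc k))) (j : Fin (suc k)) → ∃ λ i′ →
  ∀ (w : Vec A k) a u → insertAt (insertAt w j a) i u ≡ insertAt (insertAt w i′ u) (punchIn i j) a
insertAt-comm fzero j = fzero , λ w a u → refl
insertAt-comm (fsuc i) fzero = i , λ w a u → refl
insertAt-comm {k = suc k} (fsuc i) (fsuc j) with insertAt-comm i j
... | i′ , eq = fsuc i′ , λ { (b ∷ w) a u → cong (b ∷_) (eq w a u) }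

≤ᵇ-true : ∀ {m n} → m ≤ n → (m ≤ᵇ n) ≡ true
≤ᵇ-true le = Equivalence.to T-≡ (≤⇒≤ᵇ le)

true-≤ᵇ : ∀ {m n} → (m ≤ᵇ n) ≡ true → m ≤ n
true-≤ᵇ {m} {n} e = ≤ᵇ⇒≤ m n (Equivalence.from T-≡ e)

sumFin-mono : ∀ n {f g : Fin n → ℕ} → (∀ i → f i ≤ g i) → sumFin n f ≤ sumFin n g
sumFin-mono zero h = z≤n
sumFin-mono (suc n) h = +-mono-≤ (h fzero) (sumFin-mono n (λ i → h (fsuc i)))

sumFin-const : ∀ n c → sumFin n (λ _ → c) ≡ n * c
sumFin-const zero c = refl
sumFin-const (suc n) c = cong (c +_) (sumFin-const n c)

sumFin-* : ∀ n c (f : Fin n → ℕ) → sumFin n (λ i → c * f i) ≡ c * sumFin n f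
sumFin-* zero c f = sym (*-zeroʳ c)
sumFin-* (suc n) c f rewrite sumFin-* n c (λ i → f (fsuc i)) = sym (*-distribˡ-+ c (f fzero) _)

sumFin-exchange : ∀ n {f g : Fin n → ℕ} → (∀ i → g i ≤ f i) → ∀ i →
  sumFin n g + f i ≤ sumFin n f + g i
sumFin-exchange (suc n) {f} {g} h fzero = begin
  g fzero + sumFin n (g ∘ fsuc) + f fzero   ≡⟨ lem (g fzero) _ (f fzero) ⟩
  f fzero + sumFin n (g ∘ fsuc) + g fzero   ≤⟨ +-monoˡ-≤ (g fzero) (+-monoʳ-≤ (f fzero) (sumFin-mono n (λ i → h (fsuc i)))) ⟩
  f fzero + sumFin n (f ∘ fsuc) + g fzero   ∎
  where
  open ≤-Reasoning
  lem : ∀ a b c → a + b + c ≡ c + b + a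
  lem = solve-∀
sumFin-exchange (suc n) {f} {g} h (fsuc i) = begin
  g fzero + sumFin n (g ∘ fsuc) + f (fsuc i)   ≡⟨ +-assoc (g fzero) _ _ ⟩
  g fzero + (sumFin n (g ∘ fsuc) + f (fsuc i)) ≤⟨ +-mono-≤ (h fzero) (sumFin-exchange n (λ i → h (fsuc i)) i) ⟩
  f fzero + (sumFin n (f ∘ fsuc) + g (fsuc i)) ≡⟨ +-assoc (f fzero) _ _ ⟨
  f fzero + sumFin n (f ∘ fsuc) + g (fsuc i)   ∎
  where open ≤-Reasoning

∧-true : ∀ {a b} → a ∧ b ≡ true → (a ≡ true) × (b ≡ true)
∧-true {true} {true} e = refl , refl

_⊆ᵇ_ : {A : Set} → (A → Bool) → (A → Bool) → Set
X ⊆ᵇ Y = ∀ x → X x ≡ true → Y x ≡ true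

module _ {A : Set} (xs : List A) (full : ∀ a → a ∈ xs) where

  Thick : ∀ {k} → ℕ → (Vec A (suc k) → Bool) → Set
  Thick δ X = ∀ i w → 0 < deg xs X i w → δ ≤ deg xs X i w

  deg-mono : ∀ {k} {X Y : Vec A (suc k) → Bool} → X ⊆ᵇ Y → ∀ i w → deg xs X i w ≤ deg xs Y i w
  deg-mono s i w = cnt-mono xs (λ a → s (insertAt w i a))

  proj-mono : ∀ {k} {X Y : Vec A (suc k) → Bool} → X ⊆ᵇ Y → ∀ i → proj xs X i ⊆ᵇ proj xs Y i
  proj-mono s i w e = 0<ᵇ-true (≤-trans (true-0<ᵇ e) (deg-mono s i w))

  private
    trim : ∀ {k} → ℕ → Fin (suc k) → (Vec A (suc k) → Bool) → Vec A (suc k) → Bool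
    trim δ i X x = X x ∧ (δ ≤ᵇ deg xs X i (removeAt x i))

    trim⊆ : ∀ {k} δ (i : Fin (suc k)) X → trim δ i X ⊆ᵇ X
    trim⊆ δ i X x e = proj₁ (∧-true e)

    deg-trim : ∀ {k} δ (i : Fin (suc k)) X w →
      (δ ≤ deg xs X i w × deg xs (trim δ i X) i w ≡ deg xs X i w) ⊎
      (deg xs X i w < δ × deg xs (trim δ i X) i w ≡ 0)
    deg-trim δ i X w with δ ≤ᵇ deg xs X i w in eq
    ... | true = inj₁ (true-≤ᵇ eq , sumL-cong xs λ a → cong b2n (lem a))
      where
      lem : ∀ a → trim δ i X (insertAt w i a) ≡ X (insertAt w i a)
      lem a rewrite removeAt-insertAt w i a | eq = ∧-identityʳ _
    ... | false = inj₂ (≰⇒> (λ le → case≢ (trans (sym (≤ᵇ-true le)) eq)) ,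
                        trans (sumL-cong xs λ a → cong b2n (lem a)) (trans (sumL-const xs 0) (*-zeroʳ (length xs))))
      where
      case≢ : true ≡ false → ⊥
      case≢ ()
      lem : ∀ a → trim δ i X (insertAt w i a) ≡ false
      lem a rewrite removeAt-insertAt w i a | eq = ∧-zeroʳ _

    trim-loss : ∀ {k} δ (i : Fin (suc k)) X →
      card xs X + δ * card xs (proj xs (trim δ i X) i) ≤
      card xs (trim δ i X) + δ * card xs (proj xs X i)
    trim-loss {k} δ i X = begin
      card xs X + δ * card xs (proj xs X₁ i)
        ≡⟨ cong₂ _+_ (card-deg xs X i) (sym (sumL-* vs δ _)) ⟩
      sumL vs (deg xs X i) + sumL vs (λ w → δ * b2n (proj xs X₁ i w))
        ≡⟨ sumL-+ vs _ _ ⟨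
      sumL vs (λ w → deg xs X i w + δ * b2n (proj xs X₁ i w))
        ≤⟨ sumL-mono vs pt ⟩
      sumL vs (λ w → deg xs X₁ i w + δ * b2n (proj xs X i w))
        ≡⟨ sumL-+ vs _ _ ⟩
      sumL vs (deg xs X₁ i) + sumL vs (λ w → δ * b2n (proj xs X i w))
        ≡⟨ cong₂ _+_ (sym (card-deg xs X₁ i)) (sumL-* vs δ _) ⟩
      card xs X₁ + δ * card xs (proj xs X i) ∎
      where
      open ≤-Reasoning
      X₁ = trim δ i X
      vs = allVec xs k
      light : ∀ d → d < δ → d + δ * 0 ≤ δ * b2n (0 <ᵇ d)
      light zero lt rewrite *-zeroʳ δ = z≤n
      light (suc d) lt rewrite *-zeroʳ δ | *-identityʳ δ | +-identityʳ d = <⇒≤ lt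
      pt : ∀ w → deg xs X i w + δ * b2n (proj xs X₁ i w) ≤ deg xs X₁ i w + δ * b2n (proj xs X i w)
      pt w with deg-trim δ i X w
      ... | inj₁ (_ , eq) rewrite eq = ≤-refl
      ... | inj₂ (lt , eq) rewrite eq = light (deg xs X i w) lt

    trim-strict : ∀ {k} δ (i : Fin (suc k)) X w → 0 < deg xs X i w → deg xs X i w < δ →
      card xs (trim δ i X) < card xs X
    trim-strict {k} δ i X w pos lt rewrite card-deg xs (trim δ i X) i | card-deg xs X i =
      sumL-strict (∈-allVec xs full w) (deg-mono (trim⊆ δ i X) i) at-w
      where
      at-w : deg xs (trim δ i X) i w < deg xs X i w
      at-w with deg-trim δ i X w
      ... | inj₁ (le , _) = ⊥-elim (<⇒≱ lt le)
      ... | inj₂ (_ , eq) rewrite eq = pos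

  -- Deleting the light lines in one direction loses at most δ points per line deleted,
  -- so the total loss is paid for by the decrease of the projections.
  thicken : ∀ {k} δ (X : Vec A (suc k) → Bool) → ∃ λ X′ → X′ ⊆ᵇ X × Thick δ X′ ×
    card xs X ≤ card xs X′ + δ * sumFin (suc k) (λ i → card xs (proj xs X i))
  thicken {k} δ X = go (card xs X) X ≤-refl
    where
    Σπ : (Vec A (suc k) → Bool) → ℕ
    Σπ X = sumFin (suc k) (λ i → card xs (proj xs X i))
    go : ∀ c (X : Vec A (suc k) → Bool) → card xs X ≤ c → ∃ λ X′ → X′ ⊆ᵇ X × Thick δ X′ ×
         card xs X ≤ card xs X′ + δ * Σπ X
    go c X le with any? (λ i → card xs (trim δ i X) <? card xs X)
    ... | no none = X , (λ x e → e) , thick , m≤m+n _ _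
      where
      thick : Thick δ X
      thick i w pos with δ ≤? deg xs X i w
      ... | yes q = q
      ... | no ¬q = ⊥-elim (none (i , trim-strict δ i X w pos (≰⇒> ¬q)))
    go zero X le | yes (i , lt) = ⊥-elim (<⇒≱ (≤-trans lt le) z≤n)
    go (suc c) X le | yes (i , lt) with go c (trim δ i X) (≤-pred (≤-trans lt le))
    ... | X′ , sub , th , loss =
      X′ , (λ x e → trim⊆ δ i X x (sub x e)) , th ,
      +-cancelʳ-≤ (δ * g i) _ _ (begin
        card xs X + δ * g i                          ≤⟨ trim-loss δ i X ⟩
        card xs X₁ + δ * f i                         ≤⟨ +-monoˡ-≤ (δ * f i) loss ⟩
        card xs X′ + δ * Σπ X₁ + δ * f i             ≡⟨ lem (card xs X′) δ (Σπ X₁) (f i) ⟩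
        card xs X′ + δ * (Σπ X₁ + f i)               ≤⟨ +-monoʳ-≤ (card xs X′) (*-monoʳ-≤ δ (sumFin-exchange (suc k) mono i)) ⟩
        card xs X′ + δ * (Σπ X + g i)                ≡⟨ lem (card xs X′) δ (Σπ X) (g i) ⟨
        card xs X′ + δ * Σπ X + δ * g i              ∎)
      where
      open ≤-Reasoning
      X₁ = trim δ i X
      f g : Fin (suc k) → ℕ
      f j = card xs (proj xs X j)
      g j = card xs (proj xs X₁ j)
      mono : ∀ j → g j ≤ f j
      mono j = cnt-mono (allVec xs k) (proj-mono (trim⊆ δ i X) j)
      lem : ∀ a d b c → a + d * b + d * c ≡ a + d * (b + c)
      lem = solve-∀

  thick-proj : ∀ {k} δ (X : Vec A (suc (suc k)) → Bool) → Thick δ X → ∀ i → Thick δ (proj xs X i)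
  thick-proj {k} δ X th i j w pos
    with insertAt-comm {A} i j | cnt>0⇒∃ xs _ pos
  ... | i′ , comm | a , pa with cnt>0⇒∃ xs _ (true-0<ᵇ pa)
  ... | u , pu = ≤-trans (th (punchIn i j) (insertAt w i′ u) line>0) (cnt-mono xs inside)
    where
    line>0 : 0 < deg xs X (punchIn i j) (insertAt w i′ u)
    line>0 = cnt-∈ _ (full a) (trans (cong X (sym (comm w a u))) pu)
    inside : ∀ b → X (insertAt (insertAt w i′ u) (punchIn i j) b) ≡ true → proj xs X i (insertAt w j b) ≡ true
    inside b e = 0<ᵇ-true (cnt-∈ _ (full u) (trans (cong X (comm w b u)) e))

-- Communication protocols

data Protocol (X Y O : Set) : Set where
  leaf  : O → Protocol X Y O
  nodeA : (X → Bool) → Protocol X Y O → Protocol X Y O → Protocol X Y O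
  nodeB : (Y → Bool) → Protocol X Y O → Protocol X Y O → Protocol X Y O

module _ {X Y O : Set} where

  run : Protocol X Y O → X → Y → O
  run (leaf o) x y = o
  run (nodeA c l r) x y = if c x then run l x y else run r x y
  run (nodeB c l r) x y = if c y then run l x y else run r x y

  leaves : Protocol X Y O → ℕ
  leaves (leaf o) = 1
  leaves (nodeA c l r) = leaves l + leaves r
  leaves (nodeB c l r) = leaves l + leaves r

  leaves>0 : ∀ T → 0 < leaves T
  leaves>0 (leaf o) = s≤s z≤n
  leaves>0 (nodeA c l r) = ≤-trans (leaves>0 l) (m≤m+n _ _)
  leaves>0 (nodeB c l r) = ≤-trans (leaves>0 l) (m≤m+n _ _)

  leaves≤1 : ∀ T → leaves T ≤ 1 → ∃ λ o → T ≡ leaf o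
  leaves≤1 (leaf o) le = o , refl
  leaves≤1 (nodeA c l r) le = ⊥-elim (<⇒≱ (+-mono-≤ (leaves>0 l) (leaves>0 r)) le)
  leaves≤1 (nodeB c l r) le = ⊥-elim (<⇒≱ (+-mono-≤ (leaves>0 l) (leaves>0 r)) le)

reindex : {X Y O X′ Y′ O′ : Set} → (X′ → X) → (Y′ → Y) → (O → O′) → Protocol X Y O → Protocol X′ Y′ O′
reindex f g h (leaf o) = leaf (h o)
reindex f g h (nodeA c l r) = nodeA (c ∘ f) (reindex f g h l) (reindex f g h r)
reindex f g h (nodeB c l r) = nodeB (c ∘ g) (reindex f g h l) (reindex f g h r)

module _ {X Y O X′ Y′ O′ : Set} (f : X′ → X) (g : Y′ → Y) (h : O → O′) where

  run-reindex : ∀ (T : Protocol X Y O) x y → run (reindex f g h T) x y ≡ h (run T (f x) (g y))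
  run-reindex (leaf o) x y = refl
  run-reindex (nodeA c l r) x y with c (f x)
  ... | true = run-reindex l x y
  ... | false = run-reindex r x y
  run-reindex (nodeB c l r) x y with c (g y)
  ... | true = run-reindex l x y
  ... | false = run-reindex r x y

  leaves-reindex : ∀ (T : Protocol X Y O) → leaves (reindex f g h T) ≡ leaves T
  leaves-reindex (leaf o) = refl
  leaves-reindex (nodeA c l r) = cong₂ _+_ (leaves-reindex l) (leaves-reindex r)
  leaves-reindex (nodeB c l r) = cong₂ _+_ (leaves-reindex l) (leaves-reindex r)

module _ {X Y O : Set} where

  private
    record Subtree (L : ℕ) (T : Protocol X Y O) : Set where
      field
        inA   : X → Bool
        inB   : Y → Bool
        sub   : Protocol X Y O
        rest  : Protocol X Y O
        total : leaves sub + leaves rest ≡ leaves T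
        lower : L ≤ 4 * leaves sub
        upper : 4 * leaves sub ≤ 3 * L
        inside  : ∀ x y → inA x ≡ true → inB y ≡ true → run sub x y ≡ run T x y
        outside : ∀ x y → (inA x ≡ false) ⊎ (inB y ≡ false) → run rest x y ≡ run T x y

    heavy : ∀ {L l r} → 3 * L < 4 * (l + r) → r ≤ l → L ≤ 4 * l
    heavy {L} {l} {r} lt le = *-cancelˡ-≤ 2 (begin
      2 * L          ≤⟨ *-monoˡ-≤ L {2} {3} (s≤s (s≤s z≤n)) ⟩
      3 * L          ≤⟨ <⇒≤ lt ⟩
      4 * (l + r)    ≤⟨ *-monoʳ-≤ 4 (+-monoʳ-≤ l le) ⟩
      4 * (l + l)    ≡⟨ lem l ⟩
      2 * (4 * l)    ∎)
      where
      open ≤-Reasoning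
      lem : ∀ l → 4 * (l + l) ≡ 2 * (4 * l)
      lem = solve-∀

    swap-sum : ∀ {L} l r → 3 * L < 4 * (l + r) → 3 * L < 4 * (r + l)
    swap-sum l r lt rewrite +-comm l r = lt

    rotate : ∀ a b c → a + (b + c) ≡ b + (a + c)
    rotate = solve-∀

    locate : ∀ {L} → 2 ≤ L → ∀ T → 3 * L < 4 * leaves T → Subtree L T
    locate {L} 2≤L (leaf o) lt = ⊥-elim (<⇒≱ lt (≤-trans (m≤m+n 4 2) (*-monoʳ-≤ 3 2≤L)))
    locate {L} 2≤L (nodeA c l r) lt with ≤-total (leaves r) (leaves l)
    ... | inj₁ le with 3 * L <? 4 * leaves l
    ...   | no small = record
      { inA = c ; inB = λ _ → true ; sub = l ; rest = r ; total = refl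
      ; lower = heavy {r = leaves r} lt le ; upper = ≮⇒≥ small
      ; inside = λ x y e _ → in₁ x y e ; outside = λ { x y (inj₁ e) → out₁ x y e } }
      where
      in₁ : ∀ x y → c x ≡ true → run l x y ≡ run (nodeA c l r) x y
      in₁ x y e rewrite e = refl
      out₁ : ∀ x y → c x ≡ false → run r x y ≡ run (nodeA c l r) x y
      out₁ x y e rewrite e = refl
    ...   | yes big = record
      { inA = λ x → c x ∧ inA x ; inB = inB ; sub = sub ; rest = nodeA c rest r
      ; total = trans (sym (+-assoc (leaves sub) _ _)) (cong (_+ leaves r) total)
      ; lower = lower ; upper = upper ; inside = in₁ ; outside = out₁ }
      where
      open Subtree (locate 2≤L l big)
      in₁ : ∀ x y → c x ∧ inA x ≡ true → inB y ≡ true → run sub x y ≡ run (nodeA c l r) x y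
      in₁ x y e e′ with c x
      ... | true = inside x y e e′
      out₁ : ∀ x y → (c x ∧ inA x ≡ false) ⊎ (inB y ≡ false) →
             run (nodeA c rest r) x y ≡ run (nodeA c l r) x y
      out₁ x y e with c x
      ... | true = outside x y e
      ... | false = refl
    locate {L} 2≤L (nodeA c l r) lt | inj₂ le with 3 * L <? 4 * leaves r
    ...   | no small = record
      { inA = not ∘ c ; inB = λ _ → true ; sub = r ; rest = l ; total = +-comm (leaves r) _
      ; lower = heavy {r = leaves l} (swap-sum {L} (leaves l) _ lt) le ; upper = ≮⇒≥ small
      ; inside = λ x y e _ → in₁ x y e ; outside = λ { x y (inj₁ e) → out₁ x y e } }
      where
      in₁ : ∀ x y → not (c x) ≡ true → run r x y ≡ run (nodeA c l r) x y
      in₁ x y e with c x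
      ... | false = refl
      out₁ : ∀ x y → not (c x) ≡ false → run l x y ≡ run (nodeA c l r) x y
      out₁ x y e with c x
      ... | true = refl
    ...   | yes big = record
      { inA = λ x → not (c x) ∧ inA x ; inB = inB ; sub = sub ; rest = nodeA c l rest
      ; total = trans (rotate (leaves sub) (leaves l) (leaves rest)) (cong (leaves l +_) total)
      ; lower = lower ; upper = upper ; inside = in₁ ; outside = out₁ }
      where
      open Subtree (locate 2≤L r big)
      in₁ : ∀ x y → not (c x) ∧ inA x ≡ true → inB y ≡ true → run sub x y ≡ run (nodeA c l r) x y
      in₁ x y e e′ with c x
      ... | false = inside x y e e′
      out₁ : ∀ x y → (not (c x) ∧ inA x ≡ false) ⊎ (inB y ≡ false) →
             run (nodeA c l rest) x y ≡ run (nodeA c l r) x y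
      out₁ x y e with c x
      ... | false = outside x y e
      ... | true = refl
    locate {L} 2≤L (nodeB c l r) lt with ≤-total (leaves r) (leaves l)
    ... | inj₁ le with 3 * L <? 4 * leaves l
    ...   | no small = record
      { inA = λ _ → true ; inB = c ; sub = l ; rest = r ; total = refl
      ; lower = heavy {r = leaves r} lt le ; upper = ≮⇒≥ small
      ; inside = λ x y _ e → in₁ x y e ; outside = λ { x y (inj₂ e) → out₁ x y e } }
      where
      in₁ : ∀ x y → c y ≡ true → run l x y ≡ run (nodeB c l r) x y
      in₁ x y e rewrite e = refl
      out₁ : ∀ x y → c y ≡ false → run r x y ≡ run (nodeB c l r) x y
      out₁ x y e rewrite e = refl
    ...   | yes big = record
      { inA = inA ; inB = λ y → c y ∧ inB y ; sub = sub ; rest = nodeB c rest r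
      ; total = trans (sym (+-assoc (leaves sub) _ _)) (cong (_+ leaves r) total)
      ; lower = lower ; upper = upper ; inside = in₁ ; outside = out₁ }
      where
      open Subtree (locate 2≤L l big)
      in₁ : ∀ x y → inA x ≡ true → c y ∧ inB y ≡ true → run sub x y ≡ run (nodeB c l r) x y
      in₁ x y e e′ with c y
      ... | true = inside x y e e′
      out₁ : ∀ x y → (inA x ≡ false) ⊎ (c y ∧ inB y ≡ false) →
             run (nodeB c rest r) x y ≡ run (nodeB c l r) x y
      out₁ x y e with c y
      ... | true = outside x y e
      ... | false = refl
    locate {L} 2≤L (nodeB c l r) lt | inj₂ le with 3 * L <? 4 * leaves r
    ...   | no small = record
      { inA = λ _ → true ; inB = not ∘ c ; sub = r ; rest = l ; total = +-comm (leaves r) _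
      ; lower = heavy {r = leaves l} (swap-sum {L} (leaves l) _ lt) le ; upper = ≮⇒≥ small
      ; inside = λ x y _ e → in₁ x y e ; outside = λ { x y (inj₂ e) → out₁ x y e } }
      where
      in₁ : ∀ x y → not (c y) ≡ true → run r x y ≡ run (nodeB c l r) x y
      in₁ x y e with c y
      ... | false = refl
      out₁ : ∀ x y → not (c y) ≡ false → run l x y ≡ run (nodeB c l r) x y
      out₁ x y e with c y
      ... | true = refl
    ...   | yes big = record
      { inA = inA ; inB = λ y → not (c y) ∧ inB y ; sub = sub ; rest = nodeB c l rest
      ; total = trans (rotate (leaves sub) (leaves l) (leaves rest)) (cong (leaves l +_) total)
      ; lower = lower ; upper = upper ; inside = in₁ ; outside = out₁ }
      where
      open Subtree (locate 2≤L r big)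
      in₁ : ∀ x y → inA x ≡ true → not (c y) ∧ inB y ≡ true → run sub x y ≡ run (nodeB c l r) x y
      in₁ x y e e′ with c y
      ... | false = inside x y e e′
      out₁ : ∀ x y → (inA x ≡ false) ⊎ (not (c y) ∧ inB y ≡ false) →
             run (nodeB c l rest) x y ≡ run (nodeB c l r) x y
      out₁ x y e with c y
      ... | false = outside x y e
      ... | true = refl

    a+a≡2*a : ∀ a → a + a ≡ 2 * a
    a+a≡2*a = solve-∀

    halves : ∀ {A : Set} (xs : List A) (P Q : A → Bool) →
      (cnt xs P ≤ 2 * cnt xs (λ a → P a ∧ Q a)) ⊎ (cnt xs P ≤ 2 * cnt xs (λ a → P a ∧ not (Q a)))
    halves xs P Q rewrite cnt-split xs P Q
      with ≤-total (cnt xs (λ a → P a ∧ Q a)) (cnt xs (λ a → P a ∧ not (Q a)))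
    ... | inj₁ le = inj₂ (≤-trans (+-monoˡ-≤ _ le) (≤-reflexive (a+a≡2*a (cnt xs (λ a → P a ∧ not (Q a))))))
    ... | inj₂ le = inj₁ (≤-trans (+-monoʳ-≤ (cnt xs (λ a → P a ∧ Q a)) le)
                                  (≤-reflexive (a+a≡2*a (cnt xs (λ a → P a ∧ Q a)))))

    not-true : ∀ {b} → not b ≡ true → b ≡ false
    not-true {false} e = refl

  record Split (xs : List X) (ys : List Y) (P : X → Bool) (Q : Y → Bool) (T : Protocol X Y O) : Set where
    field
      P′    : X → Bool
      Q′    : Y → Bool
      T′    : Protocol X Y O
      P′⊆P  : P′ ⊆ᵇ P
      Q′⊆Q  : Q′ ⊆ᵇ Q
      halfP : cnt xs P ≤ 2 * cnt xs P′
      halfQ : cnt ys Q ≤ 2 * cnt ys Q′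
      fewer : 4 * leaves T′ ≤ 3 * leaves T
      agree : ∀ x y → P′ x ≡ true → Q′ y ≡ true → run T′ x y ≡ run T x y

  split : ∀ xs ys P Q T → 2 ≤ leaves T → Split xs ys P Q T
  split xs ys P Q T 2≤L = cases
    where
    L = leaves T
    3L<4L : 3 * L < 4 * L
    3L<4L = +-monoˡ-≤ (3 * L) (≤-trans (s≤s z≤n) 2≤L)
    open Subtree (locate 2≤L T 3L<4L)
    n≤2n : ∀ n → n ≤ 2 * n
    n≤2n n = m≤m+n n (n + 0)
    rest-fewer : 4 * leaves rest ≤ 3 * L
    rest-fewer = +-cancelˡ-≤ L _ _ (begin
      L + 4 * leaves rest               ≤⟨ +-monoˡ-≤ _ lower ⟩
      4 * leaves sub + 4 * leaves rest  ≡⟨ *-distribˡ-+ 4 (leaves sub) (leaves rest) ⟨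
      4 * (leaves sub + leaves rest)    ≡⟨ cong (4 *_) total ⟩
      4 * L ∎)
      where open ≤-Reasoning
    cases : Split xs ys P Q T
    cases with halves xs P inA | halves ys Q inB
    ... | inj₁ hP | inj₁ hQ = record
      { T′ = sub ; P′⊆P = λ x → proj₁ ∘ ∧-true ; Q′⊆Q = λ y → proj₁ ∘ ∧-true ; halfP = hP ; halfQ = hQ
      ; fewer = upper ; agree = λ x y p q → inside x y (proj₂ (∧-true {P x} p)) (proj₂ (∧-true {Q y} q)) }
    ... | inj₂ hP | _ = record
      { T′ = rest ; P′⊆P = λ x → proj₁ ∘ ∧-true ; Q′⊆Q = λ y e → e ; halfP = hP ; halfQ = n≤2n (cnt ys Q)
      ; fewer = rest-fewer ; agree = λ x y p q → outside x y (inj₁ (not-true (proj₂ (∧-true {P x} p)))) }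
    ... | inj₁ _ | inj₂ hQ = record
      { T′ = rest ; P′⊆P = λ x e → e ; Q′⊆Q = λ y → proj₁ ∘ ∧-true ; halfP = n≤2n (cnt xs P) ; halfQ = hQ
      ; fewer = rest-fewer ; agree = λ x y p q → outside x y (inj₂ (not-true (proj₂ (∧-true {Q y} q)))) }

sumL-allFin : ∀ n (f : Fin n → ℕ) → sumL (allFin n) f ≡ sumFin n f
sumL-allFin n f = go n (λ i → i)
  where
  go : ∀ k (g : Fin k → Fin n) → sumL (tabulate g) f ≡ sumFin k (f ∘ g)
  go zero g = refl
  go (suc k) g = cong (f (g fzero) +_) (go k (g ∘ fsuc))

length-allFin : ∀ n → length (allFin n) ≡ n
length-allFin n = length-tabulate (λ i → i)

^-distribʳ-* : ∀ k a b → (a * b) ^ k ≡ a ^ k * b ^ k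
^-distribʳ-* zero a b = refl
^-distribʳ-* (suc k) a b rewrite ^-distribʳ-* k a b = lem a b (a ^ k) (b ^ k)
  where
  lem : ∀ a b p q → a * b * (p * q) ≡ a * p * (b * q)
  lem = solve-∀

private
  bernoulli : ∀ a j → (a + j) * a ^ j ≤ suc a ^ j * a
  bernoulli a zero = ≤-reflexive (lem a)
    where
    lem : ∀ a → (a + 0) * 1 ≡ 1 * a
    lem = solve-∀
  bernoulli a (suc j) = begin
    (a + suc j) * (a * a ^ j)            ≡⟨ l₁ a j (a ^ j) ⟩
    (a + (a * a + a * j)) * a ^ j        ≤⟨ *-monoˡ-≤ (a ^ j) (+-monoˡ-≤ _ (m≤m+n a j)) ⟩
    (a + j + (a * a + a * j)) * a ^ j    ≡⟨ l₂ a j (a ^ j) ⟩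
    suc a * ((a + j) * a ^ j)            ≤⟨ *-monoʳ-≤ (suc a) (bernoulli a j) ⟩
    suc a * (suc a ^ j * a)              ≡⟨ *-assoc (suc a) (suc a ^ j) a ⟨
    suc a * suc a ^ j * a                ∎
    where
    open ≤-Reasoning
    l₁ : ∀ a j p → (a + suc j) * (a * p) ≡ (a + (a * a + a * j)) * p
    l₁ = solve-∀
    l₂ : ∀ a j p → (a + j + (a * a + a * j)) * p ≡ suc a * ((a + j) * p)
    l₂ = solve-∀

2*a^[1+a]≤[1+a]^[1+a] : ∀ a → 2 * a ^ suc a ≤ suc a ^ suc a
2*a^[1+a]≤[1+a]^[1+a] zero = z≤n
2*a^[1+a]≤[1+a]^[1+a] a@(suc _) = *-cancelʳ-≤ _ _ a (begin
  2 * a ^ suc a * a          ≡⟨ lem a (a ^ suc a) ⟩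
  (a + a) * a ^ suc a        ≤⟨ *-monoˡ-≤ (a ^ suc a) (+-monoʳ-≤ a (n≤1+n a)) ⟩
  (a + suc a) * a ^ suc a    ≤⟨ bernoulli a (suc a) ⟩
  suc a ^ suc a * a          ∎)
  where
  open ≤-Reasoning
  lem : ∀ a p → 2 * p * a ≡ (a + a) * p
  lem = solve-∀

2^b*a^≤[1+a]^ : ∀ a b → 2 ^ b * a ^ (suc a * b) ≤ suc a ^ (suc a * b)
2^b*a^≤[1+a]^ a b = begin
  2 ^ b * a ^ (suc a * b)       ≡⟨ cong (2 ^ b *_) (^-*-assoc a (suc a) b) ⟨
  2 ^ b * (a ^ suc a) ^ b       ≡⟨ ^-distribʳ-* b 2 (a ^ suc a) ⟨
  (2 * a ^ suc a) ^ b           ≤⟨ ^-monoˡ-≤ b (2*a^[1+a]≤[1+a]^[1+a] a) ⟩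
  (suc a ^ suc a) ^ b           ≡⟨ ^-*-assoc (suc a) (suc a) b ⟩
  suc a ^ (suc a * b)           ∎
  where open ≤-Reasoning

_==_ : ∀ {n} → Fin n → Fin n → Bool
a == b = does (a Fin.≟ b)

==-true : ∀ {n} (a b : Fin n) → (a == b) ≡ true → a ≡ b
==-true a b e with a Fin.≟ b
... | yes p = p

-- The number of functions avoiding a value on a given set

avoids : ∀ {n m} → Fin n → (Fin m → Bool) → Vec (Fin n) m → Bool
avoids v W [] = true
avoids v W (a ∷ f) = not (W fzero ∧ (a == v)) ∧ avoids v (W ∘ fsuc) f

weight : ∀ {m} → (Fin m → Bool) → ℕ
weight {m} W = sumFin m (b2n ∘ W)

private
  count≢ : ∀ n (v : Fin (suc n)) → sumFin (suc n) (λ a → b2n (not (a == v))) ≡ n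
  count≢ n fzero = trans (sumFin-const n 1) (*-identityʳ n)
  count≢ (suc n) (fsuc v) = cong suc (count≢ n v)

  avoids-cons : ∀ {n m} (v : Fin n) (W : Fin (suc m) → Bool) → let vs = allFin n in
    cnt (allVec vs (suc m)) (avoids v W) ≡
    sumFin n (λ a → b2n (not (W fzero ∧ (a == v)))) * cnt (allVec vs m) (avoids v (W ∘ fsuc))
  avoids-cons {n} {m} v W = begin
    cnt (allVec vs (suc m)) (avoids v W)
      ≡⟨ sumL-allVec vs m _ ⟩
    sumL vs (λ a → sumL (allVec vs m) (λ f → b2n (not (W fzero ∧ (a == v)) ∧ avoids v (W ∘ fsuc) f)))
      ≡⟨ sumL-cong vs (λ a → trans (sumL-cong (allVec vs m) (λ f → b2n-∧ (not (W fzero ∧ (a == v))) _))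
                                   (trans (sumL-* (allVec vs m) (b2n (not (W fzero ∧ (a == v)))) _) (*-comm (b2n (not (W fzero ∧ (a == v)))) c))) ⟩
    sumL vs (λ a → c * b2n (not (W fzero ∧ (a == v))))
      ≡⟨ sumL-* vs c _ ⟩
    c * sumL vs (λ a → b2n (not (W fzero ∧ (a == v))))
      ≡⟨ cong (c *_) (sumL-allFin n _) ⟩
    c * sumFin n (λ a → b2n (not (W fzero ∧ (a == v))))
      ≡⟨ *-comm c _ ⟩
    sumFin n (λ a → b2n (not (W fzero ∧ (a == v)))) * c ∎
    where
    open ≡-Reasoning
    vs = allFin n
    c = cnt (allVec vs m) (avoids v (W ∘ fsuc))
    b2n-∧ : ∀ a b → b2n (a ∧ b) ≡ b2n a * b2n b
    b2n-∧ true b = sym (+-identityʳ _)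
    b2n-∧ false b = refl

cnt-avoids : ∀ {n m} (v : Fin (suc n)) (W : Fin m → Bool) →
  cnt (allVec (allFin (suc n)) m) (avoids v W) * suc n ^ weight W ≡ n ^ weight W * suc n ^ m
cnt-avoids {m = zero} v W = refl
cnt-avoids {n} {suc m} v W rewrite avoids-cons v W with W fzero
... | true rewrite count≢ n v = begin
  n * c * (suc n * suc n ^ s)   ≡⟨ l₁ n c (suc n ^ s) ⟩
  n * suc n * (c * suc n ^ s)   ≡⟨ cong (n * suc n *_) (cnt-avoids v (W ∘ fsuc)) ⟩
  n * suc n * (n ^ s * suc n ^ m) ≡⟨ l₂ n (n ^ s) (suc n ^ m) ⟩
  n * n ^ s * (suc n * suc n ^ m) ∎
  where
  open ≡-Reasoning
  c = cnt (allVec (allFin (suc n)) m) (avoids v (W ∘ fsuc))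
  s = weight (W ∘ fsuc)
  l₁ : ∀ n c q → n * c * (suc n * q) ≡ n * suc n * (c * q)
  l₁ = solve-∀
  l₂ : ∀ n a b → n * suc n * (a * b) ≡ n * a * (suc n * b)
  l₂ = solve-∀
... | false rewrite sumFin-const n 1 | *-identityʳ n = begin
  (c + n * c) * suc n ^ s       ≡⟨ l₁ n c (suc n ^ s) ⟩
  suc n * (c * suc n ^ s)       ≡⟨ cong (suc n *_) (cnt-avoids v (W ∘ fsuc)) ⟩
  suc n * (n ^ s * suc n ^ m)   ≡⟨ l₂ n (n ^ s) (suc n ^ m) ⟩
  n ^ s * (suc n * suc n ^ m)   ∎
  where
  open ≡-Reasoning
  c = cnt (allVec (allFin (suc n)) m) (avoids v (W ∘ fsuc))
  s = weight (W ∘ fsuc)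
  l₁ : ∀ n c q → (c + n * c) * q ≡ suc n * (c * q)
  l₁ = solve-∀
  l₂ : ∀ n a b → suc n * (a * b) ≡ a * (suc n * b)
  l₂ = solve-∀

avoids-or-hits : ∀ {n m} (v : Fin n) (W : Fin m → Bool) f →
  1 ≤ b2n (avoids v W f) + sumFin m (λ u → b2n (W u) * b2n (lookup f u == v))
avoids-or-hits v W [] = ≤-refl
avoids-or-hits v W (a ∷ f) with W fzero | a == v
... | true | true = s≤s z≤n
... | true | false = avoids-or-hits v (W ∘ fsuc) f
... | false | _ = avoids-or-hits v (W ∘ fsuc) f

module _ {m n : ℕ} where

  cols : List (Vec (Fin (suc n)) m)
  cols = allVec (allFin (suc n)) m

  length-cols : length cols ≡ suc n ^ m
  length-cols = trans (length-allVec (allFin (suc n)) m) (cong (_^ m) (length-allFin (suc n)))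

  pin : ∀ {k} → (Vec (Vec (Fin (suc n)) m) k → Bool) → Fin k → Fin m → Fin (suc n) →
        Vec (Vec (Fin (suc n)) m) k → Bool
  pin Y i u v y = Y y ∧ (lookup (lookup y i) u == v)

  module _ {k} (Y : Vec (Vec (Fin (suc n)) m) (suc k) → Bool) (i : Fin (suc k)) (v : Fin (suc n)) where

    bad : Fin m → Bool
    bad u = 2 * m * card cols (pin Y i u v) <ᵇ card cols Y

    private
      Y∅ : Vec (Vec (Fin (suc n)) m) (suc k) → Bool
      Y∅ y = Y y ∧ avoids v bad (lookup y i)

      ys = allVec cols (suc k)

      pointwise : ∀ y → b2n (Y y) ≤ b2n (Y∅ y) + sumL (allFin m) (λ u → b2n (bad u) * b2n (pin Y i u v y))
      pointwise y with Y y
      ... | false = z≤n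
      ... | true rewrite sumL-allFin m (λ u → b2n (bad u) * b2n (lookup (lookup y i) u == v)) =
        avoids-or-hits v bad (lookup y i)

      cover : card cols Y ≤ card cols Y∅ + sumFin m (λ u → b2n (bad u) * card cols (pin Y i u v))
      cover = begin
        card cols Y
          ≤⟨ sumL-mono ys pointwise ⟩
        sumL ys (λ y → b2n (Y∅ y) + sumL (allFin m) (λ u → b2n (bad u) * b2n (pin Y i u v y)))
          ≡⟨ sumL-+ ys _ _ ⟩
        card cols Y∅ + sumL ys (λ y → sumL (allFin m) (λ u → b2n (bad u) * b2n (pin Y i u v y)))
          ≡⟨ cong (card cols Y∅ +_) (trans (sumL-swap ys (allFin m) _)
               (trans (sumL-cong (allFin m) (λ u → sumL-* ys (b2n (bad u)) _)) (sumL-allFin m _))) ⟩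
        card cols Y∅ + sumFin m (λ u → b2n (bad u) * card cols (pin Y i u v)) ∎
        where open ≤-Reasoning

      bad-small : ∀ u → 2 * m * (b2n (bad u) * card cols (pin Y i u v)) ≤ card cols Y
      bad-small u with 2 * m * card cols (pin Y i u v) <ᵇ card cols Y in eq
      ... | false rewrite *-zeroʳ (2 * m) = z≤n
      ... | true rewrite +-identityʳ (card cols (pin Y i u v)) =
        <⇒≤ (<ᵇ⇒< (2 * m * card cols (pin Y i u v)) (card cols Y) (Equivalence.from T-≡ eq))

      half : .{{_ : NonZero m}} → card cols Y ≤ 2 * card cols Y∅
      half = +-cancelˡ-≤ (card cols Y) _ _ (begin
        card cols Y + card cols Y       ≡⟨ l₀ (card cols Y) ⟩
        2 * card cols Y                 ≤⟨ *-monoʳ-≤ 2 cover ⟩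
        2 * (card cols Y∅ + σ)          ≡⟨ l₁ (card cols Y∅) σ ⟩
        2 * σ + 2 * card cols Y∅        ≤⟨ +-monoˡ-≤ _ 2σ≤ ⟩
        card cols Y + 2 * card cols Y∅  ∎)
        where
        open ≤-Reasoning
        l₀ : ∀ a → a + a ≡ 2 * a
        l₀ = solve-∀
        l₁ : ∀ a b → 2 * (a + b) ≡ 2 * b + 2 * a
        l₁ = solve-∀
        l₂ : ∀ a b → a * (2 * b) ≡ 2 * a * b
        l₂ = solve-∀
        σ = sumFin m (λ u → b2n (bad u) * card cols (pin Y i u v))
        2σ≤ : 2 * σ ≤ card cols Y
        2σ≤ = *-cancelˡ-≤ m (begin
          m * (2 * σ)    ≡⟨ l₂ m σ ⟩
          2 * m * σ      ≡⟨ sumFin-* m (2 * m) _ ⟨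
          sumFin m (λ u → 2 * m * (b2n (bad u) * card cols (pin Y i u v)))
                         ≤⟨ sumFin-mono m bad-small ⟩
          sumFin m (λ _ → card cols Y) ≡⟨ sumFin-const m _ ⟩
          m * card cols Y ∎)

      Y∅≤ : card cols Y∅ ≤ (suc n ^ m) ^ k * cnt cols (avoids v bad)
      Y∅≤ = begin
        card cols Y∅
          ≤⟨ cnt-mono ys (λ y e → proj₂ (∧-true {Y y} e)) ⟩
        cnt ys (λ y → avoids v bad (lookup y i))
          ≡⟨ sumL-insertAt cols k i _ ⟩
        sumL (allVec cols k) (λ w → cnt cols (λ f → avoids v bad (lookup (insertAt w i f) i)))
          ≡⟨ sumL-cong (allVec cols k) (λ w → sumL-cong cols (λ f → cong (b2n ∘ avoids v bad) (insertAt-lookup w i f))) ⟩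
        sumL (allVec cols k) (λ w → cnt cols (avoids v bad))
          ≡⟨ sumL-const (allVec cols k) _ ⟩
        length (allVec cols k) * cnt cols (avoids v bad)
          ≡⟨ cong (_* cnt cols (avoids v bad)) (trans (length-allVec cols k) (cong (_^ k) length-cols)) ⟩
        (suc n ^ m) ^ k * cnt cols (avoids v bad) ∎
        where open ≤-Reasoning

    -- If the values u in W are all bad, half of Y avoids the value v on W,
    -- which caps the density of Y at 2 (n / (n + 1))^|W|.
    few-bad : .{{_ : NonZero m}} .{{_ : NonZero n}} → ∀ E β → 4 * E ≤ 2 ^ β → 0 < E →
      (suc n ^ m) ^ suc k ≤ card cols Y * E → weight bad ≤ suc n * β
    few-bad E β 4E≤ E>0 dense with weight bad ≤? suc n * β
    ... | yes le = le
    ... | no ¬le = ⊥-elim (<⇒≱ lower upper)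
      where
      open ≤-Reasoning
      W = weight bad
      M = suc n ^ m
      a = cnt cols (avoids v bad)
      instance
        Mk≢0 : NonZero (M ^ k)
        Mk≢0 = m^n≢0 M k {{m^n≢0 (suc n) m}}
        M≢0 : NonZero M
        M≢0 = m^n≢0 (suc n) m
      l₁ : ∀ p q e → 2 * (p * q) * e ≡ p * (2 * e * q)
      l₁ = solve-∀
      M≤ : M ≤ 2 * E * a
      M≤ = *-cancelˡ-≤ (M ^ k) (begin
        M ^ k * M               ≡⟨ *-comm (M ^ k) M ⟩
        M ^ suc k               ≤⟨ dense ⟩
        card cols Y * E         ≤⟨ *-monoˡ-≤ E (≤-trans half (*-monoʳ-≤ 2 Y∅≤)) ⟩
        2 * (M ^ k * a) * E     ≡⟨ l₁ (M ^ k) a E ⟩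
        M ^ k * (2 * E * a)     ∎)
      upper : suc n ^ W ≤ 2 * E * n ^ W
      upper = *-cancelˡ-≤ M (begin
        M * suc n ^ W             ≤⟨ *-monoˡ-≤ (suc n ^ W) M≤ ⟩
        2 * E * a * suc n ^ W     ≡⟨ *-assoc (2 * E) a _ ⟩
        2 * E * (a * suc n ^ W)   ≡⟨ cong (2 * E *_) (cnt-avoids v bad) ⟩
        2 * E * (n ^ W * M)       ≡⟨ l₂ (2 * E) (n ^ W) M ⟩
        M * (2 * E * n ^ W)       ∎)
        where
        l₂ : ∀ e p q → e * (p * q) ≡ q * (e * p)
        l₂ = solve-∀
      c = suc n * β
      d = W ∸ c
      W≡ : W ≡ c + d
      W≡ = sym (m+[n∸m]≡n (<⇒≤ (≰⇒> ¬le)))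
      lower : 2 * E * n ^ W < suc n ^ W
      lower = begin-strict
        2 * E * n ^ W               <⟨ *-monoˡ-< (n ^ W) {{m^n≢0 n W}} 2E<4E ⟩
        4 * E * n ^ W               ≤⟨ *-monoˡ-≤ (n ^ W) 4E≤ ⟩
        2 ^ β * n ^ W               ≡⟨ cong (λ z → 2 ^ β * n ^ z) W≡ ⟩
        2 ^ β * n ^ (c + d)         ≡⟨ cong (2 ^ β *_) (^-distribˡ-+-* n c d) ⟩
        2 ^ β * (n ^ c * n ^ d)     ≡⟨ *-assoc (2 ^ β) (n ^ c) (n ^ d) ⟨
        2 ^ β * n ^ c * n ^ d       ≤⟨ *-mono-≤ (2^b*a^≤[1+a]^ n β) (^-monoˡ-≤ d (n≤1+n n)) ⟩
        suc n ^ c * suc n ^ d       ≡⟨ ^-distribˡ-+-* (suc n) c d ⟨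
        suc n ^ (c + d)             ≡⟨ cong (suc n ^_) W≡ ⟨
        suc n ^ W                   ∎
        where
        2E<4E : 2 * E < 4 * E
        2E<4E = *-monoˡ-< E {{>-nonZero E>0}} {2} {4} (s≤s (s≤s (s≤s z≤n)))

module _ {m n k : ℕ} .{{_ : NonZero m}} .{{_ : NonZero n}}
         (X : Vec (Fin m) (suc k) → Bool) (i : Fin (suc k)) (v : Fin (suc n))
         (M B E β : ℕ) (B≡ : B ≡ suc n * β) (m≡ : m ≡ suc M * B) (4E≤ : 4 * E ≤ 2 ^ β) (E>0 : 0 < E) where

  private
    rows = allFin m

    hit : (Vec (Fin m) k → Bool) → Fin m → Vec (Fin m) k → Bool
    hit H u w = H w ∧ X (insertAt w i u)

    module _ (H : Vec (Fin m) k → Bool) (Y : Vec (Vec (Fin (suc n)) m) (suc k) → Bool)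
             (thick : ∀ w → H w ≡ true → 2 * B ≤ deg rows X i w) where

      ws = allVec rows k

      hits : 2 * B * card rows H ≤ sumFin m (λ u → card rows (hit H u))
      hits = begin
        2 * B * card rows H                               ≡⟨ sumL-* ws (2 * B) _ ⟨
        sumL ws (λ w → 2 * B * b2n (H w))                 ≤⟨ sumL-mono ws pt ⟩
        sumL ws (λ w → sumL rows (λ u → b2n (hit H u w))) ≡⟨ sumL-swap ws rows _ ⟩
        sumL rows (λ u → card rows (hit H u))             ≡⟨ sumL-allFin m _ ⟩
        sumFin m (λ u → card rows (hit H u))              ∎
        where
        open ≤-Reasoning
        pt : ∀ w → 2 * B * b2n (H w) ≤ sumL rows (λ u → b2n (hit H u w))
        pt w with H w in eq
        ... | false = ≤-trans (≤-reflexive (*-zeroʳ (2 * B))) z≤n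
        ... | true = ≤-trans (≤-reflexive (*-identityʳ (2 * B))) (thick w eq)

      pick : 0 < card rows H → (suc n ^ m) ^ suc k ≤ card cols Y * E → ∃ λ u →
        card cols Y ≤ 2 * m * card cols (pin Y i u v) × card rows H ≤ suc M * card rows (hit H u)
      pick h>0 dense
        with any? (λ u → card cols Y ≤? 2 * m * card cols (pin Y i u v) ×-dec card rows H ≤? suc M * card rows (hit H u))
      ... | yes found = found
      ... | no none = ⊥-elim (<⇒≱ (>-nonZero⁻¹ m) (+-cancelˡ-≤ (suc M * σ) m 0 (begin
        suc M * σ + m
          ≡⟨ cong₂ _+_ (sym (sumFin-* m (suc M) _)) (sym (trans (sumFin-const m 1) (*-identityʳ m))) ⟩
        sumFin m (λ u → suc M * card rows (hit H u)) + sumFin m (λ _ → 1)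
          ≡⟨ sumFin-+ m _ _ ⟨
        sumFin m (λ u → suc M * card rows (hit H u) + 1)
          ≤⟨ sumFin-mono m pt ⟩
        sumFin m (λ u → h + suc M * h * b2n (bad Y i v u))
          ≡⟨ sumFin-+ m _ _ ⟩
        sumFin m (λ u → h) + sumFin m (λ u → suc M * h * b2n (bad Y i v u))
          ≡⟨ cong₂ _+_ (sumFin-const m h) (sumFin-* m (suc M * h) _) ⟩
        m * h + suc M * h * weight (bad Y i v)
          ≤⟨ +-mono-≤ (≤-reflexive (cong (_* h) m≡)) (*-monoʳ-≤ (suc M * h) (≤-trans (few-bad Y i v E β 4E≤ E>0 dense) (≤-reflexive (sym B≡)))) ⟩
        suc M * B * h + suc M * h * B
          ≡⟨ l₁ (suc M) B h ⟩
        suc M * (2 * B * h)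
          ≤⟨ *-monoʳ-≤ (suc M) hits ⟩
        suc M * σ
          ≡⟨ +-identityʳ _ ⟨
        suc M * σ + 0 ∎)))
        where
        open ≤-Reasoning
        σ = sumFin m (λ u → card rows (hit H u))
        h = card rows H
        l₁ : ∀ a b h → a * b * h + a * h * b ≡ a * (2 * b * h)
        l₁ = solve-∀
        sumFin-+ : ∀ m (f g : Fin m → ℕ) → sumFin m (λ u → f u + g u) ≡ sumFin m f + sumFin m g
        sumFin-+ zero f g = refl
        sumFin-+ (suc m) f g rewrite sumFin-+ m (f ∘ fsuc) (g ∘ fsuc) =
          lem (f fzero) (g fzero) (sumFin m (f ∘ fsuc)) (sumFin m (g ∘ fsuc))
          where
          lem : ∀ a b c d → a + b + (c + d) ≡ a + c + (b + d)
          lem = solve-∀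
        pt : ∀ u → suc M * card rows (hit H u) + 1 ≤ h + suc M * h * b2n (bad Y i v u)
        pt u with 2 * m * card cols (pin Y i u v) <ᵇ card cols Y in eq
        ... | true = begin
          suc M * card rows (hit H u) + 1  ≤⟨ +-mono-≤ (*-monoʳ-≤ (suc M) (cnt-mono ws (λ w e → proj₁ (∧-true e)))) h>0 ⟩
          suc M * h + h                    ≡⟨ +-comm (suc M * h) h ⟩
          h + suc M * h                    ≡⟨ cong (h +_) (*-identityʳ (suc M * h)) ⟨
          h + suc M * h * 1                ∎
        ... | false = begin
          suc M * card rows (hit H u) + 1  ≡⟨ +-comm _ 1 ⟩
          suc (suc M * card rows (hit H u)) ≤⟨ ≰⇒> (λ le → none (u , good , le)) ⟩
          h                                ≤⟨ m≤m+n h _ ⟩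
          h + suc M * h * 0                ∎
          where
          good : card cols Y ≤ 2 * m * card cols (pin Y i u v)
          good = ≮⇒≥ (λ lt → false≢true (trans (sym eq) (Equivalence.to T-≡ (<⇒<ᵇ lt))))
            where
            false≢true : false ≡ true → ⊥
            false≢true ()

  -- Each chosen u serves a fraction 1/(M+1) of the rows w still unserved,
  -- while pinning y i u to v keeps a fraction 1/2m of Y.
  serve : Fin m → ∀ t (H : Vec (Fin m) k → Bool) (Y : Vec (Vec (Fin (suc n)) m) (suc k) → Bool) →
    (∀ w → H w ≡ true → 2 * B ≤ deg rows X i w) →
    card rows H * M ^ t < suc M ^ t →
    (suc n ^ m) ^ suc k * (2 * m) ^ t ≤ card cols Y * E →
    ∃ λ Y′ → Σ (Vec (Fin m) k → Fin m) λ u → Y′ ⊆ᵇ Y × card cols Y ≤ (2 * m) ^ t * card cols Y′ ×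
      (∀ w → H w ≡ true → X (insertAt w i (u w)) ≡ true ×
        (∀ y → Y′ y ≡ true → lookup (lookup y i) (u w) ≡ v))
  serve u₀ t H Y thick few dense with card rows H in eqH
  ... | zero = Y , (λ _ → u₀) , (λ y e → e) , le , λ w e → ⊥-elim (empty w e)
    where
    instance
      2m≢0 : NonZero (2 * m)
      2m≢0 = m*n≢0 2 m
    le : card cols Y ≤ (2 * m) ^ t * card cols Y
    le = m≤n*m (card cols Y) ((2 * m) ^ t) {{m^n≢0 (2 * m) t}}
    empty : ∀ w → H w ≡ true → ⊥
    empty w e = <⇒≱ (cnt-∈ H (∈-allVec rows ∈-allFin w) e) (≤-reflexive eqH)
  serve u₀ zero H Y thick few dense | suc h = ⊥-elim (<⇒≱ few (s≤s z≤n))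
  serve u₀ (suc t) H Y thick few dense | suc h
    with pick H Y thick (≤-trans (s≤s z≤n) (≤-reflexive (sym eqH)))
              (≤-trans (m≤m*n ((suc n ^ m) ^ suc k) ((2 * m) ^ suc t) {{m^n≢0 (2 * m) (suc t) {{m*n≢0 2 m}}}}) dense)
  ... | u , goodY , goodH
    with serve u₀ t H′ (pin Y i u v) (λ w e → thick w (proj₁ (∧-true e))) few′ dense′
    where
    open ≤-Reasoning
    H′ : Vec (Fin m) k → Bool
    H′ w = H w ∧ not (X (insertAt w i u))
    splitH : card rows H ≡ card rows (hit H u) + card rows H′
    splitH = cnt-split (allVec rows k) H (λ w → X (insertAt w i u))
    shrink : suc M * card rows H′ ≤ M * card rows H
    shrink = +-cancelˡ-≤ (card rows H) _ _ (begin
      card rows H + suc M * card rows H′                      ≤⟨ +-monoˡ-≤ _ goodH ⟩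
      suc M * card rows (hit H u) + suc M * card rows H′      ≡⟨ *-distribˡ-+ (suc M) (card rows (hit H u)) (card rows H′) ⟨
      suc M * (card rows (hit H u) + card rows H′)            ≡⟨ cong (suc M *_) splitH ⟨
      suc M * card rows H                                     ∎)
    l₁ : ∀ a b c → a * (b * c) ≡ a * b * c
    l₁ = solve-∀
    l₂ : ∀ a b c → a * b * c ≡ b * (a * c)
    l₂ = solve-∀
    few′ : card rows H′ * M ^ t < suc M ^ t
    few′ = *-cancelˡ-< (suc M) _ _ (begin-strict
      suc M * (card rows H′ * M ^ t)   ≡⟨ l₁ (suc M) (card rows H′) (M ^ t) ⟩
      suc M * card rows H′ * M ^ t     ≤⟨ *-monoˡ-≤ (M ^ t) shrink ⟩
      M * card rows H * M ^ t          ≡⟨ l₂ M (card rows H) (M ^ t) ⟩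
      card rows H * M ^ suc t          ≡⟨ cong (_* M ^ suc t) eqH ⟩
      suc h * M ^ suc t                <⟨ few ⟩
      suc M * suc M ^ t                ∎)
    l₃ : ∀ a b c → a * b * c ≡ a * (b * c)
    l₃ = solve-∀
    l₄ : ∀ q p c → q * (p * c) ≡ p * (q * c)
    l₄ = solve-∀
    dense′ : (suc n ^ m) ^ suc k * (2 * m) ^ t ≤ card cols (pin Y i u v) * E
    dense′ = *-cancelˡ-≤ (2 * m) {{m*n≢0 2 m}} (begin
      2 * m * ((suc n ^ m) ^ suc k * (2 * m) ^ t)   ≡⟨ l₄ (2 * m) ((suc n ^ m) ^ suc k) ((2 * m) ^ t) ⟩
      (suc n ^ m) ^ suc k * (2 * m) ^ suc t         ≤⟨ dense ⟩
      card cols Y * E                               ≤⟨ *-monoˡ-≤ E goodY ⟩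
      2 * m * card cols (pin Y i u v) * E           ≡⟨ l₃ (2 * m) (card cols (pin Y i u v)) E ⟩
      2 * m * (card cols (pin Y i u v) * E)         ∎)
  ... | Y′ , r , sub , large , served =
    Y′ , (λ w → if X (insertAt w i u) then u else r w) , (λ y e → proj₁ (∧-true (sub y e))) , large′ , served′
    where
    large′ : card cols Y ≤ 2 * m * (2 * m) ^ t * card cols Y′
    large′ = begin
      card cols Y                                ≤⟨ goodY ⟩
      2 * m * card cols (pin Y i u v)            ≤⟨ *-monoʳ-≤ (2 * m) large ⟩
      2 * m * ((2 * m) ^ t * card cols Y′)       ≡⟨ *-assoc (2 * m) ((2 * m) ^ t) _ ⟨
      2 * m * (2 * m) ^ t * card cols Y′         ∎
      where open ≤-Reasoning
    served′ : ∀ w → H w ≡ true →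
      X (insertAt w i (if X (insertAt w i u) then u else r w)) ≡ true ×
      (∀ y → Y′ y ≡ true → lookup (lookup y i) (if X (insertAt w i u) then u else r w) ≡ v)
    served′ w e with X (insertAt w i u) in eq
    ... | true = eq , λ y e′ → ==-true _ v (proj₂ (∧-true {Y y} (sub y e′)))
    ... | false = served w (subst₂ (λ a b → a ∧ not b ≡ true) (sym e) (sym eq) refl)

Label : Set
Label = ℕ × ℕ × ℕ × ℕ

-- x i is the row chosen at node i, y i a the value Bob has stored in row a of node i; the value z at a
-- node i is a pointer to the node z if z < i, and marks i as dead otherwise.
Violation : ℕ → Label → (ℕ → ℕ) → (ℕ → ℕ → ℕ) → Set
Violation N (i , a , j , b) x y =
  i ≤ N × j < i × x i ≡ a × x j ≡ b × y i (x i) ≡ j × j ≤ y j (x j)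

sumFin-single : ∀ m (u : Fin m) (f : Fin m → ℕ) → (∀ w → w ≢ u → f w ≡ 0) → sumFin m f ≡ f u
sumFin-single (suc m) fzero f h =
  trans (cong (f fzero +_) (sumFin-zero m (λ w → h (fsuc w) (λ ())))) (+-identityʳ _)
  where
  sumFin-zero : ∀ m {f : Fin m → ℕ} → (∀ w → f w ≡ 0) → sumFin m f ≡ 0
  sumFin-zero zero h = refl
  sumFin-zero (suc m) h rewrite h fzero = sumFin-zero m (λ w → h (fsuc w))
sumFin-single (suc m) (fsuc u) f h rewrite h fzero (λ ()) =
  sumFin-single m u (f ∘ fsuc) (λ w ne → h (fsuc w) (λ { refl → ne refl }))

record Parameters (S n : ℕ) : Set where
  field
    m M β t B D P E : ℕ
    S≤n  : S ≤ n
    n>0  : 0 < n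
    B>0  : 0 < B
    B≡   : B ≡ suc n * β
    m≡   : m ≡ suc M * B
    m≡4D : m ≡ 4 * D
    D≡   : D ≡ 4 * (2 + n) * (2 * B)
    P≡   : P ≡ (2 * m) ^ t
    E≡   : E ≡ 2 ^ S * P ^ (2 + n)
    few  : m ^ (2 + n) * M ^ t < suc M ^ t
    4E≤  : 4 * E ≤ 2 ^ β

module Adversary {S n : ℕ} (params : Parameters S n) where
  open Parameters params

  private
    K = 2 + n
    N = suc n
    rows = allFin m
    full : ∀ a → _
    full = ∈-allFin {m}

    m>0 : 0 < m
    m>0 = ≤-trans (*-mono-≤ {1} {suc M} (s≤s z≤n) B>0) (≤-reflexive (sym m≡))

    instance
      n≢0 : NonZero n
      n≢0 = >-nonZero n>0
      m≢0 : NonZero m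
      m≢0 = >-nonZero m>0
      P≢0 : NonZero P
      P≢0 = subst NonZero (sym P≡) (m^n≢0 (2 * m) t {{m*n≢0 2 m}})
      NM≢0 : NonZero (N ^ m)
      NM≢0 = m^n≢0 N m

    E>0 : 0 < E
    E>0 = ≤-trans (*-mono-≤ (m^n>0 2 S) (m^n>0 P K)) (≤-reflexive (sym E≡))

    2B≥2 : 2 ≤ 2 * B
    2B≥2 = *-monoʳ-≤ 2 B>0

    AInput BInput : ℕ → Set
    AInput k = Vec (Fin m) k
    BInput k = Vec (Vec (Fin N) m) k

  record State (s k : ℕ) : Set where
    field
      X   : AInput (suc k) → Bool
      Y   : BInput (suc k) → Bool
      T   : Protocol (AInput (suc k)) (BInput (suc k)) Label
      lab : Fin (suc k) → ℕ
      eA  : AInput (suc k) → ℕ → ℕ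
      eB  : BInput (suc k) → ℕ → ℕ → ℕ
      descending : ∀ f g → f Fin.< g → lab g < lab f
      lab≤N  : ∀ f → lab f ≤ N
      coordA : ∀ x f → eA x (lab f) ≡ toℕ (lookup x f)
      coordB : ∀ y f a → eB y (lab f) (toℕ a) ≡ toℕ (lookup (lookup y f) a)
      settled : ∀ x y → X x ≡ true → Y y ≡ true → ∀ i → i ≤ N → (∀ f → lab f ≢ i) →
        let z = eB y i (eA x i) in
        i ≤ z ⊎ z ≡ lab fzero ⊎ (∀ f → lab f ≢ z) × eB y z (eA x z) < z
      correct : ∀ x y → X x ≡ true → Y y ≡ true → Violation N (run T x y) (eA x) (eB y)
      thick  : Thick rows full (2 * B) X
      c q    : ℕ
      c+s≡S  : c + s ≡ S
      q+k≡K  : q + suc k ≡ K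
      largeX : m ^ suc k * 4 ^ q ≤ card rows X * 4 ^ c
      largeY : (N ^ m) ^ suc k ≤ card cols Y * (2 ^ c * P ^ q)
      small  : leaves T * 3 ^ s ≤ 4 ^ s

  private
    module _ {s k} (σ : State s k) where
      open State σ

      nonemptyX : ∃ λ x → X x ≡ true
      nonemptyX = cnt>0⇒∃ (allVec rows (suc k)) X
        (n≢0⇒n>0 (λ e → <⇒≱ (*-mono-≤ (m^n>0 m (suc k)) (m^n>0 4 q))
                              (≤-trans largeX (≤-reflexive (cong (_* 4 ^ c) e)))))

      nonemptyY : ∃ λ y → Y y ≡ true
      nonemptyY = cnt>0⇒∃ (allVec cols (suc k)) Y
        (n≢0⇒n>0 (λ e → <⇒≱ (m^n>0 (N ^ m) (suc k))
                              (≤-trans largeY (≤-reflexive (cong (_* (2 ^ c * P ^ q)) e)))))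

      q≤n : q ≤ n
      q≤n with q ≤? c
      ... | yes le = ≤-trans le (≤-trans (m≤m+n c s) (≤-trans (≤-reflexive c+s≡S) S≤n))
      ... | no gt = ⊥-elim (<⇒≱ (^-monoʳ-< 4 (s≤s (s≤s z≤n)) (≰⇒> gt)) 4^q≤4^c)
        where
        card-bound : card rows X ≤ m ^ suc k
        card-bound = ≤-trans (card≤ rows X) (≤-reflexive (cong (_^ suc k) (length-allFin m)))
        4^q≤4^c : 4 ^ q ≤ 4 ^ c
        4^q≤4^c = *-cancelˡ-≤ (m ^ suc k) {{m^n≢0 m (suc k)}} (≤-trans largeX (*-monoˡ-≤ (4 ^ c) card-bound))

      varied : ∀ f a → (∀ x → X x ≡ true → eA x (lab f) ≡ a) → ⊥
      varied f a const with nonemptyX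
      ... | x , Xx = <⇒≱ (≤-trans 2B≥2 (thick f w deg>0)) deg≤1
        where
        w = removeAt x f
        u₀ = lookup x f
        Xu₀ : X (insertAt w f u₀) ≡ true
        Xu₀ = trans (cong X (insertAt-removeAt x f)) Xx
        deg>0 : 0 < deg rows X f w
        deg>0 = cnt-∈ _ (full u₀) Xu₀
        value : ∀ u → X (insertAt w f u) ≡ true → toℕ u ≡ a
        value u e = trans (cong toℕ (sym (insertAt-lookup w f u)))
                          (trans (sym (coordA (insertAt w f u) f)) (const _ e))
        other : ∀ u → u ≢ u₀ → b2n (X (insertAt w f u)) ≡ 0
        other u ne with X (insertAt w f u) in eq
        ... | false = refl
        ... | true = ⊥-elim (ne (toℕ-injective (trans (value u eq) (sym (value u₀ Xu₀)))))
        deg≤1 : deg rows X f w ≤ 1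
        deg≤1 = ≤-trans (≤-reflexive (trans (sumL-allFin m _) (sumFin-single m u₀ _ other))) (b2n≤1 _)

      not-constant : ∀ o → T ≡ leaf o → ⊥
      not-constant (i , a , j , b) refl
        with any? (λ f → lab f ≟ i) | any? (λ f → lab f ≟ j)
      ... | yes (f , refl) | _ =
        varied f a λ x Xx → proj₁ (proj₂ (proj₂ (correct x (proj₁ nonemptyY) Xx (proj₂ nonemptyY))))
      ... | no _ | yes (f , refl) =
        varied f b λ x Xx → proj₁ (proj₂ (proj₂ (proj₂ (correct x (proj₁ nonemptyY) Xx (proj₂ nonemptyY)))))
      ... | no i∉ | no j∉ with nonemptyX | nonemptyY
      ... | x , Xx | y , Yy with correct x y Xx Yy
      ... | i≤N , j<i , _ , _ , zi≡j , j≤zj with settled x y Xx Yy i i≤N (λ f e → i∉ (f , e))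
      ... | inj₁ dead = <⇒≱ j<i (≤-trans dead (≤-reflexive zi≡j))
      ... | inj₂ (inj₁ head) = j∉ (fzero , trans (sym head) zi≡j)
      ... | inj₂ (inj₂ (_ , alive)) rewrite zi≡j = <⇒≱ alive j≤zj

    module Answer {s k} (σ : State s (suc k)) (f : Fin (2 + k)) where
      open State σ

      target : Fin (2 + k) → ℕ
      target fzero = lab (fsuc fzero)
      target (fsuc g) = lab (fsuc g)

      target<N : ∀ f → target f < N
      target<N fzero = ≤-trans (descending fzero (fsuc fzero) (s≤s z≤n)) (lab≤N fzero)
      target<N (fsuc g) = ≤-trans (descending fzero (fsuc g) (s≤s z≤n)) (lab≤N fzero)

      v : Fin N
      v = fromℕ< (target<N f)

      q≤K : suc q ≤ K
      q≤K = s≤s (≤-trans (q≤n σ) (n≤1+n n))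

      c≤S : c ≤ S
      c≤S = ≤-trans (m≤m+n c s) (≤-reflexive c+s≡S)

      Served : Set
      Served = ∃ λ Y₁ → Σ (AInput (suc k) → Fin m) λ u → Y₁ ⊆ᵇ Y × card cols Y ≤ (2 * m) ^ t * card cols Y₁ ×
        (∀ w → proj rows X f w ≡ true → X (insertAt w f (u w)) ≡ true ×
          (∀ y → Y₁ y ≡ true → lookup (lookup y f) (u w) ≡ v))

      served : Served
      served = serve X f v M B E β B≡ m≡ 4E≤ E>0 (Fin.fromℕ< (>-nonZero⁻¹ m)) t (proj rows X f) Y
        (λ w e → thick f w (true-0<ᵇ e)) fewH denseY
        where
        open ≤-Reasoning
        fewH : card rows (proj rows X f) * M ^ t < suc M ^ t
        fewH = begin-strict
          card rows (proj rows X f) * M ^ t  ≤⟨ *-monoˡ-≤ (M ^ t) (≤-trans (card≤ rows (proj rows X f))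
                                                  (≤-reflexive (cong (_^ suc k) (length-allFin m)))) ⟩
          m ^ suc k * M ^ t                  ≤⟨ *-monoˡ-≤ (M ^ t) (^-monoʳ-≤ m (≤-trans (n≤1+n (suc k))
                                                  (≤-trans (m≤n+m (2 + k) q) (≤-reflexive q+k≡K)))) ⟩
          m ^ K * M ^ t                      <⟨ few ⟩
          suc M ^ t                          ∎
        l₁ : ∀ y a b p → y * (a * b) * p ≡ y * (a * (p * b))
        l₁ = solve-∀
        denseY : (N ^ m) ^ (2 + k) * (2 * m) ^ t ≤ card cols Y * E
        denseY = begin
          (N ^ m) ^ (2 + k) * (2 * m) ^ t      ≡⟨ cong ((N ^ m) ^ (2 + k) *_) P≡ ⟨
          (N ^ m) ^ (2 + k) * P                ≤⟨ *-monoˡ-≤ P largeY ⟩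
          card cols Y * (2 ^ c * P ^ q) * P    ≡⟨ l₁ (card cols Y) (2 ^ c) (P ^ q) P ⟩
          card cols Y * (2 ^ c * P ^ suc q)    ≤⟨ *-monoʳ-≤ (card cols Y) (*-mono-≤ (^-monoʳ-≤ 2 c≤S) (^-monoʳ-≤ P q≤K)) ⟩
          card cols Y * (2 ^ S * P ^ K)        ≡⟨ cong (card cols Y *_) E≡ ⟨
          card cols Y * E                      ∎

    module Query {s k} (σ : State s (suc k)) (f : Fin (2 + k))
                 (gain : card rows (State.X σ) < D * card rows (proj rows (State.X σ) f))
                 (Y₁ : BInput (2 + k) → Bool) (u : AInput (suc k) → Fin m)
                 (Y₁⊆Y : Y₁ ⊆ᵇ State.Y σ)
                 (Y₁-large : card cols (State.Y σ) ≤ (2 * m) ^ t * card cols Y₁)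
                 (serves : ∀ w → proj rows (State.X σ) f w ≡ true → State.X σ (insertAt w f (u w)) ≡ true ×
                   (∀ y → Y₁ y ≡ true → lookup (lookup y f) (u w) ≡ Answer.v σ f)) where
      open State σ
      open Answer σ f using (target; target<N; v)

      col : BInput (suc k) → Vec (Fin N) m
      col y = search cols (λ F → Y₁ (insertAt y f F)) (replicate m fzero)

      X′ : AInput (suc k) → Bool
      X′ = proj rows X f
      Y′ : BInput (suc k) → Bool
      Y′ = proj cols Y₁ f
      liftA : AInput (suc k) → AInput (2 + k)
      liftA w = insertAt w f (u w)
      liftB : BInput (suc k) → BInput (2 + k)
      liftB y = insertAt y f (col y)
      lab′ : Fin (suc k) → ℕ
      lab′ g = lab (punchIn f g)

      liftA∈ : ∀ w → X′ w ≡ true → X (liftA w) ≡ true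
      liftA∈ w e = proj₁ (serves w e)
      liftB∈₁ : ∀ y → Y′ y ≡ true → Y₁ (liftB y) ≡ true
      liftB∈₁ y e = search-true cols (λ F → Y₁ (insertAt y f F)) (replicate m fzero) (true-0<ᵇ e)
      liftB∈ : ∀ y → Y′ y ≡ true → Y (liftB y) ≡ true
      liftB∈ y e = Y₁⊆Y (liftB y) (liftB∈₁ y e)

      answer : ∀ x y → X′ x ≡ true → Y′ y ≡ true →
        eB (liftB y) (lab f) (eA (liftA x) (lab f)) ≡ target f
      answer x y Xx Yy = begin
        eB (liftB y) (lab f) (eA (liftA x) (lab f))  ≡⟨ cong (eB (liftB y) (lab f)) (trans (coordA (liftA x) f)
                                                         (cong toℕ (insertAt-lookup x f (u x)))) ⟩
        eB (liftB y) (lab f) (toℕ (u x))             ≡⟨ coordB (liftB y) f (u x) ⟩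
        toℕ (lookup (lookup (liftB y) f) (u x))      ≡⟨ cong toℕ (proj₂ (serves x Xx) (liftB y) (liftB∈₁ y Yy)) ⟩
        toℕ v                                        ≡⟨ toℕ-fromℕ< (target<N f) ⟩
        target f                                     ∎
        where open ≡-Reasoning

      fresh : ∀ {i} → i ≢ lab f → (∀ g → lab′ g ≢ i) → ∀ h → lab h ≢ i
      fresh {i} ne nl h e with f Fin.≟ h
      ... | yes refl = ne (sym e)
      ... | no f≢h = nl (punchOut f≢h) (trans (cong lab (punchIn-punchOut f≢h)) e)

      settled′ : ∀ x y → X′ x ≡ true → Y′ y ≡ true → ∀ i → i ≤ N → (∀ g → lab′ g ≢ i) →
        let z = eB (liftB y) i (eA (liftA x) i) in
        i ≤ z ⊎ z ≡ lab′ fzero ⊎ (∀ g → lab′ g ≢ z) × eB (liftB y) z (eA (liftA x) z) < z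
      settled′ x y Xx Yy i i≤N i∉ with i ≟ lab f
      ... | yes refl rewrite answer x y Xx Yy = at-target f
        where
        at-target : ∀ f {Q : Set} → lab f ≤ target f ⊎ target f ≡ lab (punchIn f fzero) ⊎ Q
        at-target fzero = inj₂ (inj₁ refl)
        at-target (fsuc g) = inj₁ ≤-refl
      ... | no i≢ with settled (liftA x) (liftB y) (liftA∈ x Xx) (liftB∈ y Yy) i i≤N (fresh i≢ i∉)
      ... | inj₁ dead = inj₁ dead
      ... | inj₂ (inj₂ (z∉ , alive)) = inj₂ (inj₂ ((λ g → z∉ (punchIn f g)) , alive))
      ... | inj₂ (inj₁ head) = moved f refl
        where
        z = eB (liftB y) i (eA (liftA x) i)
        moved : ∀ f′ → f ≡ f′ →
          i ≤ z ⊎ z ≡ lab′ fzero ⊎ (∀ g → lab′ g ≢ z) × eB (liftB y) z (eA (liftA x) z) < z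
        moved (fsuc g) refl = inj₂ (inj₁ head)
        moved fzero refl rewrite head = inj₂ (inj₂
          ( (λ g e → <⇒≢ (descending fzero (fsuc g) (s≤s z≤n)) e)
          , ≤-trans (s≤s (≤-reflexive (answer x y Xx Yy))) (descending fzero (fsuc fzero) (s≤s z≤n))))

      punchIn-mono-< : ∀ {k} (f : Fin (suc k)) g h → g Fin.< h → punchIn f g Fin.< punchIn f h
      punchIn-mono-< fzero g h lt = s≤s lt
      punchIn-mono-< (fsuc f) fzero (fsuc h) lt = s≤s z≤n
      punchIn-mono-< (fsuc f) (fsuc g) (fsuc h) (s≤s lt) = s≤s (punchIn-mono-< f g h lt)

      next : State s k
      next = record
        { X = X′ ; Y = Y′ ; T = reindex liftA liftB id T ; lab = lab′
        ; eA = eA ∘ liftA ; eB = eB ∘ liftB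
        ; descending = λ g h lt → descending _ _ (punchIn-mono-< f g h lt)
        ; lab≤N = λ g → lab≤N (punchIn f g)
        ; coordA = λ x g → trans (coordA (liftA x) (punchIn f g)) (cong toℕ (insertAt-punchIn x f (u x) g))
        ; coordB = λ y g a → trans (coordB (liftB y) (punchIn f g) a)
                                   (cong (λ F → toℕ (lookup F a)) (insertAt-punchIn y f (col y) g))
        ; settled = settled′
        ; correct = λ x y Xx Yy → subst (λ o → Violation N o (eA (liftA x)) (eB (liftB y))) (sym (run-reindex liftA liftB id T x y))
                                        (correct (liftA x) (liftB y) (liftA∈ x Xx) (liftB∈ y Yy))
        ; thick = thick-proj rows full (2 * B) X thick f
        ; c = c ; q = suc q ; c+s≡S = c+s≡S
        ; q+k≡K = trans (sym (+-suc q (suc k))) q+k≡K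
        ; largeX = largeX′ ; largeY = largeY′
        ; small = ≤-trans (≤-reflexive (cong (_* 3 ^ s) (leaves-reindex liftA liftB id T))) small
        }
        where
        open ≤-Reasoning
        l₁ : ∀ a b c → a * (b * (4 * c)) ≡ 4 * (a * b * c)
        l₁ = solve-∀
        l₂ : ∀ d x c → 4 * (d * x * c) ≡ 4 * d * (x * c)
        l₂ = solve-∀
        largeX′ : m ^ suc k * 4 ^ suc q ≤ card rows X′ * 4 ^ c
        largeX′ = *-cancelˡ-≤ m (begin
          m * (m ^ suc k * (4 * 4 ^ q))   ≡⟨ l₁ m (m ^ suc k) (4 ^ q) ⟩
          4 * (m ^ (2 + k) * 4 ^ q)       ≤⟨ *-monoʳ-≤ 4 largeX ⟩
          4 * (card rows X * 4 ^ c)       ≤⟨ *-monoʳ-≤ 4 (*-monoˡ-≤ (4 ^ c) (<⇒≤ gain)) ⟩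
          4 * (D * card rows X′ * 4 ^ c)  ≡⟨ l₂ D (card rows X′) (4 ^ c) ⟩
          4 * D * (card rows X′ * 4 ^ c)  ≡⟨ cong (_* (card rows X′ * 4 ^ c)) m≡4D ⟨
          m * (card rows X′ * 4 ^ c)      ∎)
        l₃ : ∀ p q y a b → p * (q * y) * (a * b) ≡ q * (y * (a * (p * b)))
        l₃ = solve-∀
        Y₁≤ : card cols Y₁ ≤ N ^ m * card cols Y′
        Y₁≤ = ≤-trans (card≤proj cols Y₁ f) (≤-reflexive (cong (_* card cols Y′) (length-cols {m} {n})))
        Y₁-large′ : card cols Y ≤ P * card cols Y₁
        Y₁-large′ = ≤-trans Y₁-large (≤-reflexive (cong (_* card cols Y₁) (sym P≡)))
        largeY′ : (N ^ m) ^ suc k ≤ card cols Y′ * (2 ^ c * P ^ suc q)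
        largeY′ = *-cancelˡ-≤ (N ^ m) (begin
          (N ^ m) ^ (2 + k)                                  ≤⟨ largeY ⟩
          card cols Y * (2 ^ c * P ^ q)                      ≤⟨ *-monoˡ-≤ (2 ^ c * P ^ q) (≤-trans Y₁-large′ (*-monoʳ-≤ P Y₁≤)) ⟩
          P * (N ^ m * card cols Y′) * (2 ^ c * P ^ q)       ≡⟨ l₃ P (N ^ m) (card cols Y′) (2 ^ c) (P ^ q) ⟩
          N ^ m * (card cols Y′ * (2 ^ c * P ^ suc q))       ∎)

    module Communicate {s k} (σ : State (suc s) k)
                       (spread : ∀ f → D * card rows (proj rows (State.X σ) f) ≤ card rows (State.X σ))
                       (halved : Split (allVec rows (suc k)) (allVec cols (suc k)) (State.X σ) (State.Y σ) (State.T σ))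
                       (X′ : AInput (suc k) → Bool) (X′⊆P′ : X′ ⊆ᵇ Split.P′ halved)
                       (X′-thick : Thick rows full (2 * B) X′)
                       (loss : card rows (Split.P′ halved) ≤
                               card rows X′ + 2 * B * sumFin (suc k) (λ f → card rows (proj rows (Split.P′ halved) f))) where
      open State σ
      open Split halved

      quarter : card rows X ≤ 4 * card rows X′
      quarter = begin
        card rows X              ≤⟨ halfP ⟩
        2 * card rows P′         ≤⟨ *-monoʳ-≤ 2 P′≤ ⟩
        2 * (2 * card rows X′)   ≡⟨ *-assoc 2 2 (card rows X′) ⟨
        4 * card rows X′         ∎
        where
        open ≤-Reasoning
        π : Fin (suc k) → ℕ
        π f = card rows (proj rows P′ f)
        Σπ = sumFin (suc k) π
        δ = 2 * B
        k≤K : suc k ≤ K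
        k≤K = ≤-trans (m≤n+m (suc k) q) (≤-reflexive q+k≡K)
        l₁ : ∀ K d σ → 2 * K * d * (2 * (d * σ)) ≡ d * (4 * K * d * σ)
        l₁ = solve-∀
        l₂ : ∀ K d p → d * (K * (2 * p)) ≡ 2 * K * d * p
        l₂ = solve-∀
        DΣπ≤ : D * Σπ ≤ K * (2 * card rows P′)
        DΣπ≤ = begin
          D * Σπ                                 ≡⟨ sumFin-* (suc k) D π ⟨
          sumFin (suc k) (λ f → D * π f)         ≤⟨ sumFin-mono (suc k) (λ f → ≤-trans (*-monoʳ-≤ D
                                                      (cnt-mono (allVec rows k) (proj-mono rows full P′⊆P f))) (spread f)) ⟩
          sumFin (suc k) (λ _ → card rows X)     ≡⟨ sumFin-const (suc k) _ ⟩
          suc k * card rows X                    ≤⟨ *-mono-≤ k≤K halfP ⟩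
          K * (2 * card rows P′)                 ∎
        2δΣπ≤ : 2 * (δ * Σπ) ≤ card rows P′
        2δΣπ≤ = *-cancelˡ-≤ (2 * K * δ) {{m*n≢0 (2 * K) δ {{_}} {{>-nonZero (≤-trans (s≤s z≤n) 2B≥2)}}}} (begin
          2 * K * δ * (2 * (δ * Σπ))      ≡⟨ l₁ K δ Σπ ⟩
          δ * (4 * K * δ * Σπ)            ≡⟨ cong (λ d → δ * (d * Σπ)) D≡ ⟨
          δ * (D * Σπ)                    ≤⟨ *-monoʳ-≤ δ DΣπ≤ ⟩
          δ * (K * (2 * card rows P′))    ≡⟨ l₂ K δ (card rows P′) ⟩
          2 * K * δ * card rows P′        ∎)
        a+a≡2a : ∀ a → a + a ≡ 2 * a
        a+a≡2a = solve-∀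
        P′≤ : card rows P′ ≤ 2 * card rows X′
        P′≤ = +-cancelʳ-≤ (card rows P′) _ _ (begin
          card rows P′ + card rows P′            ≡⟨ a+a≡2a (card rows P′) ⟩
          2 * card rows P′                       ≤⟨ *-monoʳ-≤ 2 loss ⟩
          2 * (card rows X′ + δ * Σπ)            ≡⟨ *-distribˡ-+ 2 (card rows X′) (δ * Σπ) ⟩
          2 * card rows X′ + 2 * (δ * Σπ)        ≤⟨ +-monoʳ-≤ (2 * card rows X′) 2δΣπ≤ ⟩
          2 * card rows X′ + card rows P′        ∎)

      X′⊆X : X′ ⊆ᵇ X
      X′⊆X x e = P′⊆P x (X′⊆P′ x e)

      next : State s k
      next = record
        { X = X′ ; Y = Q′ ; T = T′ ; lab = lab ; eA = eA ; eB = eB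
        ; descending = descending ; lab≤N = lab≤N ; coordA = coordA ; coordB = coordB
        ; settled = λ x y Xx Yy → settled x y (X′⊆X x Xx) (Q′⊆Q y Yy)
        ; correct = λ x y Xx Yy → subst (λ o → Violation N o (eA x) (eB y)) (sym (agree x y (X′⊆P′ x Xx) Yy))
                                        (correct x y (X′⊆X x Xx) (Q′⊆Q y Yy))
        ; thick = X′-thick
        ; c = suc c ; q = q ; c+s≡S = trans (sym (+-suc c s)) c+s≡S ; q+k≡K = q+k≡K
        ; largeX = ≤-trans largeX (≤-trans (*-monoˡ-≤ (4 ^ c) quarter) (≤-reflexive (l₁ 4 (card rows X′) (4 ^ c))))
        ; largeY = ≤-trans largeY (≤-trans (*-monoˡ-≤ (2 ^ c * P ^ q) halfQ)
                                           (≤-reflexive (l₂ (card cols Q′) (2 ^ c) (P ^ q))))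
        ; small = *-cancelˡ-≤ 4 (begin
            4 * (leaves T′ * 3 ^ s)   ≡⟨ *-assoc 4 (leaves T′) (3 ^ s) ⟨
            4 * leaves T′ * 3 ^ s     ≤⟨ *-monoˡ-≤ (3 ^ s) fewer ⟩
            3 * leaves T * 3 ^ s      ≡⟨ l₁ 3 (leaves T) (3 ^ s) ⟩
            leaves T * 3 ^ suc s      ≤⟨ small ⟩
            4 ^ suc s                 ∎)
        }
        where
        open ≤-Reasoning
        l₁ : ∀ a x c → a * x * c ≡ x * (a * c)
        l₁ = solve-∀
        l₂ : ∀ y a b → 2 * y * (a * b) ≡ y * (2 * a * b)
        l₂ = solve-∀

  contradiction : ∀ s k → State s k → ⊥
  contradiction s zero σ = <⇒≱ (≤-reflexive (sym (+-cancelʳ-≡ 1 q (suc n) (trans q+k≡K (+-comm 1 (suc n)))))) (q≤n σ)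
    where open State σ
  contradiction s (suc k) σ
    with any? (λ f → card rows (State.X σ) <? D * card rows (proj rows (State.X σ) f))
  ... | yes (f , gain) with Answer.served σ f
  ...   | Y₁ , u , sub , large , serves = contradiction s k (Query.next σ f gain Y₁ u sub large serves)
  contradiction s (suc k) σ | no none with leaves (State.T σ) ≤? 1
  ... | yes le = let o , eq = leaves≤1 (State.T σ) le in not-constant σ o eq
  contradiction zero (suc k) σ | no none | no gt = gt (≤-trans (≤-reflexive (sym (*-identityʳ _))) (State.small σ))
  contradiction (suc s) (suc k) σ | no none | no gt
    with split (allVec rows (2 + k)) (allVec cols (2 + k)) (State.X σ) (State.Y σ) (State.T σ) (≰⇒> gt)
  ... | halved with thicken rows full (2 * B) (Split.P′ halved)
  ...   | X′ , sub , th , loss =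
    contradiction s (suc k) (Communicate.next σ (λ f → ≮⇒≥ (λ lt → none (f , lt))) halved X′ sub th loss)

-- Semantics of sequents

false≢true : false ≡ true → ⊥
false≢true ()

AllTrue AllFalse : (ℕ → Bool) → List Fm → Set
AllTrue v = All (λ A → eval v A ≡ true)
AllFalse v = All (λ A → eval v A ≡ false)

⋀-true : ∀ v Γ → eval v (⋀ Γ) ≡ true → AllTrue v Γ
⋀-true v [] e = []
⋀-true v (A ∷ Γ) e = let p , q = ∧-true {eval v A} e in p ∷ ⋀-true v Γ q

AllTrue⇒⋀ : ∀ {v Γ} → AllTrue v Γ → eval v (⋀ Γ) ≡ true
AllTrue⇒⋀ [] = refl
AllTrue⇒⋀ (p ∷ ps) rewrite p = AllTrue⇒⋀ ps

⋁-false : ∀ v Δ → eval v (⋁ Δ) ≡ false → AllFalse v Δ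
⋁-false v [] e = []
⋁-false v (A ∷ Δ) e with eval v A in eq
... | false = eq ∷ ⋁-false v Δ e

AllFalse⇒⋁ : ∀ {v Δ} → AllFalse v Δ → eval v (⋁ Δ) ≡ false
AllFalse⇒⋁ [] = refl
AllFalse⇒⋁ (p ∷ ps) rewrite p = AllFalse⇒⋁ ps

valid⇒unrefuted : ∀ {S} → Valid S → ∀ {v} → AllTrue v (ante S) → AllFalse v (succ S) → ⊥
valid⇒unrefuted V {v} ts fs with V v
... | e rewrite AllTrue⇒⋀ ts | AllFalse⇒⋁ fs = false≢true e

unrefuted⇒valid : ∀ {S} → (∀ v → AllTrue v (ante S) → AllFalse v (succ S) → ⊥) → Valid S
unrefuted⇒valid {S} h v with eval v (⋀ (ante S)) in eqA | eval v (⋁ (succ S)) in eqS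
... | false | _ = refl
... | true | true = refl
... | true | false = ⊥-elim (h v (⋀-true v (ante S) eqA) (⋁-false v (succ S) eqS))

All-concatFin⁻ : ∀ {Q : Fm → Set} n (Γ : Fin n → List Fm) → All Q (concatFin n Γ) → ∀ i → All Q (Γ i)
All-concatFin⁻ (suc n) Γ h fzero = ++⁻ˡ (Γ fzero) h
All-concatFin⁻ (suc n) Γ h (fsuc i) = All-concatFin⁻ n (Γ ∘ fsuc) (++⁻ʳ (Γ fzero) h) i

All-concatFin⁺ : ∀ {Q : Fm → Set} n (Γ : Fin n → List Fm) → (∀ i → All Q (Γ i)) → All Q (concatFin n Γ)
All-concatFin⁺ zero Γ h = []
All-concatFin⁺ (suc n) Γ h = ++⁺ (h fzero) (All-concatFin⁺ n (Γ ∘ fsuc) (h ∘ fsuc))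

lookupF-∈ : ∀ xs r → lookupF xs r ∈ xs
lookupF-∈ (x ∷ xs) fzero = here refl
lookupF-∈ (x ∷ xs) (fsuc r) = there (lookupF-∈ xs r)

All-lookupF : ∀ {Q : List MFm → Set} xs → (∀ r → Q (lookupF xs r)) → All Q xs
All-lookupF [] h = []
All-lookupF (x ∷ xs) h = h fzero ∷ All-lookupF xs (h ∘ fsuc)

module Soundness (G : Calculus) (cpc : CalculusForCPC G) where

  sound : ∀ {S} → GProof G S → Valid S
  sound {S} = proj₁ (cpc S)

  axiom-sound : ∀ a → a ∈ axioms G → ∀ σ Γ Δ → Valid (axInst a σ Γ Δ)
  axiom-sound a a∈ σ Γ Δ = sound (axN a a∈ σ Γ Δ (↭-refl , ↭-refl))

  -- Put the disjunction of the premises' active formulas into the succedents: the premises become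
  -- valid, hence derivable, and so the conclusion is valid.
  left-sound : ∀ {n main prem} → record { side = left ; n = n ; main = main ; prem = prem } ∈ rules G →
    ∀ σ v → eval v (inst σ main) ≡ true →
    (∀ i r → eval v (⋀ (instL σ (lookupF (prem i) r))) ≡ false) → ⊥
  left-sound {n} {main} {prem} R∈ σ v t f =
    valid⇒unrefuted (sound (ruleN _ R∈ σ (λ _ → []) Δ (↭-refl , ↭-refl) premises))
      (++⁺ (All-concatFin⁺ n (λ _ → []) (λ _ → [])) (t ∷ []))
      (All-concatFin⁺ n Δ (λ i → map⁺ (All-lookupF (prem i) (f i))))
    where
    Δ : Fin n → List Fm
    Δ i = map (λ φs → ⋀ (instL σ φs)) (prem i)
    premises : ∀ i r → GProof G (([] ++ instL σ (lookupF (prem i) r)) ⇛ Δ i)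
    premises i r = proj₂ (cpc _) (unrefuted⇒valid {instL σ (lookupF (prem i) r) ⇛ Δ i} λ w ts fs → false≢true (trans
      (sym (All.lookup fs (∈-map⁺ (λ φs → ⋀ (instL σ φs)) (lookupF-∈ (prem i) r)))) (AllTrue⇒⋀ ts)))

  right-sound : ∀ {n main prem} → record { side = right ; n = n ; main = main ; prem = prem } ∈ rules G →
    ∀ σ v → eval v (inst σ main) ≡ false →
    (∀ i r → eval v (⋁ (instL σ (lookupF (prem i) r))) ≡ true) → ⊥
  right-sound {n} {main} {prem} R∈ σ v t f =
    valid⇒unrefuted (sound (ruleN _ R∈ σ Γ (λ _ → []) (↭-refl , ↭-refl) premises))
      (All-concatFin⁺ n Γ (λ i → map⁺ (All-lookupF (prem i) (f i))))
      (++⁺ (All-concatFin⁺ n (λ _ → []) (λ _ → [])) (t ∷ []))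
    where
    Γ : Fin n → List Fm
    Γ i = map (λ φs → ⋁ (instL σ φs)) (prem i)
    premises : ∀ i r → GProof G (Γ i ⇛ (instL σ (lookupF (prem i) r) ++ []))
    premises i r = proj₂ (cpc _) (unrefuted⇒valid λ w ts fs → false≢true (trans
      (sym (AllFalse⇒⋁ (++⁻ˡ (instL σ (lookupF (prem i) r)) fs)))
      (All.lookup ts (∈-map⁺ (λ φs → ⋁ (instL σ φs)) (lookupF-∈ (prem i) r)))))

-- Atoms and polarity of instances

AllAtoms : (ℕ → Set) → Fm → Set
AllAtoms Q (atom k) = Q k
AllAtoms Q ⊤ᶠ = ⊤
AllAtoms Q ⊥ᶠ = ⊤
AllAtoms Q (A ∧ᶠ B) = AllAtoms Q A × AllAtoms Q B
AllAtoms Q (A ∨ᶠ B) = AllAtoms Q A × AllAtoms Q B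
AllAtoms Q (A ⇒ᶠ B) = AllAtoms Q A × AllAtoms Q B
AllAtoms Q (¬ᶠ A) = AllAtoms Q A

Free : (ℕ → Set) → Fm → Set
Free P = AllAtoms (λ k → ¬ P k)

Monotone : (ℕ → Set) → Fm → Set
Monotone P (atom k) = ⊤
Monotone P ⊤ᶠ = ⊤
Monotone P ⊥ᶠ = ⊤
Monotone P (A ∧ᶠ B) = Monotone P A × Monotone P B
Monotone P (A ∨ᶠ B) = Monotone P A × Monotone P B
Monotone P (A ⇒ᶠ B) = Free P A × Monotone P B
Monotone P (¬ᶠ A) = Free P A

Free⇒Monotone : ∀ P A → Free P A → Monotone P A
Free⇒Monotone P (atom k) f = tt
Free⇒Monotone P ⊤ᶠ f = tt
Free⇒Monotone P ⊥ᶠ f = tt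
Free⇒Monotone P (A ∧ᶠ B) (f , g) = Free⇒Monotone P A f , Free⇒Monotone P B g
Free⇒Monotone P (A ∨ᶠ B) (f , g) = Free⇒Monotone P A f , Free⇒Monotone P B g
Free⇒Monotone P (A ⇒ᶠ B) (f , g) = f , Free⇒Monotone P B g
Free⇒Monotone P (¬ᶠ A) f = f

Free-stable : ∀ P A → ¬ ¬ Free P A → Free P A
Free-stable P (atom k) h = λ p → h (λ ¬p → ¬p p)
Free-stable P ⊤ᶠ h = tt
Free-stable P ⊥ᶠ h = tt
Free-stable P (A ∧ᶠ B) h = Free-stable P A (λ ¬a → h (¬a ∘ proj₁)) , Free-stable P B (λ ¬b → h (¬b ∘ proj₂))
Free-stable P (A ∨ᶠ B) h = Free-stable P A (λ ¬a → h (¬a ∘ proj₁)) , Free-stable P B (λ ¬b → h (¬b ∘ proj₂))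
Free-stable P (A ⇒ᶠ B) h = Free-stable P A (λ ¬a → h (¬a ∘ proj₁)) , Free-stable P B (λ ¬b → h (¬b ∘ proj₂))
Free-stable P (¬ᶠ A) h = Free-stable P A h

VarAtoms : (ℕ → Set) → (ℕ → Fm) → Var → Set
VarAtoms Q σ (fv k) = AllAtoms Q (σ k)
VarAtoms Q σ (at k) = Q k

AllAtoms-inst⁻ : ∀ {Q} σ A → AllAtoms Q (inst σ A) → ∀ {x} → Occ x A → VarAtoms Q σ x
AllAtoms-inst⁻ σ (fvar k) h o-fv = h
AllAtoms-inst⁻ σ (atom k) h o-at = h
AllAtoms-inst⁻ σ (A ∧ᵐ B) (h , _) (o-∧l o) = AllAtoms-inst⁻ σ A h o
AllAtoms-inst⁻ σ (A ∧ᵐ B) (_ , h) (o-∧r o) = AllAtoms-inst⁻ σ B h o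
AllAtoms-inst⁻ σ (A ∨ᵐ B) (h , _) (o-∨l o) = AllAtoms-inst⁻ σ A h o
AllAtoms-inst⁻ σ (A ∨ᵐ B) (_ , h) (o-∨r o) = AllAtoms-inst⁻ σ B h o
AllAtoms-inst⁻ σ (A ⇒ᵐ B) (h , _) (o-⇒l o) = AllAtoms-inst⁻ σ A h o
AllAtoms-inst⁻ σ (A ⇒ᵐ B) (_ , h) (o-⇒r o) = AllAtoms-inst⁻ σ B h o
AllAtoms-inst⁻ σ (¬ᵐ A) h (o-¬ o) = AllAtoms-inst⁻ σ A h o

AllAtoms-inst⁺ : ∀ {Q} σ A → (∀ x → Occ x A → VarAtoms Q σ x) → AllAtoms Q (inst σ A)
AllAtoms-inst⁺ σ (fvar k) h = h (fv k) o-fv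
AllAtoms-inst⁺ σ (atom k) h = h (at k) o-at
AllAtoms-inst⁺ σ ⊤ᵐ h = tt
AllAtoms-inst⁺ σ ⊥ᵐ h = tt
AllAtoms-inst⁺ σ (A ∧ᵐ B) h = AllAtoms-inst⁺ σ A (λ x → h x ∘ o-∧l) , AllAtoms-inst⁺ σ B (λ x → h x ∘ o-∧r)
AllAtoms-inst⁺ σ (A ∨ᵐ B) h = AllAtoms-inst⁺ σ A (λ x → h x ∘ o-∨l) , AllAtoms-inst⁺ σ B (λ x → h x ∘ o-∨r)
AllAtoms-inst⁺ σ (A ⇒ᵐ B) h = AllAtoms-inst⁺ σ A (λ x → h x ∘ o-⇒l) , AllAtoms-inst⁺ σ B (λ x → h x ∘ o-⇒r)
AllAtoms-inst⁺ σ (¬ᵐ A) h = AllAtoms-inst⁺ σ A (λ x → h x ∘ o-¬)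

AllAtoms-⊆V : ∀ {Q} σ {A B} → B ⊆V A → AllAtoms Q (inst σ A) → AllAtoms Q (inst σ B)
AllAtoms-⊆V σ {A} {B} sub h = AllAtoms-inst⁺ σ B (λ x o → AllAtoms-inst⁻ σ A h (sub x o))

Touched : (ℕ → Set) → (ℕ → Fm) → Var → Set
Touched P σ (fv k) = ¬ Free P (σ k)
Touched P σ (at k) = P k

module _ (P : ℕ → Set) (σ : ℕ → Fm) where

  Free⇒NoOcc : ∀ A → Free P (inst σ A) → NoOcc (Touched P σ) A
  Free⇒NoOcc A f (fv k) o t = t (AllAtoms-inst⁻ σ A f o)
  Free⇒NoOcc A f (at k) o t = AllAtoms-inst⁻ σ A f o t

  NoOcc⇒Free : ∀ A → NoOcc (Touched P σ) A → Free P (inst σ A)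
  NoOcc⇒Free A h = AllAtoms-inst⁺ σ A λ
    { (fv k) o → Free-stable P (σ k) (λ ¬f → h (fv k) o ¬f)
    ; (at k) o → h (at k) o }

  Monotone⇒Mono : ∀ A → Monotone P (inst σ A) → Mono (Touched P σ) A
  Monotone⇒Mono (fvar k) h = tt
  Monotone⇒Mono (atom k) h = tt
  Monotone⇒Mono ⊤ᵐ h = tt
  Monotone⇒Mono ⊥ᵐ h = tt
  Monotone⇒Mono (A ∧ᵐ B) (h , g) = Monotone⇒Mono A h , Monotone⇒Mono B g
  Monotone⇒Mono (A ∨ᵐ B) (h , g) = Monotone⇒Mono A h , Monotone⇒Mono B g
  Monotone⇒Mono (A ⇒ᵐ B) (h , g) = Free⇒NoOcc A h , Monotone⇒Mono B g
  Monotone⇒Mono (¬ᵐ A) h = Free⇒NoOcc A h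

  Monotone-σ : ∀ A → Monotone P (inst σ A) → ∀ {k} → Occ (fv k) A → Monotone P (σ k)
  Monotone-σ (fvar k) h o-fv = h
  Monotone-σ (A ∧ᵐ B) (h , _) (o-∧l o) = Monotone-σ A h o
  Monotone-σ (A ∧ᵐ B) (_ , h) (o-∧r o) = Monotone-σ B h o
  Monotone-σ (A ∨ᵐ B) (h , _) (o-∨l o) = Monotone-σ A h o
  Monotone-σ (A ∨ᵐ B) (_ , h) (o-∨r o) = Monotone-σ B h o
  Monotone-σ (A ⇒ᵐ B) (h , _) {k} (o-⇒l o) = Free⇒Monotone P (σ k) (AllAtoms-inst⁻ σ A h o)
  Monotone-σ (A ⇒ᵐ B) (_ , h) (o-⇒r o) = Monotone-σ B h o
  Monotone-σ (¬ᵐ A) h {k} (o-¬ o) = Free⇒Monotone P (σ k) (AllAtoms-inst⁻ σ A h o)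

  Mono⇒Monotone : ∀ A → Mono (Touched P σ) A → (∀ {k} → Occ (fv k) A → Monotone P (σ k)) →
                  Monotone P (inst σ A)
  Mono⇒Monotone (fvar k) h s = s o-fv
  Mono⇒Monotone (atom k) h s = tt
  Mono⇒Monotone ⊤ᵐ h s = tt
  Mono⇒Monotone ⊥ᵐ h s = tt
  Mono⇒Monotone (A ∧ᵐ B) (h , g) s = Mono⇒Monotone A h (s ∘ o-∧l) , Mono⇒Monotone B g (s ∘ o-∧r)
  Mono⇒Monotone (A ∨ᵐ B) (h , g) s = Mono⇒Monotone A h (s ∘ o-∨l) , Mono⇒Monotone B g (s ∘ o-∨r)
  Mono⇒Monotone (A ⇒ᵐ B) (h , g) s = NoOcc⇒Free A h , Mono⇒Monotone B g (s ∘ o-⇒r)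
  Mono⇒Monotone (¬ᵐ A) h s = NoOcc⇒Free A h

Free-everywhere : ∀ {P} A → AllAtoms P A → Free P A → ∀ v w → eval v A ≡ eval w A
Free-everywhere (atom k) p f v w = ⊥-elim (f p)
Free-everywhere ⊤ᶠ p f v w = refl
Free-everywhere ⊥ᶠ p f v w = refl
Free-everywhere (A ∧ᶠ B) (p , q) (f , g) v w = cong₂ _∧_ (Free-everywhere A p f v w) (Free-everywhere B q g v w)
Free-everywhere (A ∨ᶠ B) (p , q) (f , g) v w = cong₂ _∨_ (Free-everywhere A p f v w) (Free-everywhere B q g v w)
Free-everywhere (A ⇒ᶠ B) (p , q) (f , g) v w =
  cong₂ (λ a b → not a ∨ b) (Free-everywhere A p f v w) (Free-everywhere B q g v w)
Free-everywhere (¬ᶠ A) p f v w = cong not (Free-everywhere A p f v w)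

-- Chains of tests

module Chain {X Y Z : Set} (node : (Z → Bool) → Protocol X Y ℕ → Protocol X Y ℕ → Protocol X Y ℕ)
  (input : X → Y → Z)
  (leaves-node : ∀ c l r → leaves (node c l r) ≡ leaves l + leaves r)
  (run-node : ∀ c l r x y → run (node c l r) x y ≡ (if c (input x y) then run l x y else run r x y)) where

  private
    Tree = Protocol X Y ℕ

    chain : ∀ n → (Fin n → Z → Bool) → (Fin n → Tree) → Tree → Tree
    chain zero c T d = d
    chain (suc n) c T d = node (c fzero) (T fzero) (chain n (c ∘ fsuc) (T ∘ fsuc) d)

    leaves-chain : ∀ n c T d → leaves (chain n c T d) ≡ sumFin n (leaves ∘ T) + leaves d
    leaves-chain zero c T d = refl
    leaves-chain (suc n) c T d rewrite leaves-node (c fzero) (T fzero) (chain n (c ∘ fsuc) (T ∘ fsuc) d)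
      | leaves-chain n (c ∘ fsuc) (T ∘ fsuc) d = sym (+-assoc (leaves (T fzero)) _ _)

    run-chain : ∀ (Q : ℕ → Set) x y n c T d → (∀ r → c r (input x y) ≡ true → Q (run (T r) x y)) →
      ((∀ r → c r (input x y) ≡ false) → Q (run d x y)) → Q (run (chain n c T d) x y)
    run-chain Q x y zero c T d hit miss = miss (λ ())
    run-chain Q x y (suc n) c T d hit miss
      rewrite run-node (c fzero) (T fzero) (chain n (c ∘ fsuc) (T ∘ fsuc) d) x y
      with c fzero (input x y) in eq
    ... | true = hit fzero eq
    ... | false = run-chain Q x y n (c ∘ fsuc) (T ∘ fsuc) d (hit ∘ fsuc)
                    (λ h → miss λ { fzero → eq ; (fsuc r) → h r })

  chain² : ∀ n (ℓ : Fin n → ℕ) → (∀ i → Fin (ℓ i) → Z → Bool) → (∀ i → Fin (ℓ i) → Tree) → Tree → Tree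
  chain² zero ℓ c T d = d
  chain² (suc n) ℓ c T d =
    chain (ℓ fzero) (c fzero) (T fzero) (chain² n (ℓ ∘ fsuc) (λ i → c (fsuc i)) (λ i → T (fsuc i)) d)

  leaves-chain² : ∀ n ℓ c T d →
    leaves (chain² n ℓ c T d) ≡ sumFin n (λ i → sumFin (ℓ i) (λ r → leaves (T i r))) + leaves d
  leaves-chain² zero ℓ c T d = refl
  leaves-chain² (suc n) ℓ c T d
    rewrite leaves-chain (ℓ fzero) (c fzero) (T fzero) (chain² n (ℓ ∘ fsuc) (λ i → c (fsuc i)) (λ i → T (fsuc i)) d)
          | leaves-chain² n (ℓ ∘ fsuc) (λ i → c (fsuc i)) (λ i → T (fsuc i)) d =
    sym (+-assoc (sumFin (ℓ fzero) (λ r → leaves (T fzero r))) _ _)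

  run-chain² : ∀ (Q : ℕ → Set) x y n ℓ c T d → (∀ i r → c i r (input x y) ≡ true → Q (run (T i r) x y)) →
    ((∀ i r → c i r (input x y) ≡ false) → Q (run d x y)) → Q (run (chain² n ℓ c T d) x y)
  run-chain² Q x y zero ℓ c T d hit miss = miss (λ ())
  run-chain² Q x y (suc n) ℓ c T d hit miss =
    run-chain Q x y (ℓ fzero) (c fzero) (T fzero) _ (hit fzero) λ h₀ →
      run-chain² Q x y n (ℓ ∘ fsuc) (λ i → c (fsuc i)) (λ i → T (fsuc i)) d (λ i → hit (fsuc i))
        (λ h → miss λ { fzero → h₀ ; (fsuc i) → h i })

-- From proofs to protocols

module Interpolation (L R P : ℕ → Set) (L∩R⊆P : ∀ k → L k → R k → P k)
  {X Y : Set} (α : X → ℕ → Bool) (β : Y → ℕ → Bool) where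

  LeftOK RightOK : Fm → Set
  LeftOK A = AllAtoms L A × Monotone P A
  RightOK A = AllAtoms R A

  Separates : X → Y → ℕ → Set
  Separates x y o = P o × α x o ≡ true × β y o ≡ false

  private
    AllAtoms-∩ : ∀ A → AllAtoms L A → AllAtoms R A → AllAtoms P A
    AllAtoms-∩ (atom k) l r = L∩R⊆P k l r
    AllAtoms-∩ ⊤ᶠ l r = tt
    AllAtoms-∩ ⊥ᶠ l r = tt
    AllAtoms-∩ (A ∧ᶠ B) (l , l′) (r , r′) = AllAtoms-∩ A l r , AllAtoms-∩ B l′ r′
    AllAtoms-∩ (A ∨ᶠ B) (l , l′) (r , r′) = AllAtoms-∩ A l r , AllAtoms-∩ B l′ r′
    AllAtoms-∩ (A ⇒ᶠ B) (l , l′) (r , r′) = AllAtoms-∩ A l r , AllAtoms-∩ B l′ r′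
    AllAtoms-∩ (¬ᶠ A) l r = AllAtoms-∩ A l r

    -- The Karchmer–Wigderson protocol of a P-monotone formula over P.
    kw : Fm → Protocol X Y ℕ
    kw (atom k) = leaf k
    kw ⊤ᶠ = leaf 0
    kw ⊥ᶠ = leaf 0
    kw (A ∧ᶠ B) = nodeB (λ y → eval (β y) A) (kw B) (kw A)
    kw (A ∨ᶠ B) = nodeA (λ x → eval (α x) A) (kw A) (kw B)
    kw (A ⇒ᶠ B) = kw B
    kw (¬ᶠ A) = leaf 0

    leaves-kw : ∀ A → leaves (kw A) ≤ fsize A
    leaves-kw (atom k) = s≤s z≤n
    leaves-kw ⊤ᶠ = s≤s z≤n
    leaves-kw ⊥ᶠ = s≤s z≤n
    leaves-kw (A ∧ᶠ B) = m≤n⇒m≤1+n (≤-trans (+-mono-≤ (leaves-kw B) (leaves-kw A)) (≤-reflexive (+-comm (fsize B) _)))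
    leaves-kw (A ∨ᶠ B) = m≤n⇒m≤1+n (+-mono-≤ (leaves-kw A) (leaves-kw B))
    leaves-kw (A ⇒ᶠ B) = m≤n⇒m≤1+n (≤-trans (leaves-kw B) (m≤n+m _ (fsize A)))
    leaves-kw (¬ᶠ A) = s≤s z≤n

    run-kw : ∀ A → AllAtoms P A → Monotone P A → ∀ x y → eval (α x) A ≡ true → eval (β y) A ≡ false →
      Separates x y (run (kw A) x y)
    run-kw (atom k) p m x y t f = p , t , f
    run-kw ⊤ᶠ p m x y t ()
    run-kw ⊥ᶠ p m x y () f
    run-kw (A ∧ᶠ B) (p , p′) (m , m′) x y t f with ∧-true {eval (α x) A} t | eval (β y) A in eq
    ... | tA , tB | true = run-kw B p′ m′ x y tB f
    ... | tA , tB | false = run-kw A p m x y tA eq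
    run-kw (A ∨ᶠ B) (p , p′) (m , m′) x y t f with eval (α x) A in eqα | eval (β y) A in eqβ
    ... | true | false = run-kw A p m x y eqα eqβ
    ... | false | false = run-kw B p′ m′ x y t f
    run-kw (A ⇒ᶠ B) (p , p′) (m , m′) x y t f
      with eval (β y) A | Free-everywhere A p m (α x) (β y)
    ... | true | eq rewrite eq = run-kw B p′ m′ x y t f
    run-kw (¬ᶠ A) p m x y t f =
      ⊥-elim (false≢true (trans (sym f) (trans (cong not (Free-everywhere A p m (β y) (α x))) t)))

  module _ (G : Calculus) (focused : All (λ R → FocusedRule R × PPF R) (rules G)) (cpc : CalculusForCPC G) where
    open Soundness G cpc

    private
      left-premise : ∀ {n main prem} → record { side = left ; n = n ; main = main ; prem = prem } ∈ rules G →
        ∀ σ → LeftOK (inst σ main) → ∀ i r → All LeftOK (instL σ (lookupF (prem i) r))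
      left-premise {main = main} {prem} R∈ σ (atoms , mono) i r =
        map⁺ (All.tabulate λ {φ} φ∈ →
          let φ⊆ = foc i φs∈ φ∈ in
          AllAtoms-⊆V σ φ⊆ atoms ,
          Mono⇒Monotone P σ φ (All.lookup monos φ∈) (λ o → Monotone-σ P σ main mono (φ⊆ _ o)))
        where
        foc = proj₁ (All.lookup focused R∈)
        φs∈ = lookupF-∈ (prem i) r
        monos : All (Mono (Touched P σ)) (lookupF (prem i) r)
        monos = proj₂ (All.lookup focused R∈) (Touched P σ) (Monotone⇒Mono P σ main mono ∷ []) i φs∈

      right-premise : ∀ {n main prem} → record { side = right ; n = n ; main = main ; prem = prem } ∈ rules G →
        ∀ σ → RightOK (inst σ main) → ∀ i r → All RightOK (instL σ (lookupF (prem i) r))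
      right-premise {prem = prem} R∈ σ atoms i r =
        map⁺ (All.tabulate λ φ∈ → AllAtoms-⊆V σ (proj₁ (All.lookup focused R∈) i (lookupF-∈ (prem i) r) φ∈) atoms)

      module ChainA = Chain {X} {Y} nodeA (λ x y → x) (λ c l r → refl) (λ c l r x y → refl)
      module ChainB = Chain {X} {Y} nodeB (λ x y → y) (λ c l r → refl) (λ c l r x y → refl)

    ToProtocol : ∀ {S} → GProof G S → Set
    ToProtocol {S} π = Σ (Protocol X Y ℕ) λ T → leaves T ≤ gsize π ×
      (∀ x y → AllTrue (α x) (ante S) → AllFalse (β y) (succ S) → Separates x y (run T x y))

    private
      vacuous : ∀ {S} (π : GProof G S) → 1 ≤ gsize π →
        (∀ x y → AllTrue (α x) (ante S) → AllFalse (β y) (succ S) → ⊥) → ToProtocol π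
      vacuous π le h = leaf 0 , le , λ x y ts fs → ⊥-elim (h x y ts fs)

    toProtocol : ∀ {S} (π : GProof G S) → All LeftOK (ante S) → All RightOK (succ S) → ToProtocol π
    toProtocol {S} (axN (idAx A) a∈ σ Γ Δ (pl , pr)) okL okR =
      kw B , ≤-trans (leaves-kw B) size , λ x y ts fs →
        run-kw B (AllAtoms-∩ B (proj₁ okB) (All.head (All-resp-↭ pr okR))) (proj₂ okB) x y
          (All.head (All-resp-↭ pl ts)) (All.head (All-resp-↭ pr fs))
      where
      B = inst σ A
      okB = All.head (All-resp-↭ pl okL)
      size : fsize B ≤ seqSize S
      size = m≤n⇒m≤1+n (≤-trans (≤-trans (m≤m+n (fsize B) 0) (≤-reflexive (sym (sum-↭ (↭-map⁺ fsize pl))))) (m≤m+n _ _))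
    toProtocol π@(axN a@(rAx _) a∈ σ Γ Δ (pl , pr)) okL okR = vacuous π (s≤s z≤n) λ x y ts fs →
      valid⇒unrefuted (axiom-sound a a∈ σ [] []) [] (All-resp-↭ pr fs)
    toProtocol π@(axN a@(lAx _) a∈ σ Γ Δ (pl , pr)) okL okR = vacuous π (s≤s z≤n) λ x y ts fs →
      valid⇒unrefuted (axiom-sound a a∈ σ [] []) (All-resp-↭ pl ts) []
    toProtocol π@(axN a@(lCtxAx _) a∈ σ Γ Δ (pl , pr)) okL okR = vacuous π (s≤s z≤n) λ x y ts fs →
      valid⇒unrefuted (axiom-sound a a∈ σ [] []) (++⁻ʳ Γ (All-resp-↭ pl ts)) []
    toProtocol π@(axN a@(rCtxAx φs) a∈ σ Γ Δ (pl , pr)) okL okR = vacuous π (s≤s z≤n) λ x y ts fs →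
      valid⇒unrefuted (axiom-sound a a∈ σ [] []) [] (++⁺ (++⁻ˡ (instL σ φs) (All-resp-↭ pr fs)) [])
    toProtocol {S} π@(ruleN record { side = left ; n = n ; main = main ; prem = prem } R∈ σ Γ Δ (pl , pr) ps) okL okR =
      T , size , correct
      where
      ℓ : Fin n → ℕ
      ℓ i = length (prem i)
      φs : ∀ i → Fin (ℓ i) → List Fm
      φs i r = instL σ (lookupF (prem i) r)
      okL′ = All-resp-↭ pl okL
      okR′ = All-resp-↭ pr okR
      sub : ∀ i r → ToProtocol (ps i r)
      sub i r = toProtocol (ps i r)
        (++⁺ (All-concatFin⁻ n Γ (++⁻ˡ (concatFin n Γ) okL′) i)
             (left-premise R∈ σ (All.head (++⁻ʳ (concatFin n Γ) okL′)) i r))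
        (All-concatFin⁻ n Δ okR′ i)
      c : ∀ i → Fin (ℓ i) → X → Bool
      c i r x = eval (α x) (⋀ (φs i r))
      T = ChainA.chain² n ℓ c (λ i r → proj₁ (sub i r)) (leaf 0)
      size : leaves T ≤ gsize π
      size = ≤-trans (≤-reflexive (trans (ChainA.leaves-chain² n ℓ c (λ i r → proj₁ (sub i r)) (leaf 0)) (+-comm _ 1)))
        (+-mono-≤ {1} {seqSize S} (s≤s z≤n) (sumFin-mono n λ i → sumFin-mono (ℓ i) λ r → proj₁ (proj₂ (sub i r))))
      correct : ∀ x y → AllTrue (α x) (ante S) → AllFalse (β y) (succ S) → Separates x y (run T x y)
      correct x y ts fs = ChainA.run-chain² (Separates x y) x y n ℓ c _ (leaf 0)
        (λ i r t → proj₂ (proj₂ (sub i r)) x y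
          (++⁺ (All-concatFin⁻ n Γ (++⁻ˡ (concatFin n Γ) ts′) i) (⋀-true (α x) (φs i r) t))
          (All-concatFin⁻ n Δ (All-resp-↭ pr fs) i))
        (λ h → ⊥-elim (left-sound R∈ σ (α x) (All.head (++⁻ʳ (concatFin n Γ) ts′)) h))
        where ts′ = All-resp-↭ pl ts
    toProtocol {S} π@(ruleN record { side = right ; n = n ; main = main ; prem = prem } R∈ σ Γ Δ (pl , pr) ps) okL okR =
      T , size , correct
      where
      ℓ : Fin n → ℕ
      ℓ i = length (prem i)
      φs : ∀ i → Fin (ℓ i) → List Fm
      φs i r = instL σ (lookupF (prem i) r)
      okL′ = All-resp-↭ pl okL
      okR′ = All-resp-↭ pr okR
      sub : ∀ i r → ToProtocol (ps i r)
      sub i r = toProtocol (ps i r)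
        (All-concatFin⁻ n Γ okL′ i)
        (++⁺ (right-premise R∈ σ (All.head (++⁻ʳ (concatFin n Δ) okR′)) i r)
             (All-concatFin⁻ n Δ (++⁻ˡ (concatFin n Δ) okR′) i))
      c : ∀ i → Fin (ℓ i) → Y → Bool
      c i r y = not (eval (β y) (⋁ (φs i r)))
      not-true : ∀ {b} → not b ≡ true → b ≡ false
      not-true {false} e = refl
      not-false : ∀ {b} → not b ≡ false → b ≡ true
      not-false {true} e = refl
      T = ChainB.chain² n ℓ c (λ i r → proj₁ (sub i r)) (leaf 0)
      size : leaves T ≤ gsize π
      size = ≤-trans (≤-reflexive (trans (ChainB.leaves-chain² n ℓ c (λ i r → proj₁ (sub i r)) (leaf 0)) (+-comm _ 1)))
        (+-mono-≤ {1} {seqSize S} (s≤s z≤n) (sumFin-mono n λ i → sumFin-mono (ℓ i) λ r → proj₁ (proj₂ (sub i r))))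
      correct : ∀ x y → AllTrue (α x) (ante S) → AllFalse (β y) (succ S) → Separates x y (run T x y)
      correct x y ts fs = ChainB.run-chain² (Separates x y) x y n ℓ c _ (leaf 0)
        (λ i r t → proj₂ (proj₂ (sub i r)) x y
          (All-concatFin⁻ n Γ (All-resp-↭ pl ts) i)
          (++⁺ (⋁-false (β y) (φs i r) (not-true t)) (All-concatFin⁻ n Δ (++⁻ˡ (concatFin n Δ) fs′) i)))
        (λ h → ⊥-elim (right-sound R∈ σ (β y) (All.head (++⁻ʳ (concatFin n Δ) fs′)) (λ i r → not-false (h i r))))
        where fs′ = All-resp-↭ pr fs

-- Tableaux with w steps: contexts only grow, which makes the size of the sequents easy to control.

data Tableau (F : ℕ) : List Fm → List Fm → ℕ → Set where
  relax : ∀ {Γ Δ w w′} → w ≤ w′ → Tableau F Γ Δ w → Tableau F Γ Δ w′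
  close : ∀ {Γ Δ A} → A ∈ Γ → A ∈ Δ → Tableau F Γ Δ 1
  ⊥L    : ∀ {Γ Δ} → ⊥ᶠ ∈ Γ → Tableau F Γ Δ 1
  ∧L    : ∀ {Γ Δ A B w} → (A ∧ᶠ B) ∈ Γ → Tableau F (A ∷ B ∷ Γ) Δ w → Tableau F Γ Δ (suc w)
  ∧R    : ∀ {Γ Δ A B w w′} → (A ∧ᶠ B) ∈ Δ → Tableau F Γ (A ∷ Δ) w → Tableau F Γ (B ∷ Δ) w′ →
          Tableau F Γ Δ (suc (w + w′))
  ∨L    : ∀ {Γ Δ A B w w′} → (A ∨ᶠ B) ∈ Γ → Tableau F (A ∷ Γ) Δ w → Tableau F (B ∷ Γ) Δ w′ →
          Tableau F Γ Δ (suc (w + w′))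
  ∨R    : ∀ {Γ Δ A B w} → (A ∨ᶠ B) ∈ Δ → Tableau F Γ (A ∷ B ∷ Δ) w → Tableau F Γ Δ (suc w)
  ¬L    : ∀ {Γ Δ A w} → (¬ᶠ A) ∈ Γ → Tableau F Γ (A ∷ Δ) w → Tableau F Γ Δ (suc w)
  ¬R    : ∀ {Γ Δ A w} → (¬ᶠ A) ∈ Δ → Tableau F (A ∷ Γ) Δ w → Tableau F Γ Δ (suc w)
  cut   : ∀ {Γ Δ w w′} A → fsize A ≤ F → Tableau F Γ (A ∷ Δ) w → Tableau F (A ∷ Γ) Δ w′ →
          Tableau F Γ Δ (suc (w + w′))

tableau-sound : ∀ {F Γ Δ w} → Tableau F Γ Δ w → ∀ v → AllTrue v Γ → AllFalse v Δ → ⊥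
tableau-sound (relax _ t) v ts fs = tableau-sound t v ts fs
tableau-sound (close l r) v ts fs = false≢true (trans (sym (All.lookup fs r)) (All.lookup ts l))
tableau-sound (⊥L l) v ts fs = false≢true (All.lookup ts l)
tableau-sound (∧L {A = A} l t) v ts fs with ∧-true {eval v A} (All.lookup ts l)
... | a , b = tableau-sound t v (a ∷ b ∷ ts) fs
tableau-sound (∧R {A = A} r t t′) v ts fs with eval v A in eq | All.lookup fs r
... | false | _ = tableau-sound t v ts (eq ∷ fs)
... | true | b = tableau-sound t′ v ts (b ∷ fs)
tableau-sound (∨L {A = A} l t t′) v ts fs with eval v A in eq | All.lookup ts l
... | true | _ = tableau-sound t v (eq ∷ ts) fs
... | false | b = tableau-sound t′ v (b ∷ ts) fs
tableau-sound (∨R {A = A} r t) v ts fs with eval v A in eq | All.lookup fs r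
... | false | b = tableau-sound t v ts (eq ∷ b ∷ fs)
tableau-sound (¬L {A = A} l t) v ts fs with eval v A in eq | All.lookup ts l
... | false | _ = tableau-sound t v ts (eq ∷ fs)
tableau-sound (¬R {A = A} r t) v ts fs with eval v A in eq | All.lookup fs r
... | true | _ = tableau-sound t v (eq ∷ ts) fs
tableau-sound (cut A _ t t′) v ts fs with eval v A in eq
... | false = tableau-sound t v ts (eq ∷ fs)
... | true = tableau-sound t′ v (eq ∷ ts) fs

-- LK proofs of bounded size

LK≤ : ℕ → Seq → Set
LK≤ b S = Σ (LK S) λ π → lksize π ≤ b

total : List Fm → ℕ
total Γ = sum (map fsize Γ)

total-↭ : ∀ {Γ Γ′} → Γ ↭ Γ′ → total Γ ≡ total Γ′
total-↭ p = sum-↭ (↭-map⁺ fsize p)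

∈⇒↭ : {A : Set} {a : A} {xs : List A} → a ∈ xs → ∃ λ ys → xs ↭ (a ∷ ys)
∈⇒↭ {a = a} m with ∈-∃++ m
... | ys , zs , refl = ys ++ zs , shift a ys zs

seqSize≤ : ∀ F {Γ Δ} → All (λ A → fsize A ≤ F) Γ → All (λ A → fsize A ≤ F) Δ →
  seqSize (Γ ⇛ Δ) ≤ suc ((length Γ + length Δ) * F)
seqSize≤ F {Γ} {Δ} hΓ hΔ = s≤s (≤-trans (+-mono-≤ (go hΓ) (go hΔ)) (≤-reflexive (sym (*-distribʳ-+ F (length Γ) _))))
  where
  go : ∀ {Γ} → All (λ A → fsize A ≤ F) Γ → total Γ ≤ length Γ * F
  go [] = z≤n
  go (h ∷ hs) = +-mono-≤ h (go hs)

module _ (Z : ℕ) where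

  exchange : ∀ {Γ Γ′ Δ Δ′ b} → Γ ↭ Γ′ → Δ ↭ Δ′ → seqSize (Γ ⇛ Δ) ≤ Z →
    LK≤ b (Γ ⇛ Δ) → LK≤ (Z + b) (Γ′ ⇛ Δ′)
  exchange p q le (π , h) = exch p q π ,
    +-mono-≤ (≤-trans (s≤s (≤-reflexive (cong₂ _+_ (sym (total-↭ p)) (sym (total-↭ q))))) le) h

  contractL : ∀ {A Γ Δ b} → A ∈ Γ → seqSize ((A ∷ Γ) ⇛ Δ) ≤ Z → LK≤ b ((A ∷ Γ) ⇛ Δ) → LK≤ (Z + (Z + (Z + b))) (Γ ⇛ Δ)
  contractL {A} {Γ} {Δ} m le π with ∈⇒↭ m
  ... | Γ₀ , p with exchange (prep A p) ↭-refl le π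
  ...   | π₁ , h₁ = exchange (↭-sym p) ↭-refl le₀ (cL π₁ , +-mono-≤ le₀ h₁)
    where
    le₀ : seqSize ((A ∷ Γ₀) ⇛ Δ) ≤ Z
    le₀ = ≤-trans (s≤s (+-monoˡ-≤ (total Δ) (≤-trans (≤-reflexive (sym (total-↭ p))) (m≤n+m _ (fsize A))))) le

  contractR : ∀ {A Γ Δ b} → A ∈ Δ → seqSize (Γ ⇛ (A ∷ Δ)) ≤ Z → LK≤ b (Γ ⇛ (A ∷ Δ)) → LK≤ (Z + (Z + (Z + b))) (Γ ⇛ Δ)
  contractR {A} {Γ} {Δ} m le π with ∈⇒↭ m
  ... | Δ₀ , p with exchange ↭-refl (prep A p) le π
  ...   | π₁ , h₁ = exchange ↭-refl (↭-sym p) le₀ (cR π₁ , +-mono-≤ le₀ h₁)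
    where
    le₀ : seqSize (Γ ⇛ (A ∷ Δ₀)) ≤ Z
    le₀ = ≤-trans (s≤s (+-monoʳ-≤ (total Γ) (≤-trans (≤-reflexive (sym (total-↭ p))) (m≤n+m _ (fsize A))))) le

  weakenL : ∀ Γ {Γ₀ Δ b} → seqSize ((Γ ++ Γ₀) ⇛ Δ) ≤ Z → LK≤ b (Γ₀ ⇛ Δ) → LK≤ (length Γ * Z + b) ((Γ ++ Γ₀) ⇛ Δ)
  weakenL [] le π = π
  weakenL (A ∷ Γ) {Γ₀} {Δ} {b} le π
    with weakenL Γ (≤-trans (s≤s (+-monoˡ-≤ (total Δ) (m≤n+m _ (fsize A)))) le) π
  ... | π′ , h = wL π′ , ≤-trans (+-mono-≤ le h) (≤-reflexive (sym (+-assoc Z (length Γ * Z) b)))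

  weakenR : ∀ Δ {Γ Δ₀ b} → seqSize (Γ ⇛ (Δ ++ Δ₀)) ≤ Z → LK≤ b (Γ ⇛ Δ₀) → LK≤ (length Δ * Z + b) (Γ ⇛ (Δ ++ Δ₀))
  weakenR [] le π = π
  weakenR (A ∷ Δ) {Γ} {Δ₀} {b} le π
    with weakenR Δ (≤-trans (s≤s (+-monoʳ-≤ (total Γ) (m≤n+m _ (fsize A)))) le) π
  ... | π′ , h = wR π′ , ≤-trans (+-mono-≤ le h) (≤-reflexive (sym (+-assoc Z (length Δ * Z) b)))

  weaken-to : ∀ {Γ Δ Γ₁ Δ₁ Γ₀ Δ₀ b} → Γ ↭ (Γ₀ ++ Γ₁) → Δ ↭ (Δ₀ ++ Δ₁) → seqSize (Γ ⇛ Δ) ≤ Z →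
    LK≤ b (Γ₀ ⇛ Δ₀) → LK≤ (Z + (length Γ₁ * Z + (length Δ₁ * Z + b))) (Γ ⇛ Δ)
  weaken-to {Γ} {Δ} {Γ₁} {Δ₁} {Γ₀} {Δ₀} p q le π =
    exchange (↭-sym p′) (↭-sym q′) le₁ (weakenL Γ₁ le₁ (weakenR Δ₁ le₂ π))
    where
    p′ : Γ ↭ (Γ₁ ++ Γ₀)
    p′ = ↭-trans p (++-comm Γ₀ Γ₁)
    q′ : Δ ↭ (Δ₁ ++ Δ₀)
    q′ = ↭-trans q (++-comm Δ₀ Δ₁)
    le₁ : seqSize ((Γ₁ ++ Γ₀) ⇛ (Δ₁ ++ Δ₀)) ≤ Z
    le₁ = ≤-trans (s≤s (≤-reflexive (cong₂ _+_ (sym (total-↭ p′)) (sym (total-↭ q′))))) le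
    suffix : ∀ Γ₁ {Γ₀} → total Γ₀ ≤ total (Γ₁ ++ Γ₀)
    suffix [] = ≤-refl
    suffix (A ∷ Γ₁) = ≤-trans (suffix Γ₁) (m≤n+m _ (fsize A))
    le₂ : seqSize (Γ₀ ⇛ (Δ₁ ++ Δ₀)) ≤ Z
    le₂ = ≤-trans (s≤s (+-monoˡ-≤ (total (Δ₁ ++ Δ₀)) (suffix Γ₁))) le₁

fsize-∧ : ∀ {A B F} → fsize (A ∧ᶠ B) ≤ F → fsize A ≤ F × fsize B ≤ F
fsize-∧ {A} {B} h = ≤-trans (m≤n⇒m≤1+n (m≤m+n _ _)) h , ≤-trans (m≤n⇒m≤1+n (m≤n+m _ (fsize A))) h

module ToLK (F ℓ : ℕ) where

  private
    Z C : ℕ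
    Z = suc ((2 + ℓ) * F)
    C = (4 + ℓ) * Z

    Small : List Fm → Set
    Small = All (λ A → fsize A ≤ F)

    bound : ∀ {Γ Δ} → Small Γ → Small Δ → length Γ + length Δ ≤ 2 + ℓ → seqSize (Γ ⇛ Δ) ≤ Z
    bound s s′ le = ≤-trans (seqSize≤ F s s′) (s≤s (*-monoˡ-≤ F le))

    unary : ∀ {S b w} → b ≤ w * C → LK≤ (Z + (Z + (Z + (Z + b)))) S → LK≤ (suc w * C) S
    unary {b = b} {w} le (π , h) = π , ≤-trans h (≤-trans (≤-reflexive (lem Z b))
      (+-mono-≤ (*-monoˡ-≤ Z (m≤m+n 4 ℓ)) le))
      where
      lem : ∀ z b → z + (z + (z + (z + b))) ≡ 4 * z + b
      lem = solve-∀

    binary : ∀ {S w w′} → LK≤ (Z + (Z + (Z + (Z + w * C + w′ * C)))) S → LK≤ (suc (w + w′) * C) S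
    binary {w = w} {w′} (π , h) = unary {w = w + w′} ≤-refl (π , ≤-trans h (≤-reflexive (lem Z w w′ C)))
      where
      lem : ∀ z w w′ c → z + (z + (z + (z + w * c + w′ * c))) ≡ z + (z + (z + (z + (w + w′) * c)))
      lem = solve-∀

    -- A step consumes 2 from the budget ℓ and adds at most 2 formulas.
    grow : ∀ {a b w} → a ≤ 2 + b → b + 2 * suc w ≤ ℓ → a + 2 * w ≤ ℓ
    grow {a} {b} {w} le bud = begin
      a + 2 * w        ≤⟨ +-monoˡ-≤ (2 * w) le ⟩
      2 + b + 2 * w    ≡⟨ lem b w ⟩
      b + 2 * suc w    ≤⟨ bud ⟩
      ℓ                ∎
      where
      open ≤-Reasoning
      lem : ∀ b w → 2 + b + 2 * w ≡ b + 2 * suc w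
      lem = solve-∀

    fewer-steps : ∀ {b w w′} → w ≤ w′ → b + 2 * w′ ≤ ℓ → b + 2 * w ≤ ℓ
    fewer-steps {b} le bud = ≤-trans (+-monoʳ-≤ b (*-monoʳ-≤ 2 le)) bud

    within : ∀ {a b w} → a ≤ 2 + b → b + 2 * w ≤ ℓ → a ≤ 2 + ℓ
    within {b = b} le bud = ≤-trans le (+-monoʳ-≤ 2 (≤-trans (m≤m+n b _) bud))

    closing : ∀ {Γ Δ b} → ∀ j k → length Γ + length Δ + 2 * 1 ≤ ℓ → j ≤ length Γ → k ≤ length Δ → b ≤ Z →
      LK≤ (Z + (j * Z + (k * Z + b))) (Γ ⇛ Δ) → LK≤ (1 * C) (Γ ⇛ Δ)
    closing {Γ} {Δ} {b} j k bud jl kl bz (π , h) = π , (begin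
      lksize π                          ≤⟨ h ⟩
      Z + (j * Z + (k * Z + b))         ≤⟨ +-monoʳ-≤ Z (+-monoʳ-≤ (j * Z) (+-monoʳ-≤ (k * Z) bz)) ⟩
      Z + (j * Z + (k * Z + Z))         ≡⟨ lem Z j k ⟩
      (2 + (j + k)) * Z                 ≤⟨ *-monoˡ-≤ Z (+-mono-≤ (m≤m+n 2 2) (≤-trans (+-mono-≤ jl kl) (≤-trans (m≤m+n _ 2) bud))) ⟩
      (4 + ℓ) * Z                       ≡⟨ *-identityˡ C ⟨
      1 * C                             ∎)
      where
      open ≤-Reasoning
      lem : ∀ z j k → z + (j * z + (k * z + z)) ≡ (2 + (j + k)) * z
      lem = solve-∀

    comm-suc : ∀ {Γ Δ : List Fm} {A} → length Γ + length (A ∷ Δ) ≤ 2 + (length Γ + length Δ)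
    comm-suc {Γ} {Δ} = ≤-trans (≤-reflexive (+-suc (length Γ) (length Δ))) (n≤1+n _)

    comm-suc² : ∀ {Γ Δ : List Fm} {A B} → length Γ + length (A ∷ B ∷ Δ) ≤ 2 + (length Γ + length Δ)
    comm-suc² {Γ} {Δ} = ≤-reflexive (trans (+-suc (length Γ) _) (cong suc (+-suc (length Γ) _)))

  toLK : ∀ {Γ Δ w} → Tableau F Γ Δ w → Small Γ → Small Δ → length Γ + length Δ + 2 * w ≤ ℓ →
    LK≤ (w * C) (Γ ⇛ Δ)
  toLK {Γ} {Δ} (relax {w = w} le t) sΓ sΔ bud with toLK t sΓ sΔ (fewer-steps {length Γ + length Δ} le bud)
  ... | π , h = π , ≤-trans h (*-monoˡ-≤ C le)
  toLK {Γ} {Δ} (close {A = A} l r) sΓ sΔ bud with ∈⇒↭ l | ∈⇒↭ r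
  ... | Γ₁ , p | Δ₁ , q =
    closing {Γ} {Δ} {seqSize ((A ∷ []) ⇛ (A ∷ []))} (length Γ₁) (length Δ₁) bud
      (≤-trans (n≤1+n _) (≤-reflexive (sym (↭-length p)))) (≤-trans (n≤1+n _) (≤-reflexive (sym (↭-length q))))
      (bound {A ∷ []} {A ∷ []} (All.lookup sΓ l ∷ []) (All.lookup sΔ r ∷ []) (m≤m+n 2 ℓ))
      (weaken-to Z p q (bound sΓ sΔ (within {w = 1} (m≤n+m _ 2) bud)) (ax , ≤-refl))
  toLK {Γ} {Δ} (⊥L l) sΓ sΔ bud with ∈⇒↭ l
  ... | Γ₁ , p =
    closing {Γ} {Δ} {seqSize ((⊥ᶠ ∷ []) ⇛ [])} (length Γ₁) (length Δ) bud
      (≤-trans (n≤1+n _) (≤-reflexive (sym (↭-length p)))) ≤-refl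
      (bound {⊥ᶠ ∷ []} {[]} (All.lookup sΓ l ∷ []) [] (m≤m+n 1 (1 + ℓ)))
      (weaken-to Z p ↭-refl (bound sΓ sΔ (within {w = 1} (m≤n+m _ 2) bud)) (⊥L , ≤-refl))
  toLK {Γ} {Δ} (∧L {A = A} {B} {w} l t) sΓ sΔ bud with fsize-∧ {A} {B} (All.lookup sΓ l)
  ... | hA , hB with toLK t (hA ∷ hB ∷ sΓ) sΔ (grow {_} {length Γ + length Δ} {w} ≤-refl bud)
  ... | π , h = unary {w = w} ≤-refl (contractL Z l le (∧L π , +-mono-≤ le h))
    where
    le : seqSize (((A ∧ᶠ B) ∷ Γ) ⇛ Δ) ≤ Z
    le = bound {(A ∧ᶠ B) ∷ Γ} {Δ} (All.lookup sΓ l ∷ sΓ) sΔ (within {b = length Γ + length Δ} {suc w} (n≤1+n _) bud)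
  toLK {Γ} {Δ} (∧R {A = A} {B} {w} {w′} r t t′) sΓ sΔ bud with fsize-∧ {A} {B} (All.lookup sΔ r)
  ... | hA , hB with toLK t sΓ (hA ∷ sΔ) (grow {_} {length Γ + length Δ} {w} (comm-suc {Γ} {Δ} {A}) (fewer-steps {length Γ + length Δ} (s≤s (m≤m+n w w′)) bud))
                   | toLK t′ sΓ (hB ∷ sΔ) (grow {_} {length Γ + length Δ} {w′} (comm-suc {Γ} {Δ} {B}) (fewer-steps {length Γ + length Δ} (s≤s (m≤n+m w′ w)) bud))
  ... | π , h | π′ , h′ = binary {w = w} {w′} (contractR Z r le (∧R π π′ , +-mono-≤ (+-mono-≤ le h) h′))
    where
    le : seqSize (Γ ⇛ ((A ∧ᶠ B) ∷ Δ)) ≤ Z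
    le = bound {Γ} {(A ∧ᶠ B) ∷ Δ} sΓ (All.lookup sΔ r ∷ sΔ) (within {b = length Γ + length Δ} {suc (w + w′)} (comm-suc {Γ} {Δ} {A}) bud)
  toLK {Γ} {Δ} (∨L {A = A} {B} {w} {w′} l t t′) sΓ sΔ bud with fsize-∧ {A} {B} (All.lookup sΓ l)
  ... | hA , hB with toLK t (hA ∷ sΓ) sΔ (grow {_} {length Γ + length Δ} {w} (n≤1+n _) (fewer-steps {length Γ + length Δ} (s≤s (m≤m+n w w′)) bud))
                   | toLK t′ (hB ∷ sΓ) sΔ (grow {_} {length Γ + length Δ} {w′} (n≤1+n _) (fewer-steps {length Γ + length Δ} (s≤s (m≤n+m w′ w)) bud))
  ... | π , h | π′ , h′ = binary {w = w} {w′} (contractL Z l le (∨L π π′ , +-mono-≤ (+-mono-≤ le h) h′))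
    where
    le : seqSize (((A ∨ᶠ B) ∷ Γ) ⇛ Δ) ≤ Z
    le = bound {(A ∨ᶠ B) ∷ Γ} {Δ} (All.lookup sΓ l ∷ sΓ) sΔ (within {b = length Γ + length Δ} {suc (w + w′)} (n≤1+n _) bud)
  toLK {Γ} {Δ} (∨R {A = A} {B} {w} r t) sΓ sΔ bud with fsize-∧ {A} {B} (All.lookup sΔ r)
  ... | hA , hB with toLK t sΓ (hA ∷ hB ∷ sΔ) (grow {_} {length Γ + length Δ} {w} (comm-suc² {Γ} {Δ} {A} {B}) bud)
  ... | π , h = unary {w = w} ≤-refl (contractR Z r le (∨R π , +-mono-≤ le h))
    where
    le : seqSize (Γ ⇛ ((A ∨ᶠ B) ∷ Δ)) ≤ Z
    le = bound {Γ} {(A ∨ᶠ B) ∷ Δ} sΓ (All.lookup sΔ r ∷ sΔ) (within {b = length Γ + length Δ} {suc w} (comm-suc {Γ} {Δ} {A}) bud)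
  toLK {Γ} {Δ} (¬L {A = A} {w} l t) sΓ sΔ bud
    with toLK t sΓ (≤-trans (n≤1+n _) (All.lookup sΓ l) ∷ sΔ) (grow {_} {length Γ + length Δ} {w} (comm-suc {Γ} {Δ} {A}) bud)
  ... | π , h = unary {w = w} ≤-refl (contractL Z l le (¬L π , +-mono-≤ le h))
    where
    le : seqSize (((¬ᶠ A) ∷ Γ) ⇛ Δ) ≤ Z
    le = bound {(¬ᶠ A) ∷ Γ} {Δ} (All.lookup sΓ l ∷ sΓ) sΔ (within {b = length Γ + length Δ} {suc w} (n≤1+n _) bud)
  toLK {Γ} {Δ} (¬R {A = A} {w} r t) sΓ sΔ bud
    with toLK t (≤-trans (n≤1+n _) (All.lookup sΔ r) ∷ sΓ) sΔ (grow {_} {length Γ + length Δ} {w} (n≤1+n _) bud)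
  ... | π , h = unary {w = w} ≤-refl (contractR Z r le (¬R π , +-mono-≤ le h))
    where
    le : seqSize (Γ ⇛ ((¬ᶠ A) ∷ Δ)) ≤ Z
    le = bound {Γ} {(¬ᶠ A) ∷ Δ} sΓ (All.lookup sΔ r ∷ sΔ) (within {b = length Γ + length Δ} {suc w} (comm-suc {Γ} {Δ} {A}) bud)
  toLK {Γ} {Δ} (cut {w = w} {w′} A hA t t′) sΓ sΔ bud
    with toLK t sΓ (hA ∷ sΔ) (grow {_} {length Γ + length Δ} {w} (comm-suc {Γ} {Δ} {A}) (fewer-steps {length Γ + length Δ} (s≤s (m≤m+n w w′)) bud))
       | toLK t′ (hA ∷ sΓ) sΔ (grow {_} {length Γ + length Δ} {w′} (n≤1+n _) (fewer-steps {length Γ + length Δ} (s≤s (m≤n+m w′ w)) bud))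
  ... | π , h | π′ , h′ = binary {w = w} {w′} (cut π π′ ,
          ≤-trans (+-mono-≤ (+-mono-≤ le h) h′) (≤-trans (m≤n+m _ Z) (≤-trans (m≤n+m _ Z) (m≤n+m _ Z))))
    where
    le = bound sΓ sΔ (within {b = length Γ + length Δ} {suc (w + w′)} (m≤n+m _ 2) bud)

bigAnd bigOr : ℕ → (ℕ → Fm) → Fm
bigAnd zero f = ⊤ᶠ
bigAnd (suc k) f = f k ∧ᶠ bigAnd k f
bigOr zero f = ⊥ᶠ
bigOr (suc k) f = f k ∨ᶠ bigOr k f

module _ {F : ℕ} where

  useAnd : ∀ {Γ Δ w} k {f a} → bigAnd k f ∈ Γ → a < k →
    (∀ {Γ′} → Γ ⊆ Γ′ → f a ∈ Γ′ → Tableau F Γ′ Δ w) → Tableau F Γ Δ (k + w)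
  useAnd {w = w} (suc k) {f} {a} m a<k use with a ≟ k
  ... | yes refl = ∧L m (relax (m≤n+m w k) (use (there ∘ there) (here refl)))
  ... | no a≢k = ∧L m (useAnd k (there (here refl)) (≤∧≢⇒< (≤-pred a<k) a≢k)
                        (λ sub → use (sub ∘ there ∘ there)))

  useOr : ∀ {Γ Δ w} k {f} → bigOr k f ∈ Γ →
    (∀ {a Γ′} → a < k → Γ ⊆ Γ′ → f a ∈ Γ′ → Tableau F Γ′ Δ w) → Tableau F Γ Δ (suc (k * suc w))
  useOr zero m use = ⊥L m
  useOr {w = w} (suc k) m use = relax (s≤s (≤-reflexive (+-suc w (k * suc w))))
    (∨L m (use ≤-refl there (here refl)) (useOr k (here refl) (λ a<k sub → use (m≤n⇒m≤1+n a<k) (sub ∘ there))))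

  showOr : ∀ {Γ Δ w} k {f a} → bigOr k f ∈ Δ → a < k →
    (∀ {Δ′} → Δ ⊆ Δ′ → f a ∈ Δ′ → Tableau F Γ Δ′ w) → Tableau F Γ Δ (k + w)
  showOr {w = w} (suc k) {f} {a} m a<k use with a ≟ k
  ... | yes refl = ∨R m (relax (m≤n+m w k) (use (there ∘ there) (here refl)))
  ... | no a≢k = ∨R m (showOr k (there (here refl)) (≤∧≢⇒< (≤-pred a<k) a≢k)
                        (λ sub → use (sub ∘ there ∘ there)))

-- q i a: Alice's row at node i is a.  r i a j: the value in row a of node i is j if j < i, and at
-- least i if j = i.
module Formulas (N m : ℕ) (p : ℕ → ℕ → ℕ → ℕ → Fm) (q : ℕ → ℕ → Fm) (r : ℕ → ℕ → ℕ → Fm) where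

  edges : (ℕ → ℕ → ℕ → ℕ → Fm) → Fm
  edges f = bigAnd (suc N) λ i → bigAnd i λ j → bigAnd m λ a → bigAnd m λ b → f i a j b

  rowsChosen rowsLinked valuesChosen linksSound topAlive φ ψ : Fm
  rowsChosen = bigAnd (suc N) λ i → bigOr m (q i)
  rowsLinked = edges λ i a j b → (¬ᶠ q i a) ∨ᶠ ((¬ᶠ q j b) ∨ᶠ p i a j b)
  valuesChosen = bigAnd (suc N) λ i → bigAnd m λ a → bigOr (suc i) (r i a)
  linksSound = edges λ i a j b → (¬ᶠ p i a j b) ∨ᶠ ((¬ᶠ r i a j) ∨ᶠ (¬ᶠ r j b j))
  topAlive = bigAnd m λ a → ¬ᶠ r N a N
  φ = rowsChosen ∧ᶠ rowsLinked
  ψ = ¬ᶠ (valuesChosen ∧ᶠ (linksSound ∧ᶠ topAlive))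

  dead : ℕ → Fm
  dead i = bigOr m λ a → q i a ∧ᶠ r i a i

  edgeW clashW stepW : ℕ
  edgeW = suc N + (N + (m + m))
  clashW = edgeW + (6 + (edgeW + 8))
  stepW = suc N + suc (m * suc (suc N + (m + suc (suc N * suc (m + 3 + suc (m * suc (suc clashW)))))))

  loopW : ℕ → ℕ
  loopW zero = suc (m * suc (suc (m + 2)))
  loopW (suc d) = suc (stepW + loopW d)

  module _ {F : ℕ} (dead≤F : ∀ i → i ≤ N → fsize (dead i) ≤ F) where

    private
      record Ctx (i : ℕ) (Γ : List Fm) : Set where
        field
          c₁ : rowsChosen ∈ Γ
          c₂ : rowsLinked ∈ Γ
          c₃ : valuesChosen ∈ Γ
          c₄ : linksSound ∈ Γ
          c₅ : topAlive ∈ Γ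
          ds : ∀ {j} → j < i → dead j ∈ Γ
      open Ctx

      ctx-mono : ∀ {i Γ Γ′} → Γ ⊆ Γ′ → Ctx i Γ → Ctx i Γ′
      ctx-mono sub c = record { c₁ = sub (c₁ c) ; c₂ = sub (c₂ c) ; c₃ = sub (c₃ c) ; c₄ = sub (c₄ c)
                              ; c₅ = sub (c₅ c) ; ds = λ lt → sub (ds c lt) }

      useEdge : ∀ {Γ Δ w f i a j b} → edges f ∈ Γ → i ≤ N → j < i → a < m → b < m →
        (∀ {Γ′} → Γ ⊆ Γ′ → f i a j b ∈ Γ′ → Tableau F Γ′ Δ w) → Tableau F Γ Δ (edgeW + w)
      useEdge {w = w} {i = i} e∈ i≤N j<i a<m b<m use = relax bound
        (useAnd (suc N) e∈ (s≤s i≤N) λ s₁ e₁ → useAnd i e₁ j<i λ s₂ e₂ → useAnd m e₂ a<m λ s₃ e₃ →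
         useAnd m e₃ b<m λ s₄ e₄ → use (s₄ ∘ s₃ ∘ s₂ ∘ s₁) e₄)
        where
        open ≤-Reasoning
        bound : suc N + (i + (m + (m + w))) ≤ edgeW + w
        bound = begin
          suc N + (i + (m + (m + w)))     ≤⟨ +-monoʳ-≤ (suc N) (+-monoˡ-≤ (m + (m + w)) i≤N) ⟩
          suc N + (N + (m + (m + w)))     ≡⟨ cong (λ z → suc N + (N + z)) (+-assoc m m w) ⟨
          suc N + (N + (m + m + w))       ≡⟨ cong (suc N +_) (+-assoc N (m + m) w) ⟨
          suc N + (N + (m + m) + w)       ≡⟨ +-assoc (suc N) (N + (m + m)) w ⟨
          edgeW + w                       ∎

      clash : ∀ {k Γ Δ i a j b} → Ctx k Γ → i ≤ N → j < i → a < m → b < m →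
        q i a ∈ Γ → q j b ∈ Γ → r i a j ∈ Γ → r j b j ∈ Γ → Tableau F Γ Δ clashW
      clash c i≤N j<i a<m b<m q∈ q′∈ r∈ r′∈ =
        useEdge (c₂ c) i≤N j<i a<m b<m λ s₁ e₁ →
        ∨L e₁ (¬L (here refl) (close (there (s₁ q∈)) (here refl)))
          (∨L (here refl) (¬L (here refl) (close (there (there (s₁ q′∈))) (here refl)))
            (useEdge (there (there (s₁ (c₄ c)))) i≤N j<i a<m b<m λ s₂ e₂ →
             ∨L e₂ (¬L (here refl) (close (there (s₂ (here refl))) (here refl)))
               (∨L (here refl)
                 (¬L (here refl) (close (there (there (s₂ (there (there (s₁ r∈)))))) (here refl)))
                 (¬L (here refl) (close (there (there (s₂ (there (there (s₁ r′∈)))))) (here refl))))))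

      step : ∀ {i Γ Δ} → Ctx i Γ → i ≤ N → dead i ∈ Δ → Tableau F Γ Δ stepW
      step {i} {Γ} {Δ} c i≤N d∈ =
        useAnd (suc N) (c₁ c) (s≤s i≤N) λ s₁ e₁ → useOr m e₁ λ {a} a<m s₂ q∈ →
        useAnd (suc N) (c₃ (ctx-mono (s₂ ∘ s₁) c)) (s≤s i≤N) λ s₃ e₃ → useAnd m e₃ a<m λ s₄ e₄ →
        relax (s≤s (*-monoˡ-≤ (suc _) (s≤s i≤N)))
          (useOr (suc i) e₄ λ {j} j<1+i s₅ r∈ →
            value (ctx-mono (s₅ ∘ s₄ ∘ s₃ ∘ s₂ ∘ s₁) c) a<m (s₅ (s₄ (s₃ q∈))) j<1+i r∈)
        where
        value : ∀ {a j Γ′} → Ctx i Γ′ → a < m → q i a ∈ Γ′ → j < suc i → r i a j ∈ Γ′ →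
          Tableau F Γ′ Δ (m + 3 + suc (m * suc (suc clashW)))
        value {a} {j} c a<m q∈ j<1+i r∈ with j ≟ i
        ... | yes refl = relax (m≤m+n (m + 3) _) (showOr m d∈ a<m λ s e →
          ∧R e (close q∈ (here refl)) (close r∈ (here refl)))
        ... | no j≢i = relax (m≤n+m _ (m + 3)) (useOr m (ds c j<i) λ b<m s e →
          ∧L e (clash (ctx-mono (there ∘ there ∘ s) c) i≤N j<i a<m b<m
                 (there (there (s q∈))) (here refl) (there (there (s r∈))) (there (here refl))))
          where j<i = ≤∧≢⇒< (≤-pred j<1+i) j≢i

      loop : ∀ d {i Γ Δ} → i + d ≡ suc N → Ctx i Γ → Tableau F Γ Δ (loopW d)
      loop zero {i} eq c = useOr m (ds c (≤-reflexive (trans (sym eq) (+-identityʳ i)))) λ a<m s e →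
        ∧L e (useAnd m (there (there (s (c₅ c)))) a<m λ s′ e′ →
          ¬L e′ (close (s′ (there (here refl))) (here refl)))
      loop (suc d) {i} {Γ} eq c = cut (dead i) (dead≤F i i≤N) (step c i≤N (here refl))
        (loop d (trans (sym (+-suc i d)) eq) c′)
        where
        i≤N : i ≤ N
        i≤N = ≤-pred (≤-trans (≤-trans (s≤s (m≤m+n i d)) (≤-reflexive (sym (+-suc i d)))) (≤-reflexive eq))
        c′ : Ctx (suc i) (dead i ∷ Γ)
        c′ = record { Ctx (ctx-mono there c) ; ds = deads }
          where
          deads : ∀ {j} → j < suc i → dead j ∈ (dead i ∷ Γ)
          deads {j} lt with j ≟ i
          ... | yes refl = here refl
          ... | no j≢i = there (ds c (≤∧≢⇒< (≤-pred lt) j≢i))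

    tableau : Tableau F (φ ∷ []) (ψ ∷ []) (4 + loopW (suc N))
    tableau = ¬R (here refl) (∧L (there (here refl)) (∧L (there (there (here refl)))
      (∧L (there (here refl)) (loop (suc N) {0} refl record
        { c₁ = there (there (there (there (here refl)))) ; c₂ = there (there (there (there (there (here refl)))))
        ; c₃ = there (there (here refl)) ; c₄ = here refl ; c₅ = there (here refl) ; ds = λ () }))))

-- Properties of iterated connectives

-- A record rather than a synonym, so that v and A can be inferred from v ⊨ A.
record _⊨_ (v : ℕ → Bool) (A : Fm) : Set where
  constructor holds
  field proof : eval v A ≡ true
open _⊨_ public

bigAnd-true : ∀ {v} k {f} → (∀ a → a < k → v ⊨ f a) → v ⊨ bigAnd k f
bigAnd-true zero h = holds refl
bigAnd-true {v} (suc k) {f} h = holds (cong₂ _∧_ (proof (h k ≤-refl))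
  (proof (bigAnd-true k {f} (λ a lt → h a (m≤n⇒m≤1+n lt)))))

bigOr-true : ∀ {v} k {f} a → a < k → v ⊨ f a → v ⊨ bigOr k f
bigOr-true {v} (suc k) {f} a a<k e with a ≟ k
... | yes refl = holds (cong (_∨ eval v (bigOr k f)) (proof e))
... | no a≢k = holds (trans (cong (eval v (f k) ∨_) (proof (bigOr-true k {f} a (≤∧≢⇒< (≤-pred a<k) a≢k) e)))
                            (∨-zeroʳ (eval v (f k))))

AllAtoms-bigAnd : ∀ {Q} k {f} → (∀ a → AllAtoms Q (f a)) → AllAtoms Q (bigAnd k f)
AllAtoms-bigAnd zero h = tt
AllAtoms-bigAnd (suc k) h = h k , AllAtoms-bigAnd k h

AllAtoms-bigOr : ∀ {Q} k {f} → (∀ a → AllAtoms Q (f a)) → AllAtoms Q (bigOr k f)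
AllAtoms-bigOr zero h = tt
AllAtoms-bigOr (suc k) h = h k , AllAtoms-bigOr k h

Monotone-bigAnd : ∀ {P} k {f} → (∀ a → Monotone P (f a)) → Monotone P (bigAnd k f)
Monotone-bigAnd zero h = tt
Monotone-bigAnd (suc k) h = h k , Monotone-bigAnd k h

Monotone-bigOr : ∀ {P} k {f} → (∀ a → Monotone P (f a)) → Monotone P (bigOr k f)
Monotone-bigOr zero h = tt
Monotone-bigOr (suc k) h = h k , Monotone-bigOr k h

fsize-bigAnd : ∀ {s} k {f} → (∀ a → a < k → fsize (f a) ≤ s) → fsize (bigAnd k f) ≤ suc (k * suc s)
fsize-bigAnd zero h = ≤-refl
fsize-bigAnd {s} (suc k) h = s≤s (≤-trans (+-mono-≤ (h k ≤-refl) (fsize-bigAnd k (λ a lt → h a (m≤n⇒m≤1+n lt))))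
                                     (≤-reflexive (+-suc s _)))

fsize-bigOr : ∀ {s} k {f} → (∀ a → a < k → fsize (f a) ≤ s) → fsize (bigOr k f) ≤ suc (k * suc s)
fsize-bigOr zero h = ≤-refl
fsize-bigOr {s} (suc k) h = s≤s (≤-trans (+-mono-≤ (h k ≤-refl) (fsize-bigOr k (λ a lt → h a (m≤n⇒m≤1+n lt))))
                                    (≤-reflexive (+-suc s _)))

-- Numbering of the atoms

module Coding (b : ℕ) .{{_ : NonZero b}} where

  code : ℕ → ℕ → ℕ → ℕ → ℕ
  code i a j c = i + (a + (j + c * b) * b) * b

  decode : ℕ → Label
  decode k = k % b , k / b % b , k / b / b % b , k / b / b / b

  private
    digit : ∀ d e → d < b → (d + e * b) % b ≡ d
    digit d e d<b = trans ([m+kn]%n≡m%n d e b) (m<n⇒m%n≡m d<b)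

    carry : ∀ d e → d < b → (d + e * b) / b ≡ e
    carry d e d<b = trans (+-distrib-/-∣ʳ d (divides-refl e)) (cong₂ _+_ (m<n⇒m/n≡0 d<b) (m*n/n≡m e b))

  decode-code : ∀ {i a j c} → i < b → a < b → j < b → decode (code i a j c) ≡ (i , a , j , c)
  decode-code {i} {a} {j} {c} i<b a<b j<b
    rewrite digit i (a + (j + c * b) * b) i<b | carry i (a + (j + c * b) * b) i<b
          | digit a (j + c * b) a<b | carry a (j + c * b) a<b
          | digit j c j<b | carry j c j<b = refl

lookupℕ : {A : Set} → (A → ℕ) → ∀ {k} → Vec A k → ℕ → ℕ
lookupℕ g [] _ = 0
lookupℕ g (a ∷ v) zero = g a
lookupℕ g (a ∷ v) (suc i) = lookupℕ g v i

lookupℕ-toℕ : ∀ {A : Set} (g : A → ℕ) {k} (v : Vec A k) f → lookupℕ g v (toℕ f) ≡ g (lookup v f)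
lookupℕ-toℕ g (a ∷ v) fzero = refl
lookupℕ-toℕ g (a ∷ v) (fsuc f) = lookupℕ-toℕ g v f

lookupℕ-< : ∀ {A : Set} (g : A → ℕ) {B} → (∀ a → g a < B) → ∀ {k} (v : Vec A k) {i} → i < k → lookupℕ g v i < B
lookupℕ-< g h (a ∷ v) {zero} lt = h a
lookupℕ-< g h (a ∷ v) {suc i} (s≤s lt) = lookupℕ-< g h v lt

≡ᵇ-true : ∀ {m n} → m ≡ n → (m ≡ᵇ n) ≡ true
≡ᵇ-true {m} {n} e = Equivalence.to T-≡ (≡⇒≡ᵇ m n e)

true-≡ᵇ : ∀ {m n} → (m ≡ᵇ n) ≡ true → m ≡ n
true-≡ᵇ {m} {n} e = ≡ᵇ⇒≡ m n (Equivalence.from T-≡ e)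

<ᵇ-true : ∀ {m n} → m < n → (m <ᵇ n) ≡ true
<ᵇ-true lt = Equivalence.to T-≡ (<⇒<ᵇ lt)

true-<ᵇ : ∀ {m n} → (m <ᵇ n) ≡ true → m < n
true-<ᵇ {m} {n} e = <ᵇ⇒< m n (Equivalence.from T-≡ e)

module Game (n m : ℕ) where

  N = suc n
  b = suc (N + m)
  open Coding b

  AInput BInput : Set
  AInput = Vec (Fin m) (suc N)
  BInput = Vec (Vec (Fin N) m) (suc N)

  -- Coordinate f of the inputs belongs to node N ∸ f.
  row : AInput → ℕ → ℕ
  row x i = lookupℕ toℕ x (N ∸ i)

  val : BInput → ℕ → ℕ → ℕ
  val y i a = lookupℕ (λ F → lookupℕ toℕ F a) y (N ∸ i)

  p : ℕ → ℕ → ℕ → ℕ → Fm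
  p i a j c = atom (0 + code i a j c * 3)
  q : ℕ → ℕ → Fm
  q i a = atom (1 + code i a 0 0 * 3)
  r : ℕ → ℕ → ℕ → Fm
  r i a j = atom (2 + code i a j 0 * 3)

  open Formulas N m p q r public

  points : BInput → ℕ → ℕ → ℕ → Bool
  points y i a j = if j <ᵇ i then val y i a ≡ᵇ j else i ≤ᵇ val y i a

  private
    valueA : AInput → ℕ → Label → Bool
    valueA x 0 (i , a , j , c) = (row x i ≡ᵇ a) ∧ (row x j ≡ᵇ c)
    valueA x 1 (i , a , _ , _) = row x i ≡ᵇ a
    valueA x _ _ = false

    valueB : BInput → ℕ → Label → Bool
    valueB y 0 (i , a , j , c) = not ((i ≤ᵇ N) ∧ ((j <ᵇ i) ∧ (points y i a j ∧ points y j c j)))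
    valueB y 2 (i , a , j , _) = points y i a j
    valueB y _ _ = false

  α : AInput → ℕ → Bool
  α x k = valueA x (k % 3) (decode (k / 3))

  β : BInput → ℕ → Bool
  β y k = valueB y (k % 3) (decode (k / 3))

  private
    kind : ∀ d k → d < 3 → (d + k * 3) % 3 ≡ d
    kind d k lt = trans ([m+kn]%n≡m%n d k 3) (m<n⇒m%n≡m lt)

    strip : ∀ d k → d < 3 → (d + k * 3) / 3 ≡ k
    strip d k lt = trans (+-distrib-/-∣ʳ d (divides-refl k)) (cong₂ _+_ (m<n⇒m/n≡0 lt) (m*n/n≡m k 3))

    module _ (value : ℕ → Label → Bool) {i a j c : ℕ} (i<b : i < b) (a<b : a < b) (j<b : j < b) where
      value-code : ∀ d → d < 3 → let k = d + code i a j c * 3 in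
        value (k % 3) (decode (k / 3)) ≡ value d (i , a , j , c)
      value-code d lt rewrite kind d (code i a j c) lt | strip d (code i a j c) lt
        | decode-code {i} {a} {j} {c} i<b a<b j<b = refl

    node<b : ∀ {i} → i ≤ N → i < b
    node<b i≤N = s≤s (≤-trans i≤N (m≤m+n N m))
    row<b : ∀ {a} → a < m → a < b
    row<b a<m = ≤-trans a<m (≤-trans (m≤n+m m N) (n≤1+n _))

    0<3 : 0 < 3
    0<3 = s≤s z≤n
    1<3 : 1 < 3
    1<3 = s≤s (s≤s z≤n)
    2<3 : 2 < 3
    2<3 = s≤s (s≤s (s≤s z≤n))

    α-p : ∀ x {i a j c} → i ≤ N → a < m → j ≤ N → c < m → eval (α x) (p i a j c) ≡ (row x i ≡ᵇ a) ∧ (row x j ≡ᵇ c)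
    α-p x {i} {a} {j} {c} i≤N a<m j≤N c<m = value-code (valueA x) {i} {a} {j} {c} (node<b i≤N) (row<b a<m) (node<b j≤N) 0 0<3

    α-q : ∀ x {i a} → i ≤ N → a < m → eval (α x) (q i a) ≡ (row x i ≡ᵇ a)
    α-q x {i} {a} i≤N a<m = value-code (valueA x) {i} {a} {0} {0} (node<b i≤N) (row<b a<m) (s≤s z≤n) 1 1<3

    β-p : ∀ y {i a j c} → i ≤ N → a < m → j < i → c < m →
      eval (β y) (p i a j c) ≡ not (points y i a j ∧ points y j c j)
    β-p y {i} {a} {j} {c} i≤N a<m j<i c<m =
      trans (value-code (valueB y) {i} {a} {j} {c} (node<b i≤N) (row<b a<m) (node<b (≤-trans (<⇒≤ j<i) i≤N)) 0 0<3)
            (cong₂ (λ s t → not (s ∧ (t ∧ (points y i a j ∧ points y j c j)))) (≤ᵇ-true i≤N) (<ᵇ-true j<i))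

    β-r : ∀ y {i a j} → i ≤ N → a < m → j ≤ N → eval (β y) (r i a j) ≡ points y i a j
    β-r y {i} {a} {j} i≤N a<m j≤N = value-code (valueB y) {i} {a} {j} {0} (node<b i≤N) (row<b a<m) (node<b j≤N) 2 2<3

    row<m : ∀ x i → row x i < m
    row<m x i = lookupℕ-< toℕ toℕ<n x (s≤s (m∸n≤m N i))

    val<N : ∀ y i {a} → a < m → val y i a < N
    val<N y i {a} a<m = lookupℕ-< (λ F → lookupℕ toℕ F a) (λ F → lookupℕ-< toℕ toℕ<n F a<m) y (s≤s (m∸n≤m N i))

  φ-true : ∀ x → eval (α x) φ ≡ true
  φ-true x = cong₂ _∧_ (proof chosen) (proof all-linked)
    where
    chosen : α x ⊨ rowsChosen
    chosen = bigAnd-true (suc N) λ i i<K → bigOr-true m (row x i) (row<m x i)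
      (holds (trans (α-q x (≤-pred i<K) (row<m x i)) (≡ᵇ-true {row x i} refl)))
    linked : ∀ {i a j c} → i ≤ N → j < i → a < m → c < m →
      eval (α x) ((¬ᶠ q i a) ∨ᶠ ((¬ᶠ q j c) ∨ᶠ p i a j c)) ≡ true
    linked {i} {a} {j} {c} i≤N j<i a<m c<m
      rewrite α-q x i≤N a<m | α-q x (≤-trans (<⇒≤ j<i) i≤N) c<m | α-p x i≤N a<m (≤-trans (<⇒≤ j<i) i≤N) c<m
      with row x i ≡ᵇ a | row x j ≡ᵇ c
    ... | false | _ = refl
    ... | true | false = refl
    ... | true | true = refl
    all-linked : α x ⊨ rowsLinked
    all-linked = bigAnd-true (suc N) λ i i<K → bigAnd-true i λ j j<i → bigAnd-true m λ a a<m →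
      bigAnd-true m λ c c<m → holds (linked (≤-pred i<K) j<i a<m c<m)

  ψ-false : ∀ y → eval (β y) ψ ≡ false
  ψ-false y = cong not (cong₂ _∧_ (proof all-chosen) (cong₂ _∧_ (proof all-sound) (proof all-alive)))
    where
    chosen : ∀ {i a} → i ≤ N → a < m → β y ⊨ bigOr (suc i) (r i a)
    chosen {i} {a} i≤N a<m with val y i a <? i
    ... | yes z<i = bigOr-true (suc i) (val y i a) (m≤n⇒m≤1+n z<i)
      (holds (trans (β-r y i≤N a<m (≤-trans (<⇒≤ z<i) i≤N)) points-to))
      where
      points-to : points y i a (val y i a) ≡ true
      points-to rewrite <ᵇ-true z<i = ≡ᵇ-true {val y i a} refl
    ... | no z≮i = bigOr-true (suc i) i ≤-refl (holds (trans (β-r y i≤N a<m i≤N) is-dead))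
      where
      is-dead : points y i a i ≡ true
      is-dead with i <ᵇ i in eq
      ... | true = ⊥-elim (<-irrefl refl (true-<ᵇ {i} eq))
      ... | false = ≤ᵇ-true (≮⇒≥ z≮i)
    soundLink : ∀ {i a j c} → i ≤ N → j < i → a < m → c < m →
      eval (β y) ((¬ᶠ p i a j c) ∨ᶠ ((¬ᶠ r i a j) ∨ᶠ (¬ᶠ r j c j))) ≡ true
    soundLink {i} {a} {j} {c} i≤N j<i a<m c<m
      rewrite β-p y i≤N a<m j<i c<m | β-r y i≤N a<m (≤-trans (<⇒≤ j<i) i≤N)
            | β-r y {j} {c} {j} (≤-trans (<⇒≤ j<i) i≤N) c<m (≤-trans (<⇒≤ j<i) i≤N)
      with points y i a j | points y j c j
    ... | false | _ = refl
    ... | true | false = refl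
    ... | true | true = refl
    alive : ∀ {a} → a < m → eval (β y) (¬ᶠ r N a N) ≡ true
    alive {a} a<m rewrite β-r y {N} {a} {N} ≤-refl a<m ≤-refl with N <ᵇ N in eq | N ≤ᵇ val y N a in eq′
    ... | true | _ = ⊥-elim (<-irrefl refl (true-<ᵇ {N} eq))
    ... | false | true = ⊥-elim (<⇒≱ (val<N y N a<m) (true-≤ᵇ eq′))
    ... | false | false = refl
    all-chosen : β y ⊨ valuesChosen
    all-chosen = bigAnd-true (suc N) λ i i<K → bigAnd-true m λ a a<m → chosen (≤-pred i<K) a<m
    all-sound : β y ⊨ linksSound
    all-sound = bigAnd-true (suc N) λ i i<K → bigAnd-true i λ j j<i → bigAnd-true m λ a a<m →
      bigAnd-true m λ c c<m → holds (soundLink (≤-pred i<K) j<i a<m c<m)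
    all-alive : β y ⊨ topAlive
    all-alive = bigAnd-true m λ a a<m → holds (alive a<m)

  LeftAtom RightAtom CommonAtom : ℕ → Set
  LeftAtom k = k % 3 ≢ 2
  RightAtom k = k % 3 ≢ 1
  CommonAtom k = k % 3 ≡ 0

  common : ∀ k → LeftAtom k → RightAtom k → CommonAtom k
  common k l r with k % 3 | m%n<n k 3
  ... | 0 | _ = refl
  ... | 1 | _ = ⊥-elim (r refl)
  ... | 2 | _ = ⊥-elim (l refl)
  ... | suc (suc (suc _)) | s≤s (s≤s (s≤s ()))

  open Interpolation LeftAtom RightAtom CommonAtom common α β

  private
    kind≢ : ∀ {d e} k → d < 3 → d ≢ e → (d + k * 3) % 3 ≢ e
    kind≢ k lt ne eq = ne (trans (sym (kind _ k lt)) eq)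

  φ-left : LeftOK φ
  φ-left =
    ( AllAtoms-bigAnd (suc N) (λ i → AllAtoms-bigOr m (λ a → q-left i a))
    , AllAtoms-bigAnd (suc N) (λ i → AllAtoms-bigAnd i (λ j → AllAtoms-bigAnd m (λ a → AllAtoms-bigAnd m (λ c →
        q-left i a , q-left j c , kind≢ (code i a j c) 0<3 (λ ()))))) ) ,
    ( Monotone-bigAnd (suc N) (λ i → Monotone-bigOr m (λ a → tt))
    , Monotone-bigAnd (suc N) (λ i → Monotone-bigAnd i (λ j → Monotone-bigAnd m (λ a → Monotone-bigAnd m (λ c →
        q-free i a , q-free j c , tt)))) )
    where
    q-left : ∀ i a → LeftAtom (1 + code i a 0 0 * 3)
    q-left i a = kind≢ (code i a 0 0) 1<3 (λ ())
    q-free : ∀ i a → ¬ CommonAtom (1 + code i a 0 0 * 3)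
    q-free i a = kind≢ (code i a 0 0) 1<3 (λ ())

  ψ-right : RightOK ψ
  ψ-right =
    AllAtoms-bigAnd (suc N) (λ i → AllAtoms-bigAnd m (λ a → AllAtoms-bigOr (suc i) (λ j → r-right i a j))) ,
    AllAtoms-bigAnd (suc N) (λ i → AllAtoms-bigAnd i (λ j → AllAtoms-bigAnd m (λ a → AllAtoms-bigAnd m (λ c →
      kind≢ (code i a j c) 0<3 (λ ()) , r-right i a j , r-right j c j)))) ,
    AllAtoms-bigAnd m (λ a → r-right N a N)
    where
    r-right : ∀ i a j → RightAtom (2 + code i a j 0 * 3)
    r-right i a j = kind≢ (code i a j 0) 2<3 (λ ())

  violation : ∀ x y o → Separates x y o → Violation N (decode (o / 3)) (row x) (val y)
  violation x y o (k≡0 , t , f) rewrite k≡0 = go (decode (o / 3)) t f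
    where
    not-false : ∀ {b} → not b ≡ false → b ≡ true
    not-false {true} e = refl
    points-to : ∀ {i a j} → (j <ᵇ i) ≡ true → points y i a j ≡ true → val y i a ≡ j
    points-to {i} {a} j<i e rewrite j<i = true-≡ᵇ {val y i a} e
    is-dead : ∀ {j c} → points y j c j ≡ true → j ≤ val y j c
    is-dead {j} e with j <ᵇ j in eq
    ... | true = ⊥-elim (<-irrefl refl (true-<ᵇ {j} eq))
    ... | false = true-≤ᵇ e
    go : ∀ l → valueA x 0 l ≡ true → valueB y 0 l ≡ false → Violation N l (row x) (val y)
    go (i , a , j , c) t f with ∧-true {row x i ≡ᵇ a} t | ∧-true {i ≤ᵇ N} (not-false f)
    ... | ti , tj | fi , f′ with ∧-true {j <ᵇ i} f′
    ... | fj , f″ with ∧-true {points y i a j} f″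
    ... | ri , rj with true-≡ᵇ {row x i} ti | true-≡ᵇ {row x j} tj
    ... | refl | refl = true-≤ᵇ fi , true-<ᵇ {j} fj , refl , refl , points-to {i} fj ri , is-dead {j} rj

module LowerBound {S n : ℕ} (params : Parameters S n) where
  open Parameters params using (m; B; D; D≡; m≡4D)
  open Game n m
  open Adversary params
  open Interpolation LeftAtom RightAtom CommonAtom common α β

  private
    length-rows : ∀ k → length (allVec (allFin m) k) ≡ m ^ k
    length-rows k = trans (length-allVec (allFin m) k) (cong (_^ k) (length-allFin m))

    columns : List (Vec (Fin N) m)
    columns = cols

    everything : {A : Set} → A → Bool
    everything _ = true

    count-everything : {A : Set} (xs : List A) → cnt xs (everything {A}) ≡ length xs
    count-everything xs = trans (sumL-const xs 1) (*-identityʳ (length xs))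

  initial : (T : Protocol AInput BInput ℕ) → leaves T * 3 ^ S ≤ 4 ^ S →
    (∀ x y → Separates x y (run T x y)) → State S N
  initial T few-leaves sep = record
    { X = everything ; Y = everything
    ; T = reindex id id (λ o → Coding.decode b (o / 3)) T
    ; lab = λ f → N ∸ toℕ f ; eA = row ; eB = val
    ; descending = λ f g f<g → ∸-monoʳ-< f<g (toℕ≤pred[n] g)
    ; lab≤N = λ f → m∸n≤m N (toℕ f)
    ; coordA = λ x f → trans (cong (lookupℕ toℕ x) (m∸[m∸n]≡n (toℕ≤pred[n] f))) (lookupℕ-toℕ toℕ x f)
    ; coordB = λ y f a → trans (cong (lookupℕ (λ F → lookupℕ toℕ F (toℕ a)) y) (m∸[m∸n]≡n (toℕ≤pred[n] f)))
        (trans (lookupℕ-toℕ (λ F → lookupℕ toℕ F (toℕ a)) y f) (lookupℕ-toℕ toℕ (lookup y f) a))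
    ; settled = λ x y _ _ i i≤N i∉ → ⊥-elim (i∉ (fromℕ< (s≤s (m∸n≤m N i)))
        (trans (cong (N ∸_) (toℕ-fromℕ< (s≤s (m∸n≤m N i)))) (m∸[m∸n]≡n i≤N)))
    ; correct = λ x y _ _ → subst (λ l → Violation N l (row x) (val y))
        (sym (run-reindex id id (λ o → Coding.decode b (o / 3)) T x y)) (violation x y (run T x y) (sep x y))
    ; thick = λ i w _ → ≤-trans 2B≤m (≤-reflexive (sym (trans (count-everything (allFin m)) (length-allFin m))))
    ; c = 0 ; q = 0 ; c+s≡S = refl ; q+k≡K = refl
    ; largeX = ≤-reflexive (cong (_* 1) (sym (trans (count-everything (allVec (allFin m) (suc N))) (length-rows (suc N)))))
    ; largeY = ≤-reflexive (sym (trans (*-identityʳ _) (trans (count-everything (allVec columns (suc N)))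
        (trans (length-allVec columns (suc N)) (cong (_^ suc N) (length-cols {m} {n}))))))
    ; small = ≤-trans (≤-reflexive (cong (_* 3 ^ S) (leaves-reindex id id (λ o → Coding.decode b (o / 3)) T))) few-leaves
    }
    where
    2B≤m : 2 * B ≤ m
    2B≤m = ≤-trans (m≤n*m (2 * B) (4 * (2 + n))) (≤-trans (≤-reflexive (sym D≡)) (≤-trans (m≤n*m D 4) (≤-reflexive (sym m≡4D))))

  gsize-bound : (G : Calculus) → All (λ R → FocusedRule R × PPF R) (rules G) → CalculusForCPC G →
    (π : GProof G ((φ ∷ []) ⇛ (ψ ∷ []))) → 4 ^ S < gsize π * 3 ^ S
  gsize-bound G focused cpc π with toProtocol G focused cpc π (φ-left ∷ []) (ψ-right ∷ [])
  ... | T , small , sep with gsize π * 3 ^ S ≤? 4 ^ S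
  ...   | no gt = ≰⇒> gt
  ...   | yes le = ⊥-elim (contradiction S N (initial T (≤-trans (*-monoˡ-≤ (3 ^ S) small) le)
            (λ x y → sep x y (φ-true x ∷ []) (ψ-false y ∷ []))))

n<2^n : ∀ n → n < 2 ^ n
n<2^n zero = s≤s z≤n
n<2^n (suc n) = +-mono-≤ (m^n>0 2 n) (≤-trans (n<2^n n) (m≤m+n _ 0))

-- Choice of the parameters

module Choice (S : ℕ) where

  K lg M τ t β B m : ℕ
  K = 3 + S
  lg = 16 * K
  M = 2 + S + 31 * K
  τ = suc (K * lg)
  t = suc M * τ
  β = 2 + S + (1 + lg) * t * K
  B = (2 + S) * β
  m = suc M * B

  private
    record _≼_ (x a : ℕ) : Set where
      constructor bounded
      field bound : x ≤ 2 ^ (a * K)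
    open _≼_

    infixr 5 _⊗_
    _⊗_ : ∀ {x y a b} → x ≼ a → y ≼ b → (x * y) ≼ (a + b)
    _⊗_ {a = a} {b} (bounded h) (bounded g) = bounded (≤-trans (*-mono-≤ h g) (≤-reflexive
      (trans (sym (^-distribˡ-+-* 2 (a * K) (b * K))) (cong (2 ^_) (sym (*-distribʳ-+ K a b))))))

    below : ∀ {x y a} → x ≤ y → y ≼ a → x ≼ a
    below le (bounded h) = bounded (≤-trans le h)

    16k+16k≡32k : ∀ k → 16 * k + 16 * k ≡ 32 * k
    16k+16k≡32k = solve-∀

    K≼ : K ≼ 1
    K≼ = bounded (≤-trans (<⇒≤ (n<2^n K)) (≤-reflexive (cong (2 ^_) (sym (*-identityˡ K)))))

    32≼ : 32 ≼ 2
    32≼ = bounded (^-monoʳ-≤ 2 {5} (≤-trans (n≤1+n 5) (*-monoʳ-≤ 2 (m≤m+n 3 S))))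

    2+lg≼ : (2 + lg) ≼ 3
    2+lg≼ = below (≤-trans (+-monoˡ-≤ lg {2} {16 * K} (s≤s (s≤s z≤n))) (≤-reflexive (16k+16k≡32k K))) (32≼ ⊗ K≼)

    1+M≼ : suc M ≼ 3
    1+M≼ = 32≼ ⊗ K≼

    τ≼ : τ ≼ 4
    τ≼ = below (≤-trans (+-monoˡ-≤ (K * lg) {1} {K} (s≤s z≤n)) (≤-trans (≤-reflexive (sym (*-suc K lg)))
      (*-monoʳ-≤ K (n≤1+n (suc lg))))) (K≼ ⊗ 2+lg≼)

    β≼ : β ≼ 12
    β≼ = bounded (≤-trans
      (+-mono-≤ (≤-trans (n≤1+n (2 + S)) (≤-trans (bound K≼) (^-monoʳ-≤ 2 (*-monoˡ-≤ K {1} {11} (s≤s z≤n)))))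
                (bound ((below (n≤1+n (1 + lg)) 2+lg≼ ⊗ (1+M≼ ⊗ τ≼)) ⊗ K≼)))
      (≤-trans (≤-reflexive (cong (2 ^ (11 * K) +_) (sym (+-identityʳ (2 ^ (11 * K))))))
        (^-monoʳ-≤ 2 {suc (11 * K)} (+-monoˡ-≤ (11 * K) {1} {K} (s≤s z≤n)))))

    m≼ : m ≼ 16
    m≼ = 1+M≼ ⊗ (below (n≤1+n (2 + S)) K≼ ⊗ β≼)

    m≤2^lg : m ≤ 2 ^ lg
    m≤2^lg = bound m≼

    P E : ℕ
    P = (2 * m) ^ t
    E = 2 ^ S * P ^ K

    few : m ^ K * M ^ t < suc M ^ t
    few = begin-strict
      m ^ K * M ^ t         ≤⟨ *-monoˡ-≤ (M ^ t) (^-monoˡ-≤ K m≤2^lg) ⟩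
      (2 ^ lg) ^ K * M ^ t  ≡⟨ cong (_* M ^ t) (trans (^-*-assoc 2 lg K) (cong (2 ^_) (*-comm lg K))) ⟩
      2 ^ (K * lg) * M ^ t  <⟨ *-monoˡ-< (M ^ t) {{m^n≢0 M t}} {2 ^ (K * lg)} {2 ^ τ} (^-monoʳ-< 2 (s≤s (s≤s z≤n)) {K * lg} {τ} ≤-refl) ⟩
      2 ^ τ * M ^ t         ≤⟨ 2^b*a^≤[1+a]^ M τ ⟩
      suc M ^ t             ∎
      where open ≤-Reasoning

    4E≤ : 4 * E ≤ 2 ^ β
    4E≤ = begin
      4 * (2 ^ S * P ^ K)                        ≤⟨ *-monoʳ-≤ 4 (*-monoʳ-≤ (2 ^ S) (^-monoˡ-≤ K (^-monoˡ-≤ t (*-monoʳ-≤ 2 m≤2^lg)))) ⟩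
      4 * (2 ^ S * ((2 ^ (1 + lg)) ^ t) ^ K)     ≡⟨ cong (λ z → 4 * (2 ^ S * z)) (trans (cong (_^ K) (^-*-assoc 2 (1 + lg) t)) (^-*-assoc 2 ((1 + lg) * t) K)) ⟩
      2 ^ 2 * (2 ^ S * 2 ^ ((1 + lg) * t * K))   ≡⟨ *-assoc (2 ^ 2) (2 ^ S) _ ⟨
      2 ^ 2 * 2 ^ S * 2 ^ ((1 + lg) * t * K)     ≡⟨ cong (_* 2 ^ ((1 + lg) * t * K)) (^-distribˡ-+-* 2 2 S) ⟨
      2 ^ (2 + S) * 2 ^ ((1 + lg) * t * K)       ≡⟨ ^-distribˡ-+-* 2 (2 + S) _ ⟨
      2 ^ β                                      ∎
      where open ≤-Reasoning

  parameters : Parameters S (suc S)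
  parameters = record
    { m = m ; M = M ; β = β ; t = t ; B = B ; D = 4 * K * (2 * B) ; P = P ; E = E
    ; S≤n = n≤1+n S ; n>0 = s≤s z≤n ; B>0 = s≤s z≤n ; B≡ = refl ; m≡ = refl
    ; m≡4D = m≡4D ; D≡ = refl ; P≡ = refl ; E≡ = refl ; few = few ; 4E≤ = 4E≤ }
    where
    lem : ∀ k b → 32 * k * b ≡ 4 * (4 * k * (2 * b))
    lem = solve-∀
    m≡4D : suc M * B ≡ 4 * (4 * K * (2 * B))
    m≡4D = lem K B

-- Polynomially bounded functions

Poly : (ℕ → ℕ) → Set
Poly f = ∃ λ c → ∀ n → f n ≤ (2 + n) ^ c

constP : ∀ k → Poly (λ _ → k)
constP k = k , λ n → ≤-trans (<⇒≤ (n<2^n k)) (^-monoˡ-≤ k (m≤m+n 2 n))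

idP : Poly id
idP = 1 , λ n → ≤-trans (m≤n+m n 2) (≤-reflexive (sym (*-identityʳ (2 + n))))

infixl 6 _⊕_
infixl 7 _⊛_

_⊕_ : ∀ {f g} → Poly f → Poly g → Poly (λ n → f n + g n)
_⊕_ {f} {g} (c , hf) (d , hg) = suc (c + d) , λ n → begin
  f n + g n                                  ≤⟨ +-mono-≤ (≤-trans (hf n) (^-monoʳ-≤ (2 + n) (m≤m+n c d)))
                                                         (≤-trans (hg n) (^-monoʳ-≤ (2 + n) (m≤n+m d c))) ⟩
  (2 + n) ^ (c + d) + (2 + n) ^ (c + d)      ≡⟨ cong ((2 + n) ^ (c + d) +_) (+-identityʳ _) ⟨
  2 * (2 + n) ^ (c + d)                      ≤⟨ *-monoˡ-≤ ((2 + n) ^ (c + d)) (m≤m+n 2 n) ⟩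
  (2 + n) ^ suc (c + d)                      ∎
  where open ≤-Reasoning

_⊛_ : ∀ {f g} → Poly f → Poly g → Poly (λ n → f n * g n)
_⊛_ (c , hf) (d , hg) = c + d , λ n →
  ≤-trans (*-mono-≤ (hf n) (hg n)) (≤-reflexive (sym (^-distribˡ-+-* (2 + n) c d)))

1⊕_ : ∀ {f} → Poly f → Poly (λ n → suc (f n))
1⊕ p = constP 1 ⊕ p

-- Size of the formulas and of their proofs

atomSize clauseSize edgesSize rowsSize valuesSize topSize deadSize formulaSize edgeSteps clashSteps stepSteps steps budget proofSize : ℕ → ℕ → ℕ
atomSize N m = let b = suc (N + m) in 5 + (b + (b + (b + b * b) * b) * b) * 3
clauseSize N m = let s = suc (atomSize N m) in suc (s + suc (s + s))
edgesSize N m = suc (suc N * suc (suc (N * suc (suc (m * suc (suc (m * suc (clauseSize N m))))))))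
rowsSize N m = suc (suc N * suc (suc (m * suc (atomSize N m))))
valuesSize N m = suc (suc N * suc (suc (m * suc (suc (suc N * suc (atomSize N m))))))
topSize N m = suc (m * suc (suc (atomSize N m)))
deadSize N m = suc (m * suc (suc (atomSize N m + atomSize N m)))
formulaSize N m = 4 + (rowsSize N m + (edgesSize N m + (valuesSize N m + (topSize N m + deadSize N m))))
edgeSteps N m = suc N + (N + (m + m))
clashSteps N m = edgeSteps N m + (6 + (edgeSteps N m + 8))
stepSteps N m = suc N + suc (m * suc (suc N + (m + suc (suc N * suc (m + 3 + suc (m * suc (suc (clashSteps N m))))))))
steps N m = 4 + (suc N * suc (stepSteps N m) + suc (m * suc (suc (m + 2))))
budget N m = 2 + 2 * steps N m
proofSize N m = steps N m * ((4 + budget N m) * suc ((2 + budget N m) * formulaSize N m))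

module _ {N m : ℕ → ℕ} (pN : Poly N) (pm : Poly m) where

  private
    pb : Poly (λ n → suc (N n + m n))
    pb = 1⊕ (pN ⊕ pm)

    pAtom : Poly (λ n → atomSize (N n) (m n))
    pAtom = constP 5 ⊕ (pb ⊕ (pb ⊕ (pb ⊕ pb ⊛ pb) ⊛ pb) ⊛ pb) ⊛ constP 3

    pClause : Poly (λ n → clauseSize (N n) (m n))
    pClause = 1⊕ (1⊕ pAtom ⊕ 1⊕ (1⊕ pAtom ⊕ 1⊕ pAtom))

    pEdges : Poly (λ n → edgesSize (N n) (m n))
    pEdges = 1⊕ (1⊕ pN ⊛ 1⊕ 1⊕ (pN ⊛ 1⊕ 1⊕ (pm ⊛ 1⊕ 1⊕ (pm ⊛ 1⊕ pClause))))

    pFormula : Poly (λ n → formulaSize (N n) (m n))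
    pFormula = constP 4 ⊕ (1⊕ (1⊕ pN ⊛ 1⊕ 1⊕ (pm ⊛ 1⊕ pAtom)) ⊕
      (pEdges ⊕
      (1⊕ (1⊕ pN ⊛ 1⊕ 1⊕ (pm ⊛ 1⊕ 1⊕ (1⊕ pN ⊛ 1⊕ pAtom))) ⊕
      (1⊕ (pm ⊛ 1⊕ 1⊕ pAtom) ⊕
       1⊕ (pm ⊛ 1⊕ 1⊕ (pAtom ⊕ pAtom))))))

    pEdge : Poly (λ n → edgeSteps (N n) (m n))
    pEdge = 1⊕ pN ⊕ (pN ⊕ (pm ⊕ pm))

    pClash : Poly (λ n → clashSteps (N n) (m n))
    pClash = pEdge ⊕ (constP 6 ⊕ (pEdge ⊕ constP 8))

    pStep : Poly (λ n → stepSteps (N n) (m n))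
    pStep = 1⊕ pN ⊕ 1⊕ (pm ⊛ 1⊕ (1⊕ pN ⊕ (pm ⊕ 1⊕ (1⊕ pN ⊛ 1⊕ (pm ⊕ constP 3 ⊕ 1⊕ (pm ⊛ 1⊕ 1⊕ pClash))))))

    pSteps : Poly (λ n → steps (N n) (m n))
    pSteps = constP 4 ⊕ (1⊕ pN ⊛ 1⊕ pStep ⊕ 1⊕ (pm ⊛ 1⊕ 1⊕ (pm ⊕ constP 2)))

    pBudget : Poly (λ n → budget (N n) (m n))
    pBudget = constP 2 ⊕ constP 2 ⊛ pSteps

  proofSize-poly : Poly (λ n → proofSize (N n) (m n))
  proofSize-poly = pSteps ⊛ ((constP 4 ⊕ pBudget) ⊛ 1⊕ ((constP 2 ⊕ pBudget) ⊛ pFormula))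

rowCount-poly : ∀ {S} → Poly S → Poly (λ n → Choice.m (S n))
rowCount-poly {S} pS = p1+M ⊛ ((constP 2 ⊕ pS) ⊛ pβ)
  where
  pK : Poly (λ n → Choice.K (S n))
  pK = constP 3 ⊕ pS
  plg : Poly (λ n → Choice.lg (S n))
  plg = constP 16 ⊛ pK
  p1+M : Poly (λ n → suc (Choice.M (S n)))
  p1+M = 1⊕ (constP 2 ⊕ pS ⊕ constP 31 ⊛ pK)
  pβ : Poly (λ n → Choice.β (S n))
  pβ = constP 2 ⊕ pS ⊕ (1⊕ plg) ⊛ (p1+M ⊛ 1⊕ (pK ⊛ plg)) ⊛ pK

fsize-atom : ∀ k → fsize (atom k) ≤ 3 + k
fsize-atom k = s≤s (s≤s (≤-trans (⌊log₂⌋-mono-≤ (<⇒≤ (n<2^n (suc k)))) (≤-reflexive (⌊log₂[2^n]⌋≡n (suc k)))))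

module UpperBound (n m : ℕ) where
  open Game n m

  private
    s F ℓ : ℕ
    s = atomSize N m
    F = formulaSize N m
    ℓ = budget N m

    code≤ : ∀ {i a j c} → i ≤ N → a < m → j ≤ N → c < m → Coding.code b i a j c ≤ b + (b + (b + b * b) * b) * b
    code≤ i≤N a<m j≤N c<m =
      +-mono-≤ (node i≤N) (*-monoˡ-≤ b (+-mono-≤ (rowᵇ a<m) (*-monoˡ-≤ b (+-mono-≤ (node j≤N) (*-monoˡ-≤ b (rowᵇ c<m))))))
      where
      node : ∀ {i} → i ≤ N → i ≤ b
      node le = ≤-trans le (≤-trans (m≤m+n N m) (n≤1+n _))
      rowᵇ : ∀ {a} → a < m → a ≤ b
      rowᵇ lt = ≤-trans (<⇒≤ lt) (≤-trans (m≤n+m m N) (n≤1+n _))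

    atom≤ : ∀ d {k} → d ≤ 2 → k ≤ b + (b + (b + b * b) * b) * b → fsize (atom (d + k * 3)) ≤ s
    atom≤ d {k} d≤2 k≤ = ≤-trans (fsize-atom (d + k * 3)) (+-monoʳ-≤ 3 (+-mono-≤ d≤2 (*-monoˡ-≤ 3 k≤)))

    p≤ : ∀ {i a j c} → i ≤ N → a < m → j ≤ N → c < m → fsize (p i a j c) ≤ s
    p≤ i≤N a<m j≤N c<m = atom≤ 0 z≤n (code≤ i≤N a<m j≤N c<m)

    q≤ : ∀ {i a} → i ≤ N → a < m → fsize (q i a) ≤ s
    q≤ i≤N a<m = atom≤ 1 (s≤s z≤n) (code≤ i≤N a<m z≤n (≤-trans (s≤s z≤n) a<m))

    r≤ : ∀ {i a j} → i ≤ N → a < m → j ≤ N → fsize (r i a j) ≤ s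
    r≤ i≤N a<m j≤N = atom≤ 2 ≤-refl (code≤ i≤N a<m j≤N (≤-trans (s≤s z≤n) a<m))

    edges≤ : ∀ {f} → (∀ {i a j c} → i ≤ N → j ≤ N → a < m → c < m → fsize (f i a j c) ≤ clauseSize N m) →
      fsize (edges f) ≤ edgesSize N m
    edges≤ {f} h = fsize-bigAnd (suc N) λ i i<K → ≤-trans
      (fsize-bigAnd i λ j j<i → fsize-bigAnd m λ a a<m → fsize-bigAnd m λ c c<m →
        h (≤-pred i<K) (≤-trans (<⇒≤ j<i) (≤-pred i<K)) a<m c<m)
      (s≤s (*-monoˡ-≤ _ (≤-pred i<K)))

    rowsChosen≤ : fsize rowsChosen ≤ rowsSize N m
    rowsChosen≤ = fsize-bigAnd (suc N) λ i i<K → fsize-bigOr m {q i} λ a a<m → q≤ (≤-pred i<K) a<m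

    rowsLinked≤ : fsize rowsLinked ≤ edgesSize N m
    rowsLinked≤ = edges≤ λ i≤N j≤N a<m c<m → s≤s (+-mono-≤ (s≤s (q≤ i≤N a<m))
      (s≤s (+-mono-≤ (s≤s (q≤ j≤N c<m)) (≤-trans (p≤ i≤N a<m j≤N c<m) (n≤1+n s)))))

    valuesChosen≤ : fsize valuesChosen ≤ valuesSize N m
    valuesChosen≤ = fsize-bigAnd (suc N) λ i i<K → fsize-bigAnd m λ a a<m → ≤-trans
      (fsize-bigOr (suc i) {r i a} λ j j<1+i → r≤ (≤-pred i<K) a<m (≤-trans (≤-pred j<1+i) (≤-pred i<K)))
      (s≤s (*-monoˡ-≤ (suc s) i<K))

    linksSound≤ : fsize linksSound ≤ edgesSize N m
    linksSound≤ = edges≤ λ i≤N j≤N a<m c<m → s≤s (+-mono-≤ (s≤s (p≤ i≤N a<m j≤N c<m))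
      (s≤s (+-mono-≤ (s≤s (r≤ i≤N a<m j≤N)) (s≤s (r≤ j≤N c<m j≤N)))))

    topAlive≤ : fsize topAlive ≤ topSize N m
    topAlive≤ = fsize-bigAnd m λ a a<m → s≤s (r≤ ≤-refl a<m ≤-refl)

    dead≤ : ∀ i → i ≤ N → fsize (dead i) ≤ deadSize N m
    dead≤ i i≤N = fsize-bigOr m λ a a<m → s≤s (+-mono-≤ (q≤ i≤N a<m) (r≤ i≤N a<m i≤N))

    module _ (e₁ e₂ e₃ e₄ e₅ : ℕ) where
      φ-part : suc (e₁ + e₂) ≤ 4 + (e₁ + (e₂ + (e₃ + (e₄ + e₅))))
      φ-part = ≤-trans (m≤m+n _ (3 + (e₃ + (e₄ + e₅)))) (≤-reflexive (lem e₁ e₂ (e₃ + (e₄ + e₅))))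
        where
        lem : ∀ a b c → suc (a + b) + (3 + c) ≡ 4 + (a + (b + c))
        lem = solve-∀
      ψ-part : suc (suc (e₃ + suc (e₂ + e₄))) ≤ 4 + (e₁ + (e₂ + (e₃ + (e₄ + e₅))))
      ψ-part = ≤-trans (m≤m+n _ (1 + (e₁ + e₅))) (≤-reflexive (lem e₁ e₂ e₃ e₄ e₅))
        where
        lem : ∀ a b c d e → suc (suc (c + suc (b + d))) + (1 + (a + e)) ≡ 4 + (a + (b + (c + (d + e))))
        lem = solve-∀
      dead-part : e₅ ≤ 4 + (e₁ + (e₂ + (e₃ + (e₄ + e₅))))
      dead-part = ≤-trans (m≤n+m e₅ (4 + (e₁ + (e₂ + (e₃ + e₄))))) (≤-reflexive (lem e₁ e₂ e₃ e₄ e₅))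
        where
        lem : ∀ a b c d e → 4 + (a + (b + (c + d))) + e ≡ 4 + (a + (b + (c + (d + e))))
        lem = solve-∀

    φ≤F : fsize φ ≤ F
    φ≤F = ≤-trans (s≤s (+-mono-≤ rowsChosen≤ rowsLinked≤)) (φ-part (rowsSize N m) (edgesSize N m) (valuesSize N m) (topSize N m) (deadSize N m))

    ψ≤F : fsize ψ ≤ F
    ψ≤F = ≤-trans (s≤s (s≤s (+-mono-≤ valuesChosen≤ (s≤s (+-mono-≤ linksSound≤ topAlive≤)))))
      (ψ-part (rowsSize N m) (edgesSize N m) (valuesSize N m) (topSize N m) (deadSize N m))

    dead≤F : ∀ i → i ≤ N → fsize (dead i) ≤ F
    dead≤F i i≤N = ≤-trans (dead≤ i i≤N) (dead-part (rowsSize N m) (edgesSize N m) (valuesSize N m) (topSize N m) (deadSize N m))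

    loopW≡ : ∀ d → loopW d ≡ d * suc stepW + loopW 0
    loopW≡ zero = refl
    loopW≡ (suc d) = cong suc (trans (cong (stepW +_) (loopW≡ d)) (sym (+-assoc stepW (d * suc stepW) (loopW 0))))

    proof-tableau : Tableau F (φ ∷ []) (ψ ∷ []) (steps N m)
    proof-tableau = relax (≤-reflexive (cong (4 +_) (loopW≡ (suc N)))) (tableau dead≤F)

  valid : Valid ((φ ∷ []) ⇛ (ψ ∷ []))
  valid = unrefuted⇒valid {(φ ∷ []) ⇛ (ψ ∷ [])} (tableau-sound proof-tableau)

  lk-proof : LK≤ (proofSize N m) ((φ ∷ []) ⇛ (ψ ∷ []))
  lk-proof = ToLK.toLK F ℓ proof-tableau (φ≤F ∷ []) (ψ≤F ∷ []) ≤-refl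

2^n≤ : ∀ n g → 4 ^ (3 * n) < g * 3 ^ (3 * n) → 2 ^ n ≤ g
2^n≤ n g lt with 2 ^ n ≤? g
... | yes le = le
... | no gt = ⊥-elim (<⇒≱ lt (begin
  g * 3 ^ (3 * n)       ≤⟨ *-monoˡ-≤ (3 ^ (3 * n)) (<⇒≤ (≰⇒> gt)) ⟩
  2 ^ n * 3 ^ (3 * n)   ≡⟨ cong (2 ^ n *_) (^-*-assoc 3 3 n) ⟨
  2 ^ n * 27 ^ n        ≡⟨ ^-distribʳ-* n 2 27 ⟨
  54 ^ n                ≤⟨ ^-monoˡ-≤ n (m≤m+n 54 10) ⟩
  64 ^ n                ≡⟨ ^-*-assoc 4 3 n ⟩
  4 ^ (3 * n)           ∎))
  where open ≤-Reasoning

theorem5p10 : (G : Calculus) →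
    All FocusedAxiom (axioms G) →
    All (λ R → FocusedRule R × PPF R) (rules G) →
    CalculusForCPC G →
    Σ (ℕ → Fm) λ φ → Σ (ℕ → Fm) λ ψ →
    (∀ n → Valid ((φ n ∷ []) ⇛ (ψ n ∷ []))) ×
    (∃ λ c → ∀ n → Σ (LK ((φ n ∷ []) ⇛ (ψ n ∷ []))) λ π → lksize π ≤ (2 + n) ^ c) ×
    (∃ λ c → ∀ n → (π : GProof G ((φ n ∷ []) ⇛ (ψ n ∷ []))) → 2 ^ n ≤ gsize π ^ c)
theorem5p10 G _ focused cpc =
  (λ n → Game.φ (suc (3 * n)) (rows n)) , (λ n → Game.ψ (suc (3 * n)) (rows n)) ,
  (λ n → UpperBound.valid (suc (3 * n)) (rows n)) ,
  (proj₁ short , λ n → let π , le = UpperBound.lk-proof (suc (3 * n)) (rows n) in π , ≤-trans le (proj₂ short n)) ,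
  (1 , λ n π → ≤-trans
    (2^n≤ n (gsize π) (LowerBound.gsize-bound (Choice.parameters (3 * n)) G focused cpc π))
    (≤-reflexive (sym (*-identityʳ (gsize π)))))
  where
  rows : ℕ → ℕ
  rows n = Choice.m (3 * n)
  3n : Poly (λ n → 3 * n)
  3n = constP 3 ⊛ idP
  short : Poly (λ n → proofSize (suc (suc (3 * n))) (rows n))
  short = proofSize-poly (1⊕ 1⊕ 3n) (rowCount-poly 3n)
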